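{- Given an arrival time function $a:(-\infty,t_{\max}]\to\mathbb{R}$ with $b$ breakpoints (as a sorted breakpoint list) and $\varepsilon>0$, one can compute in $O(b)$ time an arrival time function $a':(-\infty,t_{\max}]\to\mathbb{R}$ with $a(t)\le a'(t)\le a(t)+\varepsilon$ for all $t\le t_{\max}$ such that $a'$ has the fewest possible number of breakpoints among all continuous piecewise linear functions $g$ on $(-\infty,t_{\max}]$ with $a\le g\le a+\varepsilon$ (in particular, $a'$ is non-decreasing).
   Context: An arrival time function (ATF) is a piecewise linear function $a:(-\infty,t_{\max}]\to\mathbb{R}$, for some $t_{\max}\in\mathbb{R}$, such that (1) $a$ is continuous, (2) $a$ is non-decreasing, (3) $a(t)\ge t$ for all $t\le t_{\max}$, and (4) there is $t_{\min}\le t_{\max}$ with $a(t)=a(t_{\min})$ for all $t\le t_{\min}$. An ATF is represented by a sorted sequence of breakpoints $(t_i,a(t_i))$, $i=1,\dots,b$, with $t_1=t_{\min}$, $t_b=t_{\max}$, $t_i<t_{i+1}$, $a$ affine between consecutive breakpoints and constant before $t_1$; one says $a$ has $b$ breakpoints. The slope changes at every breakpoint other than the last. -}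

module Defs where

open import Level using (Level; _⊔_)
open import Algebra.Core using (Op₁; Op₂)
open import Algebra.Structures using (IsCommutativeRing)
open import Data.Bool using (Bool; true; false; not; _∧_; if_then_else_)
open import Data.Fin using (Fin; zero; suc; toℕ; fromℕ; inject₁)
open import Data.Nat as ℕ using (ℕ; zero; suc)
open import Data.Product using (_×_; _,_; ∃; ∃₂)
open import Relation.Binary using (Rel; IsDecTotalOrder)
open import Relation.Binary.PropositionalEquality using (_≡_; _≢_)
open import Relation.Nullary using (does)

-- The standard library has no real numbers.  The scalars are an arbitrary
-- linearly ordered field whose order is decidable, i.e. what a real RAM assumes
-- of ℝ; (classically) ℝ is an instance.

record OrderedField (c ℓ : Level) : Set (Level.suc (c ⊔ ℓ)) where
  infix  8 _⁻¹ -_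
  infixl 7 _*_
  infixl 6 _+_ _-_
  infix  4 _≤_ _<_
  field
    Carrier : Set c
    _+_ _*_ : Op₂ Carrier
    -_      : Op₁ Carrier
    _⁻¹     : Op₁ Carrier
    0# 1#   : Carrier
    _≤_     : Rel Carrier ℓ
    isCommutativeRing : IsCommutativeRing _≡_ _+_ _*_ -_ 0# 1#
    isDecTotalOrder   : IsDecTotalOrder _≡_ _≤_
    0≢1        : 0# ≢ 1#
    *-inverseʳ : ∀ x → x ≢ 0# → x * x ⁻¹ ≡ 1#
    -- Convention making the inverse total.
    0⁻¹≡0      : 0# ⁻¹ ≡ 0#
    +-monoˡ-≤  : ∀ {x y} z → x ≤ y → x + z ≤ y + z
    *-nonNeg   : ∀ {x y} → 0# ≤ x → 0# ≤ y → 0# ≤ x * y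

  open IsDecTotalOrder isDecTotalOrder public using (_≤?_)

  _-_ : Op₂ Carrier
  x - y = x + (- y)

  _<_ : Rel Carrier (c ⊔ ℓ)
  x < y = x ≤ y × x ≢ y

------------------------------------------------------------------------
-- Piecewise linear functions on (-∞, tmax]
--
-- A function (-∞, tmax] → F is a function on F about whose values beyond tmax
-- nothing is ever said.

module PiecewiseLinear {c ℓ} (F : OrderedField c ℓ) where
  open OrderedField F

  AffineOn : (Carrier → Set ℓ) → (Carrier → Carrier) → Carrier → Set (c ⊔ ℓ)
  AffineOn I f slope = ∃ λ k → ∀ x → I x → f x ≡ slope * x + k

  -- Breakpoints t 0 < … < t n cut (-∞, t n] into n + 1 pieces; piece i is the
  -- one that ends at t i, so piece 0 is unbounded.
  Piece : ∀ {n} → (Fin (suc n) → Carrier) → Fin (suc n) → Carrier → Set ℓ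
  Piece             t zero    x = x ≤ t zero
  Piece {n = suc _} t (suc i) x = t (inject₁ i) ≤ x × x ≤ t (suc i)

  -- f is piecewise linear on (-∞, tmax] and its breakpoints are exactly the
  -- b = n + 1 points t 0, …, t n: the slope changes at each of them except at
  -- the last one, which is tmax.  The slope of the unbounded piece is arbitrary.
  record HasBreakpoints (f : Carrier → Carrier) (tmax : Carrier)
                        {n : ℕ} (t : Fin (suc n) → Carrier) : Set (c ⊔ ℓ) where
    field
      sorted : ∀ (i : Fin n) → t (inject₁ i) < t (suc i)
      last   : t (fromℕ n) ≡ tmax
      slope  : Fin (suc n) → Carrier
      affine : ∀ i → AffineOn (Piece t i) f (slope i)
      bends  : ∀ (i : Fin n) → slope (inject₁ i) ≢ slope (suc i)

  Continuous : Carrier → (Carrier → Carrier) → Set (c ⊔ ℓ)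
  Continuous tmax f =
    ∀ x → x ≤ tmax → ∀ e → 0# < e →
    ∃ λ δ → 0# < δ ×
      (∀ y → y ≤ tmax → x - δ < y → y < x + δ → f x - e < f y × f y < f x + e)

  record IsATF (tmax : Carrier) (a : Carrier → Carrier) : Set (c ⊔ ℓ) where
    field
      piecewiseLinear    : ∃₂ λ n (t : Fin (suc n) → Carrier) → HasBreakpoints a tmax t
      continuous         : Continuous tmax a
      nonDecreasing      : ∀ s t → s ≤ t → t ≤ tmax → a s ≤ a t
      notBeforeDeparture : ∀ t → t ≤ tmax → t ≤ a t
      initiallyConstant  : ∃ λ tmin → tmin ≤ tmax × (∀ t → t ≤ tmin → a t ≡ a tmin)

  -- a ≤ g ≤ a + ε on (-∞, tmax]
  Within : Carrier → Carrier → (a g : Carrier → Carrier) → Set (c ⊔ ℓ)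
  Within tmax ε a g = ∀ t → t ≤ tmax → a t ≤ g t × g t ≤ a t + ε

  -- No continuous piecewise linear g with a ≤ g ≤ a + ε has fewer than b breakpoints.
  FewestBreakpoints : Carrier → Carrier → (a : Carrier → Carrier) → ℕ → Set (c ⊔ ℓ)
  FewestBreakpoints tmax ε a b =
    ∀ (g : Carrier → Carrier) {n} (t : Fin (suc n) → Carrier) →
    HasBreakpoints g tmax t → Continuous tmax g → Within tmax ε a g → b ℕ.≤ suc n

------------------------------------------------------------------------
-- A real RAM, programmed by structured programs
--
-- Memory consists of natural-number registers (for indices and counters) and of
-- arrays of scalars, addressed by the values of index expressions.  Every
-- operation, test and memory access has unit cost.  Registers can only be copied,
-- incremented and decremented, and scalars cannot be turned into indices, so
-- that unit cost is not abused: a run of k steps uses indices of size O(b + k).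
-- The only scalar constants are 0 and 1.

data IExp : Set where
  lit     : ℕ → IExp
  reg     : ℕ → IExp
  inc dec : IExp → IExp

data SExp : Set where
  zero one        : SExp
  _[_]            : (array : ℕ) → IExp → SExp
  _⊕_ _⊖_ _⊗_ _⊘_ : SExp → SExp → SExp

data BExp : Set where
  _≤ᴵ_  : IExp → IExp → BExp
  _≤ˢ_  : SExp → SExp → BExp
  neg   : BExp → BExp
  _and_ : BExp → BExp → BExp

data Program : Set where
  skip          : Program
  _≔_           : (register : ℕ) → IExp → Program
  _[_]≔_        : (array : ℕ) → IExp → SExp → Program
  _⨾_           : Program → Program → Program
  IF_THEN_ELSE_ : BExp → Program → Program → Program
  WHILE_DO_     : BExp → Program → Program

infix  9 _[_]
infixl 8 _⊗_ _⊘_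
infixl 7 _⊕_ _⊖_
infix  6 _≤ᴵ_ _≤ˢ_ _≔_ _[_]≔_
infixr 5 _and_
infix  4 IF_THEN_ELSE_ WHILE_DO_
infixr 3 _⨾_

costᴵ : IExp → ℕ
costᴵ (lit _) = 1
costᴵ (reg _) = 1
costᴵ (inc e) = suc (costᴵ e)
costᴵ (dec e) = suc (costᴵ e)

costˢ : SExp → ℕ
costˢ zero      = 1
costˢ one       = 1
costˢ (_ [ i ]) = suc (costᴵ i)
costˢ (e ⊕ e′)  = suc (costˢ e ℕ.+ costˢ e′)
costˢ (e ⊖ e′)  = suc (costˢ e ℕ.+ costˢ e′)
costˢ (e ⊗ e′)  = suc (costˢ e ℕ.+ costˢ e′)
costˢ (e ⊘ e′)  = suc (costˢ e ℕ.+ costˢ e′)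

costᴮ : BExp → ℕ
costᴮ (e ≤ᴵ e′)  = suc (costᴵ e ℕ.+ costᴵ e′)
costᴮ (e ≤ˢ e′)  = suc (costˢ e ℕ.+ costˢ e′)
costᴮ (neg e)    = suc (costᴮ e)
costᴮ (e and e′) = suc (costᴮ e ℕ.+ costᴮ e′)

module RealRAM {c ℓ} (F : OrderedField c ℓ) where
  open OrderedField F

  record Store : Set c where
    constructor store
    field
      register : ℕ → ℕ
      array    : ℕ → ℕ → Carrier
  open Store public

  update : ∀ {a} {A : Set a} → (ℕ → A) → ℕ → A → ℕ → A
  update f i v j = if does (j ℕ.≟ i) then v else f j

  setRegister : Store → ℕ → ℕ → Store
  setRegister σ r v = store (update (register σ) r v) (array σ)

  setCell : Store → ℕ → ℕ → Carrier → Store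
  setCell σ m i v =
    store (register σ) (update (array σ) m (update (array σ m) i v))

  ⟦_⟧ᴵ : IExp → Store → ℕ
  ⟦ lit n ⟧ᴵ σ = n
  ⟦ reg r ⟧ᴵ σ = register σ r
  ⟦ inc e ⟧ᴵ σ = suc (⟦ e ⟧ᴵ σ)
  ⟦ dec e ⟧ᴵ σ = ℕ.pred (⟦ e ⟧ᴵ σ)

  ⟦_⟧ˢ : SExp → Store → Carrier
  ⟦ zero ⟧ˢ    σ = 0#
  ⟦ one ⟧ˢ     σ = 1#
  ⟦ m [ i ] ⟧ˢ σ = array σ m (⟦ i ⟧ᴵ σ)
  ⟦ e ⊕ e′ ⟧ˢ  σ = ⟦ e ⟧ˢ σ + ⟦ e′ ⟧ˢ σ
  ⟦ e ⊖ e′ ⟧ˢ  σ = ⟦ e ⟧ˢ σ - ⟦ e′ ⟧ˢ σ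
  ⟦ e ⊗ e′ ⟧ˢ  σ = ⟦ e ⟧ˢ σ * ⟦ e′ ⟧ˢ σ
  ⟦ e ⊘ e′ ⟧ˢ  σ = ⟦ e ⟧ˢ σ * (⟦ e′ ⟧ˢ σ) ⁻¹

  ⟦_⟧ᴮ : BExp → Store → Bool
  ⟦ e ≤ᴵ e′ ⟧ᴮ  σ = does (⟦ e ⟧ᴵ σ ℕ.≤? ⟦ e′ ⟧ᴵ σ)
  ⟦ e ≤ˢ e′ ⟧ᴮ  σ = does (⟦ e ⟧ˢ σ ≤? ⟦ e′ ⟧ˢ σ)
  ⟦ neg e ⟧ᴮ    σ = not (⟦ e ⟧ᴮ σ)
  ⟦ e and e′ ⟧ᴮ σ = ⟦ e ⟧ᴮ σ ∧ ⟦ e′ ⟧ᴮ σ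

  -- p , σ ⇓[ k ] σ′ : started in σ, p halts in σ′ after k steps.
  infix 2 _,_⇓[_]_
  data _,_⇓[_]_ : Program → Store → ℕ → Store → Set c where
    skip : ∀ {σ} → skip , σ ⇓[ 1 ] σ

    assign : ∀ {σ r e} →
      r ≔ e , σ ⇓[ suc (costᴵ e) ] setRegister σ r (⟦ e ⟧ᴵ σ)

    write : ∀ {σ m i e} →
      m [ i ]≔ e , σ ⇓[ suc (costᴵ i ℕ.+ costˢ e) ] setCell σ m (⟦ i ⟧ᴵ σ) (⟦ e ⟧ˢ σ)

    seq : ∀ {σ σ′ σ″ p q j k} →
      p , σ ⇓[ j ] σ′ → q , σ′ ⇓[ k ] σ″ → p ⨾ q , σ ⇓[ j ℕ.+ k ] σ″

    if-true : ∀ {σ σ′ b p q k} →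
      ⟦ b ⟧ᴮ σ ≡ true → p , σ ⇓[ k ] σ′ →
      IF b THEN p ELSE q , σ ⇓[ suc (costᴮ b ℕ.+ k) ] σ′

    if-false : ∀ {σ σ′ b p q k} →
      ⟦ b ⟧ᴮ σ ≡ false → q , σ ⇓[ k ] σ′ →
      IF b THEN p ELSE q , σ ⇓[ suc (costᴮ b ℕ.+ k) ] σ′

    while-true : ∀ {σ σ′ σ″ b p j k} →
      ⟦ b ⟧ᴮ σ ≡ true → p , σ ⇓[ j ] σ′ → WHILE b DO p , σ′ ⇓[ k ] σ″ →
      WHILE b DO p , σ ⇓[ suc (costᴮ b ℕ.+ (j ℕ.+ k)) ] σ″

    while-false : ∀ {σ b p} →
      ⟦ b ⟧ᴮ σ ≡ false → WHILE b DO p , σ ⇓[ suc (costᴮ b) ] σ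

  -- The breakpoint list (t i , f (t i)) is stored as its length in register 0,
  -- abscissae in array 0 and ordinates in array 1.
  record StoresBreakpoints (σ : Store) (f : Carrier → Carrier)
                           {n : ℕ} (t : Fin (suc n) → Carrier) : Set c where
    field
      length    : register σ 0 ≡ suc n
      abscissae : ∀ i → array σ 0 (toℕ i) ≡ t i
      ordinates : ∀ i → array σ 1 (toℕ i) ≡ f (t i)

  StoresScalar : Store → Carrier → Set c
  StoresScalar σ ε = array σ 2 0 ≡ ε

{-# OPTIONS --safe #-}

-- The graphs of a and a + ε bound a corridor, and a function with few breakpoints is a path with few links
-- in it.  The links are chosen greedily.  The first one is the highest horizontal line; every further one is
-- the line that meets the previous link inside its window (from its last contact with one wall to the point
-- where it runs into the opposite wall) and stays longest in the corridor.  Such a line touches a wall, then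
-- the opposite wall, and then runs into the first wall; hence no line through the same window lies beyond it
-- afterwards, which gives optimality by induction on the number of links, and, as a is non-decreasing, it rises.
--
-- Lines through a window form a wedge between two extreme ones, each of which turns about the convex hull of
-- the wall below it (after O'Rourke).  The two walls are treated alike: a line is seen from its side, the upper
-- wall upside down, and the program exchanges the roles of the sides after every point.  A hull vertex that is
-- skipped by a turning line or hidden by a new point never returns, which makes the running time linear.

module Submission where

open import Defs
open import Algebra.Bundles using (CommutativeRing; RawRing)
import Algebra.Properties.AbelianGroup as AbelianGroupProperties
import Algebra.Properties.Ring as RingProperties
import Algebra.Properties.Semiring.Mult as SemiringMult
import Algebra.Solver.Ring as RingSolver
open import Algebra.Solver.Ring.AlmostCommutativeRing using (fromCommutativeRing; _-Raw-AlmostCommutative⟶_)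
open import Data.Bool as 𝔹 using (Bool; true; false; _∧_; not)
open import Data.Empty using (⊥; ⊥-elim)
open import Data.Fin using (Fin; toℕ; inject₁; fromℕ; fromℕ<) renaming (zero to fzero; suc to fsuc)
import Data.Fin.Properties as Finₚ
open import Data.Integer as ℤ using (ℤ; -[1+_]) renaming (+_ to pos)
import Data.Integer.Properties as ℤₚ
open import Data.Maybe using (Maybe; just; nothing)
open import Data.Nat as ℕ using (ℕ; zero; suc)
import Data.Nat.Properties as ℕ
open import Data.Nat.Solver using (module +-*-Solver)
open import Data.Product using (_×_; _,_; proj₁; proj₂; ∃; ∃-syntax; Σ-syntax)
open import Data.Sum using (_⊎_; inj₁; inj₂)
open import Data.Unit using (⊤; tt)
open import Function using (_∘_)
open import Level using (_⊔_)
open import Relation.Binary using (IsDecTotalOrder; Tri; tri<; tri≈; tri>)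
open import Relation.Binary.PropositionalEquality hiding ([_])
open import Relation.Nullary using (¬_; yes; no; Dec; does)

-- A bound on the breakpoints of a competitor is too weak for the induction. The competitor may bend
-- before the window ends, and its next line is constrained only from that bend on. `Reach`
-- therefore also records that this line, if it gets past `q`, respects the walls when it is
-- extended back to the start of the window; this makes it comparable with the greedy link. The base
-- case rests on the unbounded piece: `a` is constant there, so a line that stays within `ε` of it
-- is horizontal. A window usually ends between two breakpoints. Its end becomes an artificial hull
-- vertex, and an extreme line of the new wedge may have its second contact at a point that is not
-- processed yet; hence the two cases `Touch` and `Pending`. A link that is blocked by a wall rises
-- because of the contacts before the block. The last link is not blocked by anything; it is taken
-- to be the extreme line that touches the lower wall and afterwards the upper one, so that it rises
-- as well.

module Geometry {c ℓ} (F : OrderedField c ℓ) where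
  open OrderedField F
  open PiecewiseLinear F using (Continuous)
  open RealRAM F using (update)

  -- A ring solver with integer coefficients

  commutativeRing : CommutativeRing c c
  commutativeRing = record { isCommutativeRing = isCommutativeRing }

  module CR = CommutativeRing commutativeRing
  open RingProperties CR.ring using (-‿distribˡ-*; -‿involutive; -0#≈0#)
  open AbelianGroupProperties CR.+-abelianGroup using (⁻¹-∙-comm)
  open SemiringMult CR.semiring using (×-homo-+; ×1-homo-*) renaming (_×_ to _·_)

  -- Coefficients are integers because their equality computes; the solver can then collect and
  -- cancel terms, and its identities hold by `refl`.
  fromℤ : ℤ → Carrier
  fromℤ (pos n)      = n · 1#
  fromℤ (-[1+ n ]) = - (suc n · 1#)

  private
    open ≡-Reasoning
    assoc-swap : ∀ x y z → (x + y) + (- (x + z)) ≡ y + (- z)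
    assoc-swap x y z = begin
      (x + y) + (- (x + z))     ≡⟨ cong₂ _+_ (CR.+-comm x y) (sym (⁻¹-∙-comm x z)) ⟩
      (y + x) + (- x + - z)     ≡⟨ CR.+-assoc y x _ ⟩
      y + (x + (- x + - z))     ≡⟨ cong (y +_) (sym (CR.+-assoc x (- x) (- z))) ⟩
      y + ((x + - x) + - z)     ≡⟨ cong (λ w → y + (w + - z)) (CR.-‿inverseʳ x) ⟩
      y + (0# + - z)            ≡⟨ cong (y +_) (CR.+-identityˡ (- z)) ⟩
      y + - z                   ∎

  fromℤ-⊖ : ∀ m n → fromℤ (m ℤ.⊖ n) ≡ m · 1# - n · 1#
  fromℤ-⊖ zero    zero    = sym (CR.-‿inverseʳ 0#)
  fromℤ-⊖ zero    (suc n) = sym (CR.+-identityˡ _)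
  fromℤ-⊖ (suc m) zero    = sym (trans (cong (suc m · 1# +_) -0#≈0#) (CR.+-identityʳ _))
  fromℤ-⊖ (suc m) (suc n) = begin
    fromℤ (suc m ℤ.⊖ suc n)      ≡⟨ cong fromℤ (ℤₚ.[1+m]⊖[1+n]≡m⊖n m n) ⟩
    fromℤ (m ℤ.⊖ n)              ≡⟨ fromℤ-⊖ m n ⟩
    m · 1# - n · 1#              ≡⟨ sym (assoc-swap 1# _ _) ⟩
    suc m · 1# - suc n · 1#      ∎

  fromℤ-neg : ∀ i → fromℤ (ℤ.- i) ≡ - fromℤ i
  fromℤ-neg (pos zero)   = sym -0#≈0#
  fromℤ-neg (pos (suc n))  = refl
  fromℤ-neg (-[1+ n ]) = sym (-‿involutive _)

  fromℤ-+ : ∀ i j → fromℤ (i ℤ.+ j) ≡ fromℤ i + fromℤ j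
  fromℤ-+ (pos m)      (pos n)      = ×-homo-+ 1# m n
  fromℤ-+ (pos m)      (-[1+ n ]) = fromℤ-⊖ m (suc n)
  fromℤ-+ (-[1+ m ]) (pos n)      = trans (fromℤ-⊖ n (suc m)) (CR.+-comm _ _)
  fromℤ-+ (-[1+ m ]) (-[1+ n ]) = trans
    (cong -_ (trans (cong (λ k → suc k · 1#) (sym (ℕ.+-suc m n))) (×-homo-+ 1# (suc m) (suc n))))
    (sym (⁻¹-∙-comm _ _))

  fromℤ-+* : ∀ m j → fromℤ (pos m ℤ.* j) ≡ m · 1# * fromℤ j
  fromℤ-+* zero    j = trans (cong fromℤ (ℤₚ.*-zeroˡ j)) (sym (CR.zeroˡ _))
  fromℤ-+* (suc m) j = begin
    fromℤ (pos (suc m) ℤ.* j)            ≡⟨ cong fromℤ (ℤₚ.suc-* (pos m) j) ⟩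
    fromℤ (j ℤ.+ pos m ℤ.* j)          ≡⟨ fromℤ-+ j (pos m ℤ.* j) ⟩
    fromℤ j + fromℤ (pos m ℤ.* j)      ≡⟨ cong (fromℤ j +_) (fromℤ-+* m j) ⟩
    fromℤ j + m · 1# * fromℤ j       ≡⟨ cong (_+ m · 1# * fromℤ j) (sym (CR.*-identityˡ _)) ⟩
    1# * fromℤ j + m · 1# * fromℤ j  ≡⟨ sym (CR.distribʳ _ _ _) ⟩
    suc m · 1# * fromℤ j             ∎

  fromℤ-* : ∀ i j → fromℤ (i ℤ.* j) ≡ fromℤ i * fromℤ j
  fromℤ-* (pos m)      j = fromℤ-+* m j
  fromℤ-* (-[1+ m ]) j = begin
    fromℤ (-[1+ m ] ℤ.* j)         ≡⟨ cong fromℤ (sym (ℤₚ.neg-distribˡ-* (pos (suc m)) j)) ⟩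
    fromℤ (ℤ.- (pos (suc m) ℤ.* j))    ≡⟨ fromℤ-neg (pos (suc m) ℤ.* j) ⟩
    - fromℤ (pos (suc m) ℤ.* j)        ≡⟨ cong -_ (fromℤ-+* (suc m) j) ⟩
    - (suc m · 1# * fromℤ j)       ≡⟨ -‿distribˡ-* _ _ ⟩
    - (suc m · 1#) * fromℤ j       ∎

  private
    ℤ-rawRing : RawRing _ _
    ℤ-rawRing = record { Carrier = ℤ ; _≈_ = _≡_ ; _+_ = ℤ._+_ ; _*_ = ℤ._*_
                       ; -_ = ℤ.-_ ; 0# = pos 0 ; 1# = pos 1 }

    fromℤ-morphism : ℤ-rawRing -Raw-AlmostCommutative⟶ fromCommutativeRing commutativeRing
    fromℤ-morphism = record
      { ⟦_⟧ = fromℤ ; +-homo = fromℤ-+ ; *-homo = fromℤ-* ; -‿homo = fromℤ-neg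
      ; 0-homo = refl ; 1-homo = CR.+-identityʳ 1# }

    coeff≟ : ∀ i j → Maybe (fromℤ i ≡ fromℤ j)
    coeff≟ i j with i ℤ.≟ j
    ... | yes eq = just (cong fromℤ eq)
    ... | no _   = nothing

  open RingSolver ℤ-rawRing (fromCommutativeRing commutativeRing) fromℤ-morphism coeff≟ public
    using (solve; _:+_; _:*_; _:-_; :-_; _:=_; con)

  -- Order reasoning in an ordered field

  open IsDecTotalOrder isDecTotalOrder public
    using (_≟_; total)
    renaming (refl to ≤-refl; reflexive to ≤-reflexive; trans to ≤-trans; antisym to ≤-antisym)

  ≰⇒< : ∀ {x y} → ¬ (x ≤ y) → y < x
  ≰⇒< {x} {y} x≰y with total x y
  ... | inj₁ x≤y = ⊥-elim (x≰y x≤y)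
  ... | inj₂ y≤x = y≤x , λ { refl → x≰y ≤-refl }

  <⇒≤ : ∀ {x y} → x < y → x ≤ y
  <⇒≤ = proj₁

  <⇒≱ : ∀ {x y} → x < y → ¬ (y ≤ x)
  <⇒≱ (x≤y , x≢y) y≤x = x≢y (≤-antisym x≤y y≤x)

  <-irrefl : ∀ {x} → ¬ (x < x)
  <-irrefl (_ , x≢x) = x≢x refl

  ≤-<-trans : ∀ {x y z} → x ≤ y → y < z → x < z
  ≤-<-trans x≤y y<z = ≤-trans x≤y (<⇒≤ y<z) , λ { refl → <⇒≱ y<z x≤y }

  <-≤-trans : ∀ {x y z} → x < y → y ≤ z → x < z
  <-≤-trans x<y y≤z = ≤-trans (<⇒≤ x<y) y≤z , λ { refl → <⇒≱ x<y y≤z }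

  <-trans : ∀ {x y z} → x < y → y < z → x < z
  <-trans x<y y<z = <-≤-trans x<y (<⇒≤ y<z)

  ≤-respˡ : ∀ {x y z} → x ≡ y → x ≤ z → y ≤ z
  ≤-respˡ refl p = p

  ≤-respʳ : ∀ {x y z} → y ≡ z → x ≤ y → x ≤ z
  ≤-respʳ refl p = p

  <-respˡ : ∀ {x y z} → x ≡ y → x < z → y < z
  <-respˡ refl p = p

  <-respʳ : ∀ {x y z} → y ≡ z → x < y → x < z
  <-respʳ refl p = p

  ≤-<-split : ∀ x y → x ≤ y ⊎ y < x
  ≤-<-split x y with x ≤? y
  ... | yes x≤y = inj₁ x≤y
  ... | no  x≰y = inj₂ (≰⇒< x≰y)

  +-mono-≤ : ∀ {x y u v} → x ≤ y → u ≤ v → x + u ≤ y + v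
  +-mono-≤ {x} {y} {u} {v} x≤y u≤v = ≤-trans (+-monoˡ-≤ u x≤y)
    (subst₂ _≤_ (CR.+-comm u y) (CR.+-comm v y) (+-monoˡ-≤ y u≤v))

  +-nonNeg : ∀ {x y} → 0# ≤ x → 0# ≤ y → 0# ≤ x + y
  +-nonNeg {x} {y} p q = subst (_≤ x + y) (CR.+-identityˡ 0#) (+-mono-≤ p q)

  ≤⇒0≤ : ∀ {x y} → x ≤ y → 0# ≤ y - x
  ≤⇒0≤ {x} {y} p = subst (_≤ y - x) (CR.-‿inverseʳ x) (+-monoˡ-≤ (- x) p)

  0≤⇒≤ : ∀ {x y} → 0# ≤ y - x → x ≤ y
  0≤⇒≤ {x} {y} p = subst₂ _≤_ (CR.+-identityˡ x)
    (solve 2 (λ x y → (y :- x) :+ x := y) refl x y) (+-monoˡ-≤ x p)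

  <⇒0< : ∀ {x y} → x < y → 0# < y - x
  <⇒0< {x} {y} (p , q) = ≤⇒0≤ p , λ e → q
    (sym (trans (sym (solve 2 (λ x y → (y :- x) :+ x := y) refl x y))
                (trans (cong (_+ x) (sym e)) (CR.+-identityˡ x))))

  0<⇒< : ∀ {x y} → 0# < y - x → x < y
  0<⇒< {x} {y} (p , q) = 0≤⇒≤ p , λ { refl → q (sym (CR.-‿inverseʳ x)) }

  neg-mono-≤ : ∀ {x y} → x ≤ y → - y ≤ - x
  neg-mono-≤ {x} {y} p = 0≤⇒≤ (subst (0# ≤_)
    (solve 2 (λ x y → y :- x := (:- x) :- (:- y)) refl x y) (≤⇒0≤ p))

  neg-mono-< : ∀ {x y} → x < y → - y < - x
  neg-mono-< (p , q) = neg-mono-≤ p , λ e → q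
    (sym (trans (sym (-‿involutive _)) (trans (cong -_ e) (-‿involutive _))))

  *-cancel-≢0 : ∀ {x y} → x ≢ 0# → x * y ≡ 0# → y ≡ 0#
  *-cancel-≢0 {x} {y} x≢0 eq = begin
    y                ≡⟨ sym (CR.*-identityˡ y) ⟩
    1# * y           ≡⟨ cong (_* y) (sym (*-inverseʳ x x≢0)) ⟩
    x * x ⁻¹ * y     ≡⟨ solve 3 (λ x i y → x :* i :* y := i :* (x :* y)) refl x (x ⁻¹) y ⟩
    x ⁻¹ * (x * y)   ≡⟨ cong (x ⁻¹ *_) eq ⟩
    x ⁻¹ * 0#        ≡⟨ CR.zeroʳ _ ⟩
    0#               ∎

  *-pos : ∀ {x y} → 0# < x → 0# < y → 0# < x * y
  *-pos (p , x≢0) (q , y≢0) = *-nonNeg p q ,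
    λ e → y≢0 (sym (*-cancel-≢0 (λ x≡0 → x≢0 (sym x≡0)) (sym e)))

  -- This takes the place of division: lines are compared through identities between products, from
  -- which a positive distance is cancelled.
  0≤-cancel-* : ∀ {x y} → 0# < x → 0# ≤ x * y → 0# ≤ y
  0≤-cancel-* {x} {y} 0<x 0≤xy with ≤-<-split 0# y
  ... | inj₁ p = p
  ... | inj₂ y<0 = ⊥-elim (<⇒≱ (*-pos 0<x (<⇒0< y<0)) (subst₂ _≤_
        (solve 2 (λ x y → :- (x :* y) := x :* (con (pos 0) :- y)) refl x y) -0#≈0# (neg-mono-≤ 0≤xy)))

  0<-cancel-* : ∀ {x y} → 0# < x → 0# < x * y → 0# < y
  0<-cancel-* {x} {y} 0<x (p , q) = 0≤-cancel-* 0<x p , λ { refl → q (sym (CR.zeroʳ x)) }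

  +-pos-nonNeg : ∀ {x y} → 0# < x → 0# ≤ y → 0# < x + y
  +-pos-nonNeg {x} {y} p q = <-≤-trans p (subst (_≤ x + y) (CR.+-identityʳ x)
    (+-mono-≤ ≤-refl q))

  +-nonNeg-pos : ∀ {x y} → 0# ≤ x → 0# < y → 0# < x + y
  +-nonNeg-pos {x} {y} p q = subst (0# <_) (CR.+-comm y x) (+-pos-nonNeg q p)

  0≤x² : ∀ x → 0# ≤ x * x
  0≤x² x with total 0# x
  ... | inj₁ p = *-nonNeg p p
  ... | inj₂ p = subst (0# ≤_) (solve 1 (λ x → (con (pos 0) :- x) :* (con (pos 0) :- x) := x :* x) refl x)
    (*-nonNeg (≤⇒0≤ p) (≤⇒0≤ p))

  0<1 : 0# < 1#
  0<1 = subst (0# ≤_) (CR.*-identityˡ 1#) (0≤x² 1#) , 0≢1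

  ⁻¹-pos : ∀ {x} → 0# < x → 0# < x ⁻¹
  ⁻¹-pos {x} 0<x@(_ , x≢0) = 0<-cancel-* 0<x (subst (0# <_) (sym (*-inverseʳ x (≢-sym x≢0))) 0<1)

  x<x+pos : ∀ {x e} → 0# < e → x < x + e
  x<x+pos {x} {e} p = 0<⇒< (subst (0# <_) (solve 2 (λ x e → e := (x :+ e) :- x) refl x e) p)

  rising⇒mono : ∀ {f : ℕ → Carrier} {n} → (∀ {i} → i ℕ.< n → f i < f (suc i)) →
                ∀ {i j} → i ℕ.≤ j → j ℕ.≤ n → f i ≤ f j
  rising⇒mono {f} {n} rise i≤j j≤n = go (ℕ.≤⇒≤′ i≤j) j≤n
    where
    go : ∀ {i j} → i ℕ.≤′ j → j ℕ.≤ n → f i ≤ f j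
    go ℕ.≤′-refl     _ = ≤-refl
    go (ℕ.≤′-step p) q = ≤-trans (go p (ℕ.<⇒≤ q)) (<⇒≤ (rise q))

  min : Carrier → Carrier → Carrier
  min x y with x ≤? y
  ... | yes _ = x
  ... | no  _ = y

  min-≤ˡ : ∀ x y → min x y ≤ x
  min-≤ˡ x y with x ≤? y
  ... | yes _ = ≤-refl
  ... | no p  = <⇒≤ (≰⇒< p)

  min-≤ʳ : ∀ x y → min x y ≤ y
  min-≤ʳ x y with x ≤? y
  ... | yes p = p
  ... | no p  = ≤-refl

  <-min : ∀ {z} x y → z < x → z < y → z < min x y
  <-min x y p q with x ≤? y
  ... | yes _ = p
  ... | no _  = q

  -- Lines and their comparison

  record Line : Set c where
    constructor line
    field
      slope intercept : Carrier
  open Line public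

  infix 9 _at_
  _at_ : Line → Carrier → Carrier
  L at x = slope L * x + intercept L

  mirror : Line → Line
  mirror (line m k) = line (- m) (- k)

  mirror-at : ∀ L z → mirror L at z ≡ - (L at z)
  mirror-at (line m k) z = solve 3 (λ m k z → (:- m) :* z :+ (:- k) := :- (m :* z :+ k)) refl m k z

  neg-mirror-at : ∀ L z → - (mirror L at z) ≡ L at z
  neg-mirror-at L z = trans (cong -_ (mirror-at L z)) (-‿involutive _)

  through : (x₁ y₁ x₂ y₂ : Carrier) → Line
  through x₁ y₁ x₂ y₂ = line m (y₁ - m * x₁)
    where m = (y₂ - y₁) * (x₂ - x₁) ⁻¹

  through₁ : ∀ x₁ y₁ x₂ y₂ → through x₁ y₁ x₂ y₂ at x₁ ≡ y₁
  through₁ x₁ y₁ x₂ y₂ = solve 3 (λ m x y → m :* x :+ (y :- m :* x) := y) refl _ x₁ y₁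

  through₂ : ∀ {x₁ x₂} y₁ y₂ → x₁ < x₂ → through x₁ y₁ x₂ y₂ at x₂ ≡ y₂
  through₂ {x₁} {x₂} y₁ y₂ x₁<x₂ = begin
    (y₂ - y₁) * d ⁻¹ * x₂ + (y₁ - (y₂ - y₁) * d ⁻¹ * x₁)
      ≡⟨ solve 5 (λ a i x₁ x₂ y₁ → a :* i :* x₂ :+ (y₁ :- a :* i :* x₁) := a :* ((x₂ :- x₁) :* i) :+ y₁)
           refl (y₂ - y₁) (d ⁻¹) x₁ x₂ y₁ ⟩
    (y₂ - y₁) * (d * d ⁻¹) + y₁   ≡⟨ cong (λ w → (y₂ - y₁) * w + y₁) (*-inverseʳ d (≢-sym (proj₂ (<⇒0< x₁<x₂)))) ⟩
    (y₂ - y₁) * 1# + y₁           ≡⟨ cong (_+ y₁) (CR.*-identityʳ _) ⟩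
    (y₂ - y₁) + y₁                ≡⟨ solve 2 (λ y₁ y₂ → (y₂ :- y₁) :+ y₁ := y₂) refl y₁ y₂ ⟩
    y₂                            ∎
    where d = x₂ - x₁

  module _ (K L : Line) where
    private
      D : Carrier → Carrier
      D z = L at z - K at z

      -- The three-point identity of an affine function, solved for each of the three values.
      three₁ : ∀ x y z → (y - x) * D z ≡ (z - y) * (K at x - L at x) + (z - x) * D y
      three₁ x y z = solve 7 (λ m k m′ k′ x y z →
        (y :- x) :* ((m′ :* z :+ k′) :- (m :* z :+ k)) :=
        (z :- y) :* ((m :* x :+ k) :- (m′ :* x :+ k′)) :+ (z :- x) :* ((m′ :* y :+ k′) :- (m :* y :+ k)))
        refl (slope K) (intercept K) (slope L) (intercept L) x y z

      three₂ : ∀ x y z → (y - x) * D z ≡ (y - z) * D x + (z - x) * D y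
      three₂ x y z = solve 7 (λ m k m′ k′ x y z →
        (y :- x) :* ((m′ :* z :+ k′) :- (m :* z :+ k)) :=
        (y :- z) :* ((m′ :* x :+ k′) :- (m :* x :+ k)) :+ (z :- x) :* ((m′ :* y :+ k′) :- (m :* y :+ k)))
        refl (slope K) (intercept K) (slope L) (intercept L) x y z

      three₃ : ∀ x y z → (y - x) * D z ≡ (y - z) * D x + (x - z) * (K at y - L at y)
      three₃ x y z = solve 7 (λ m k m′ k′ x y z →
        (y :- x) :* ((m′ :* z :+ k′) :- (m :* z :+ k)) :=
        (y :- z) :* ((m′ :* x :+ k′) :- (m :* x :+ k)) :+ (x :- z) :* ((m :* y :+ k) :- (m′ :* y :+ k′)))
        refl (slope K) (intercept K) (slope L) (intercept L) x y z

    -- The difference of two lines is affine and changes sign at most once. This and the four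
    -- comparisons below read signs off that form of the three-point identity in which all
    -- coefficients are nonnegative.
    beyondʳ : ∀ {x y z} → L at x ≤ K at x → K at y ≤ L at y → x < y → y ≤ z → K at z ≤ L at z
    beyondʳ {x} {y} {z} p q x<y y≤z = 0≤⇒≤ (0≤-cancel-* (<⇒0< x<y) (subst (0# ≤_) (sym (three₁ x y z))
      (+-nonNeg (*-nonNeg (≤⇒0≤ y≤z) (≤⇒0≤ p)) (*-nonNeg (≤⇒0≤ (≤-trans (<⇒≤ x<y) y≤z)) (≤⇒0≤ q)))))

    beyondʳ-< : ∀ {x y z} → L at x ≤ K at x → K at y < L at y → x < y → y ≤ z → K at z < L at z
    beyondʳ-< {x} {y} {z} p q x<y y≤z = 0<⇒< (0<-cancel-* (<⇒0< x<y) (subst (0# <_) (sym (three₁ x y z))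
      (+-nonNeg-pos (*-nonNeg (≤⇒0≤ y≤z) (≤⇒0≤ p)) (*-pos (<⇒0< (<-≤-trans x<y y≤z)) (<⇒0< q)))))

    between : ∀ {x y z} → K at x ≤ L at x → K at y ≤ L at y → x ≤ z → z ≤ y → K at z ≤ L at z
    between {x} {y} {z} p q x≤z z≤y with ≤-<-split y x
    ... | inj₁ y≤x = subst (λ w → K at w ≤ L at w) (≤-antisym x≤z (≤-trans z≤y y≤x)) p
    ... | inj₂ x<y = 0≤⇒≤ (0≤-cancel-* (<⇒0< x<y) (subst (0# ≤_) (sym (three₂ x y z))
      (+-nonNeg (*-nonNeg (≤⇒0≤ z≤y) (≤⇒0≤ p)) (*-nonNeg (≤⇒0≤ x≤z) (≤⇒0≤ q)))))

    between-< : ∀ {x y z} → K at x ≤ L at x → K at y < L at y → x < z → z ≤ y → K at z < L at z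
    between-< {x} {y} {z} p q x<z z≤y = 0<⇒< (0<-cancel-* (<⇒0< (<-≤-trans x<z z≤y)) (subst (0# <_) (sym (three₂ x y z))
      (+-nonNeg-pos (*-nonNeg (≤⇒0≤ z≤y) (≤⇒0≤ p)) (*-pos (<⇒0< x<z) (<⇒0< q)))))

    beyondˡ : ∀ {x y z} → K at x ≤ L at x → L at y ≤ K at y → x < y → z ≤ x → K at z ≤ L at z
    beyondˡ {x} {y} {z} p q x<y z≤x = 0≤⇒≤ (0≤-cancel-* (<⇒0< x<y) (subst (0# ≤_) (sym (three₃ x y z))
      (+-nonNeg (*-nonNeg (≤⇒0≤ (≤-trans z≤x (<⇒≤ x<y))) (≤⇒0≤ p)) (*-nonNeg (≤⇒0≤ z≤x) (≤⇒0≤ q)))))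

  slope-mono : ∀ L {x y} → 0# ≤ slope L → x ≤ y → L at x ≤ L at y
  slope-mono (line m k) {x} {y} 0≤m x≤y = 0≤⇒≤ (subst (0# ≤_)
    (solve 4 (λ m k x y → m :* (y :- x) := (m :* y :+ k) :- (m :* x :+ k)) refl m k x y)
    (*-nonNeg 0≤m (≤⇒0≤ x≤y)))

  rising⇒slope-pos : ∀ L {x y} → x < y → L at x < L at y → 0# < slope L
  rising⇒slope-pos (line m k) {x} {y} x<y p = 0<-cancel-* (<⇒0< x<y) (subst (0# <_)
    (solve 4 (λ m k x y → (m :* y :+ k) :- (m :* x :+ k) := (y :- x) :* m) refl m k x y) (<⇒0< p))

  AffineBetween : Carrier → Carrier → (Carrier → Carrier) → Set (c ⊔ ℓ)
  AffineBetween x y f = ∃ λ K → ∀ {z} → x ≤ z → z ≤ y → f z ≡ K at z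

  affine-⊆ : ∀ {x y x′ y′ f} → x ≤ x′ → y′ ≤ y → AffineBetween x y f → AffineBetween x′ y′ f
  affine-⊆ p q (K , eq) = K , λ r s → eq (≤-trans p r) (≤-trans s q)

  affine-≤ : ∀ {f x y} L → AffineBetween x y f → f x ≤ L at x → f y ≤ L at y →
             ∀ {z} → x ≤ z → z ≤ y → f z ≤ L at z
  affine-≤ {f} {x} {y} L (K , eq) p q x≤z z≤y = ≤-respˡ (sym (eq x≤z z≤y))
    (between K L (≤-respˡ (eq ≤-refl x≤y) p) (≤-respˡ (eq x≤y ≤-refl) q) x≤z z≤y)
    where x≤y = ≤-trans x≤z z≤y

  affine-≥ : ∀ {f x y} L → AffineBetween x y f → L at x ≤ f x → L at y ≤ f y →
             ∀ {z} → x ≤ z → z ≤ y → L at z ≤ f z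
  affine-≥ {f} {x} {y} L (K , eq) p q x≤z z≤y = ≤-respʳ (sym (eq x≤z z≤y))
    (between L K (≤-respʳ (eq ≤-refl x≤y) p) (≤-respʳ (eq x≤y ≤-refl) q) x≤z z≤y)
    where x≤y = ≤-trans x≤z z≤y

  affine-> : ∀ {f x y} L → AffineBetween x y f → L at x ≤ f x → L at y < f y →
             ∀ {z} → x < z → z ≤ y → L at z < f z
  affine-> {f} {x} {y} L (K , eq) p q x<z z≤y = <-respʳ (sym (eq (<⇒≤ x<z) z≤y))
    (between-< L K (≤-respʳ (eq ≤-refl x≤y) p) (<-respʳ (eq x≤y ≤-refl) q) x<z z≤y)
    where x≤y = ≤-trans (<⇒≤ x<z) z≤y

  affine-neg : ∀ {f x y} → AffineBetween x y f → AffineBetween x y (λ z → - f z)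
  affine-neg (K , eq) = mirror K , λ p q → trans (cong -_ (eq p q)) (sym (mirror-at K _))

  -- Upper hulls of the graph of a function

  module _ (hx hy : ℕ → Carrier) where

    edge : ℕ → Line
    edge h = through (hx h) (hy h) (hx (suc h)) (hy (suc h))

    -- That every edge line dominates f on the whole hull (dom) says at once that the
    -- chain of vertices is concave and that it dominates f.
    record Hull (f : Carrier → Carrier) (b t : ℕ) : Set (c ⊔ ℓ) where
      field
        b≤t : b ℕ.≤ t
        rising : ∀ {h} → b ℕ.≤ h → h ℕ.< t → hx h < hx (suc h)
        val : ∀ {h} → b ℕ.≤ h → h ℕ.≤ t → hy h ≡ f (hx h)
        dom : ∀ {h} → b ℕ.≤ h → h ℕ.< t → ∀ {z} → hx b ≤ z → z ≤ hx t → f z ≤ edge h at z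

  open Hull public

  module _ {hx hy : ℕ → Carrier} {f : Carrier → Carrier} where

    hull-mono : ∀ {b t} → Hull hx hy f b t → ∀ {h h′} → b ℕ.≤ h → h ℕ.≤ h′ → h′ ℕ.≤ t → hx h ≤ hx h′
    hull-mono H b≤h h≤h′ h′≤t = go (ℕ.≤⇒≤′ h≤h′) h′≤t
      where
      go : ∀ {h′} → _ ℕ.≤′ h′ → h′ ℕ.≤ _ → hx _ ≤ hx h′
      go ℕ.≤′-refl     _ = ≤-refl
      go (ℕ.≤′-step p) q = ≤-trans (go p (ℕ.<⇒≤ q))
        (<⇒≤ (rising H (ℕ.≤-trans b≤h (ℕ.≤′⇒≤ p)) q))

    hull-strict : ∀ {b t} → Hull hx hy f b t → ∀ {h h′} → b ℕ.≤ h → h ℕ.< h′ → h′ ℕ.≤ t → hx h < hx h′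
    hull-strict H b≤h h<h′ h′≤t = <-≤-trans (rising H b≤h (ℕ.<-≤-trans h<h′ h′≤t))
      (hull-mono H (ℕ.m≤n⇒m≤1+n b≤h) h<h′ h′≤t)

    hull-singleton : ∀ {b} → hy b ≡ f (hx b) → Hull hx hy f b b
    hull-singleton eq = record
      { b≤t = ℕ.≤-refl
      ; rising = λ p q → ⊥-elim (ℕ.<⇒≱ q p)
      ; val = λ p q → subst (λ h → hy h ≡ f (hx h)) (ℕ.≤-antisym p q) eq
      ; dom = λ p q → ⊥-elim (ℕ.<⇒≱ q p) }

    hull-tail : ∀ {b b′ t} → Hull hx hy f b t → b ℕ.≤ b′ → b′ ℕ.≤ t → Hull hx hy f b′ t
    hull-tail H b≤b′ b′≤t = record
      { b≤t = b′≤t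
      ; rising = λ p → rising H (ℕ.≤-trans b≤b′ p)
      ; val = λ p → val H (ℕ.≤-trans b≤b′ p)
      ; dom = λ p q r → dom H (ℕ.≤-trans b≤b′ p) q (≤-trans (hull-mono H ℕ.≤-refl b≤b′ b′≤t) r) }

    hull-init : ∀ {b t} → Hull hx hy f b (suc t) → b ℕ.≤ t → Hull hx hy f b t
    hull-init H b≤t = record
      { b≤t = b≤t
      ; rising = λ p q → rising H p (ℕ.m<n⇒m<1+n q)
      ; val = λ p q → val H p (ℕ.m≤n⇒m≤1+n q)
      ; dom = λ p q r s → dom H p (ℕ.m<n⇒m<1+n q) r
          (≤-trans s (hull-mono H b≤t (ℕ.n≤1+n _) ℕ.≤-refl)) }

    hull-cong : ∀ {hx′ hy′ b t} → (∀ {h} → b ℕ.≤ h → h ℕ.≤ t → hx′ h ≡ hx h × hy′ h ≡ hy h) →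
                Hull hx hy f b t → Hull hx′ hy′ f b t
    hull-cong {hx′} {hy′} {b} {t} eq H = record
      { b≤t = b≤t H
      ; rising = λ p q → subst₂ _<_ (sym (ex p (ℕ.<⇒≤ q))) (sym (ex (ℕ.m≤n⇒m≤1+n p) q)) (rising H p q)
      ; val = λ p q → trans (ey p q) (trans (val H p q) (cong f (sym (ex p q))))
      ; dom = λ {h} p q {z} r s → subst (λ L → f z ≤ L at z)
          (trans (cong₂ (λ x y → through x y _ _) (sym (ex p (ℕ.<⇒≤ q))) (sym (ey p (ℕ.<⇒≤ q))))
                 (cong₂ (through _ _) (sym (ex (ℕ.m≤n⇒m≤1+n p) q)) (sym (ey (ℕ.m≤n⇒m≤1+n p) q))))
          (dom H p q (≤-respˡ (ex ℕ.≤-refl (b≤t H)) r) (≤-respʳ (ex (b≤t H) ℕ.≤-refl) s)) }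
      where
      ex : ∀ {h} → b ℕ.≤ h → h ℕ.≤ t → hx′ h ≡ hx h
      ex p q = proj₁ (eq p q)
      ey : ∀ {h} → b ℕ.≤ h → h ℕ.≤ t → hy′ h ≡ hy h
      ey p q = proj₂ (eq p q)

    edge₁ : ∀ h → edge hx hy h at hx h ≡ hy h
    edge₁ h = through₁ _ _ _ _

    edge₂ : ∀ {b t h} → Hull hx hy f b t → b ℕ.≤ h → h ℕ.< t → edge hx hy h at hx (suc h) ≡ hy (suc h)
    edge₂ H p q = through₂ _ _ (rising H p q)

    -- By dom it suffices to compare L with the first edge.
    hull-tangent : ∀ {b t} → Hull hx hy f b t → ∀ L → L at hx b ≡ hy b →
      b ≡ t ⊎ (b ℕ.< t × hy (suc b) ≤ L at hx (suc b)) →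
      ∀ {z} → hx b ≤ z → z ≤ hx t → f z ≤ L at z
    hull-tangent {b} {t} H L Lb≡ (inj₁ refl) p q =
      subst (λ w → f w ≤ L at w) (≤-antisym p q) (≤-reflexive (sym (trans Lb≡ (val H ℕ.≤-refl ℕ.≤-refl))))
    hull-tangent {b} {t} H L Lb≡ (inj₂ (b<t , r)) {z} p q = ≤-trans (dom H ℕ.≤-refl b<t p q) E≤L
      where
      E = edge hx hy b
      E≤b : E at hx b ≤ L at hx b
      E≤b = ≤-reflexive (trans (edge₁ b) (sym Lb≡))
      E≤sb : E at hx (suc b) ≤ L at hx (suc b)
      E≤sb = ≤-respˡ (sym (edge₂ H ℕ.≤-refl b<t)) r
      E≤L : E at z ≤ L at z
      E≤L with ≤-<-split z (hx (suc b))
      ... | inj₁ z≤ = between E L E≤b E≤sb p z≤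
      ... | inj₂ z> = beyondʳ E L (≤-reflexive (trans Lb≡ (sym (edge₁ b)))) E≤sb (rising H ℕ.≤-refl b<t) (<⇒≤ z>)

    -- A last vertex under the line `N` from its predecessor to the new point is redundant. Left of
    -- it the last edge lies below `N`; right of it the old front line `N′` does, since both lines
    -- end in the new point.
    pop : ∀ {b t x y} → Hull hx hy f b (suc t) → b ℕ.≤ t → hx (suc t) < x →
      hy (suc t) ≤ through (hx t) (hy t) x y at hx (suc t) →
      (∀ {z} → hx (suc t) ≤ z → z ≤ x → f z ≤ through (hx (suc t)) (hy (suc t)) x y at z) →
      ∀ {z} → hx t ≤ z → z ≤ x → f z ≤ through (hx t) (hy t) x y at z
    pop {b} {t} {x} {y} H b≤t st<x below front {z} p q = go (≤-<-split z (hx (suc t)))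
      where
      N  = through (hx t) (hy t) x y
      N′ = through (hx (suc t)) (hy (suc t)) x y
      E  = edge hx hy t
      t<st = rising H b≤t ℕ.≤-refl
      go : z ≤ hx (suc t) ⊎ hx (suc t) < z → f z ≤ N at z
      go (inj₁ z≤) = ≤-trans (dom H b≤t ℕ.≤-refl (≤-trans (hull-mono H ℕ.≤-refl b≤t (ℕ.n≤1+n _)) p) z≤)
        (between E N (≤-reflexive (trans (edge₁ t) (sym (through₁ _ _ _ _))))
                     (≤-respˡ (sym (edge₂ H b≤t ℕ.≤-refl)) below) p z≤)
      go (inj₂ z>) = ≤-trans (front (<⇒≤ z>) q)
        (between N′ N (≤-respˡ (sym (through₁ _ _ _ _)) below)
                      (≤-reflexive (trans (through₂ _ _ st<x) (sym (through₂ _ _ (<-trans t<st st<x))))) (<⇒≤ z>) q)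

    -- Concavity at the vertex where popping stops: `N` and the last edge start in the same vertex,
    -- the edge is not lower at the next one, hence not lower at the new point.
    pop-stop : ∀ {b t x y} → Hull hx hy f b (suc t) → b ℕ.≤ t → hx (suc t) < x →
      through (hx t) (hy t) x y at hx (suc t) ≤ hy (suc t) → y ≤ edge hx hy t at x
    pop-stop {b} {t} {x} {y} H b≤t st<x above = ≤-respˡ (through₂ _ _ (<-trans t<st st<x))
      (beyondʳ N E (≤-reflexive (trans (edge₁ t) (sym (through₁ _ _ _ _))))
        (≤-respʳ (sym (edge₂ H b≤t ℕ.≤-refl)) above) t<st (<⇒≤ st<x))
      where
      N = through (hx t) (hy t) x y
      E = edge hx hy t
      t<st = rising H b≤t ℕ.≤-refl

    -- Concavity at a vertex that is kept because `D` touches the hull there. `D` is not below the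
    -- edge at its left end and meets it at its right end, so further on the edge is not below `D`,
    -- and `D` is not below the new point.
    guard-stop : ∀ {b t x y} D → Hull hx hy f b (suc t) → b ℕ.≤ t → hx (suc t) < x →
      hy t ≤ D at hx t → D at hx (suc t) ≡ hy (suc t) → y ≤ D at x → y ≤ edge hx hy t at x
    guard-stop {b} {t} D H b≤t st<x p q r = ≤-trans r
      (beyondʳ D E (≤-respˡ (sym (edge₁ t)) p) (≤-reflexive (trans q (sym (edge₂ H b≤t ℕ.≤-refl))))
        (rising H b≤t ℕ.≤-refl) (<⇒≤ st<x))
      where E = edge hx hy t

    -- The last hypothesis is concavity at the old top. It puts the previous edge below the new one
    -- on the left, so the new edge dominates everything. An old edge starts on or below the new
    -- line and is not below it at the old top, so it dominates the new segment.
    push : ∀ {b t} → Hull hx hy f b t → hx t < hx (suc t) → hy (suc t) ≡ f (hx (suc t)) →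
      (∀ {z} → hx t ≤ z → z ≤ hx (suc t) → f z ≤ edge hx hy t at z) →
      t ≡ b ⊎ (∃ λ t₀ → t ≡ suc t₀ × b ℕ.≤ t₀ × hy (suc t) ≤ edge hx hy t₀ at hx (suc t)) →
      Hull hx hy f b (suc t)
    push {b} {t} H t<st vst front stop = record
      { b≤t = ℕ.m≤n⇒m≤1+n (b≤t H)
      ; rising = λ p q → rising′ p (ℕ.m≤n⇒m<n∨m≡n (ℕ.s≤s⁻¹ q))
      ; val = λ p q → val′ p (ℕ.m≤n⇒m<n∨m≡n q)
      ; dom = λ p q → dom′ p (ℕ.m≤n⇒m<n∨m≡n (ℕ.s≤s⁻¹ q)) }
      where
      N = edge hx hy t
      x = hx (suc t)
      rising′ : ∀ {h} → b ℕ.≤ h → h ℕ.< t ⊎ h ≡ t → hx h < hx (suc h)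
      rising′ p (inj₁ q)    = rising H p q
      rising′ p (inj₂ refl) = t<st
      val′ : ∀ {h} → b ℕ.≤ h → h ℕ.< suc t ⊎ h ≡ suc t → hy h ≡ f (hx h)
      val′ p (inj₁ q)    = val H p (ℕ.s≤s⁻¹ q)
      val′ p (inj₂ refl) = vst
      domN : ∀ {z} → hx b ≤ z → z ≤ x → f z ≤ N at z
      domN {z} p q = go stop (≤-<-split (hx t) z)
        where
        go : t ≡ b ⊎ _ → hx t ≤ z ⊎ z < hx t → f z ≤ N at z
        go _           (inj₁ t≤z) = front t≤z q
        go (inj₁ refl) (inj₂ z<t) = ⊥-elim (<⇒≱ z<t p)
        go (inj₂ (t₀ , refl , b≤t₀ , y≤)) (inj₂ z<t) = ≤-trans (dom H b≤t₀ ℕ.≤-refl p (<⇒≤ z<t))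
          (beyondˡ (edge hx hy t₀) N (≤-reflexive (trans (edge₂ H b≤t₀ ℕ.≤-refl) (sym (edge₁ t))))
            (≤-respˡ (sym (through₂ _ _ t<st)) y≤) t<st (<⇒≤ z<t))
      dom′ : ∀ {h} → b ℕ.≤ h → h ℕ.< t ⊎ h ≡ t → ∀ {z} → hx b ≤ z → z ≤ x → f z ≤ edge hx hy h at z
      dom′ p (inj₂ refl) r s = domN r s
      dom′ {h} p (inj₁ h<t) {z} r s with ≤-<-split z (hx t)
      ... | inj₁ z≤t = dom H p h<t r z≤t
      ... | inj₂ t<z = ≤-trans (front (<⇒≤ t<z) s)
        (beyondʳ N (edge hx hy h)
          (subst₂ _≤_ (trans (sym (val H p (ℕ.<⇒≤ h<t))) (sym (edge₁ h))) refl
            (domN (hull-mono H ℕ.≤-refl p (ℕ.<⇒≤ h<t)) (≤-trans (hull-mono H p (ℕ.<⇒≤ h<t) ℕ.≤-refl) (<⇒≤ t<st))))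
          (≤-respˡ (trans (sym (val H (b≤t H) ℕ.≤-refl)) (sym (edge₁ t)))
            (dom H p h<t (hull-mono H ℕ.≤-refl (b≤t H) ℕ.≤-refl) ≤-refl))
          (hull-strict H p h<t ℕ.≤-refl) (<⇒≤ t<z))

  -- Rotating a line about the hull of the obstacle below it

  module Rotation
    {hx hy : ℕ → Carrier} {lo up : Carrier → Carrier} {b t : ℕ}
    (lo<up : ∀ z → lo z < up z)
    (H : Hull hx hy lo b t) (s s′ e′ x : Carrier) (s≤b : s ≤ hx b) (t≤x : hx t ≤ x)
    (P : Line) (lo≤P : ∀ {z} → s ≤ z → z ≤ hx t → lo z ≤ P at z)
               (P≤up : ∀ {z} → s′ ≤ z → z ≤ e′ → P at z ≤ up z)
    (P-touch : P at hx b ≡ hy b) (P≥ : up x ≤ P at x) (b<x : hx b < x)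
    (D : Line) (lo≤D : ∀ {z} → s ≤ z → z ≤ hx t → lo z ≤ D at z)
               (D≤up : ∀ {z} → s′ ≤ z → z ≤ x → D at z ≤ up z)
    (s′≤e′ : s′ ≤ e′) (e′≤x : e′ ≤ x)
    (up-affine : AffineBetween e′ x up)
    where

    private
      s′≤x : s′ ≤ x
      s′≤x = ≤-trans s′≤e′ e′≤x

    -- `P` is the extreme line to be turned, which reaches or exceeds the ceiling at `x`; the
    -- candidates join a hull vertex to the ceiling at `x`. `D` is the opposite extreme line. It
    -- respects both walls, and its contact with the hull bounds the turn.
    R : ℕ → Line
    R h = through (hx h) (hy h) x (up x)

    record Rotating (h : ℕ) : Set (c ⊔ ℓ) where
      field
        b≤h  : b ℕ.≤ h
        h≤t  : h ℕ.≤ t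
        h<x  : hx h < x
        lo≤R : ∀ {z} → s ≤ z → z ≤ hx h → lo z ≤ R h at z

    R₁ : ∀ h → R h at hx h ≡ hy h
    R₁ h = through₁ _ _ _ _

    rotating-start : Rotating b
    rotating-start = record
      { b≤h = ℕ.≤-refl ; h≤t = b≤t H ; h<x = b<x
      ; lo≤R = λ p q → ≤-trans (lo≤P p (≤-trans q (hull-mono H ℕ.≤-refl (b≤t H) ℕ.≤-refl)))
          (beyondˡ P (R b) (≤-reflexive (trans P-touch (sym (R₁ b))))
            (≤-respˡ (sym (through₂ _ _ b<x)) P≥) b<x q) }

    -- Moving the pivot to a vertex above the line raises the line everywhere up to the new pivot,
    -- so it stays above the obstacle where it was; between the two pivots it lies above the hull
    -- edge.
    rotate : ∀ {h} → Rotating h → h ℕ.< t → R h at hx (suc h) < hy (suc h) → Rotating (suc h)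
    rotate {h} ρ h<t below = record
      { b≤h = ℕ.m≤n⇒m≤1+n b≤h ; h≤t = h<t ; h<x = sh<x ; lo≤R = λ p q → go p q (≤-<-split _ (hx h)) }
      where
      open Rotating ρ
      -- At `x` the line has the height of the ceiling, so no point of the obstacle at `x` lies
      -- above it.
      x≢ : hx (suc h) ≢ x
      x≢ eq = <⇒≱ (subst₂ _<_ (trans (cong (R h at_) eq) (through₂ _ _ h<x))
                              (trans (val H (ℕ.m≤n⇒m≤1+n b≤h) h<t) (cong lo eq)) below)
                  (<⇒≤ (lo<up x))
      sh<x : hx (suc h) < x
      sh<x = ≤-trans (hull-mono H (ℕ.m≤n⇒m≤1+n b≤h) h<t ℕ.≤-refl) t≤x , x≢
      R≤R′ : ∀ {z} → z ≤ hx (suc h) → R h at z ≤ R (suc h) at z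
      R≤R′ = beyondˡ (R h) (R (suc h)) (≤-respʳ (sym (R₁ (suc h))) (<⇒≤ below))
        (≤-reflexive (trans (through₂ _ _ sh<x) (sym (through₂ _ _ h<x)))) sh<x
      h<sh = rising H b≤h h<t
      go : ∀ {z} → s ≤ z → z ≤ hx (suc h) → z ≤ hx h ⊎ hx h < z → lo z ≤ R (suc h) at z
      go p q (inj₁ z≤h) = ≤-trans (lo≤R p z≤h) (R≤R′ q)
      go p q (inj₂ h<z) = ≤-trans
        (dom H b≤h h<t (≤-trans (hull-mono H ℕ.≤-refl b≤h h≤t) (<⇒≤ h<z))
           (≤-trans q (hull-mono H (ℕ.m≤n⇒m≤1+n b≤h) h<t ℕ.≤-refl)))
        (between (edge hx hy h) (R (suc h))
          (≤-respˡ (trans (R₁ h) (sym (edge₁ {hx} {hy} {lo} h))) (R≤R′ (<⇒≤ h<sh)))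
          (≤-reflexive (trans (edge₂ H b≤h h<t) (sym (R₁ (suc h))))) (<⇒≤ h<z) q)

    module _ {h : ℕ} (ρ : Rotating h) where
      open Rotating ρ
      private
        R≡up : R h at x ≡ up x
        R≡up = through₂ _ _ h<x
        s≤h : s ≤ hx h
        s≤h = ≤-trans s≤b (hull-mono H ℕ.≤-refl b≤h h≤t)
        h≤ht : hx h ≤ hx t
        h≤ht = hull-mono H b≤h h≤t ℕ.≤-refl
        vh : hy h ≡ lo (hx h)
        vh = val H b≤h h≤t

      -- Either the line is tangent to the rest of the hull, or its pivot is a contact of `D`. In
      -- the latter case it starts on `D` and ends at the ceiling, which is not below `D`, so it
      -- stays above `D` in between.
      rotated-≥ : (h ≡ t ⊎ (h ℕ.< t × hy (suc h) ≤ R h at hx (suc h))) ⊎ D at hx h ≡ lo (hx h) →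
        ∀ {z} → s ≤ z → z ≤ hx t → lo z ≤ R h at z
      rotated-≥ stop {z} p q with ≤-<-split z (hx h)
      ... | inj₁ z≤h = lo≤R p z≤h
      rotated-≥ (inj₁ stop) p q | inj₂ h<z =
        hull-tangent (hull-tail H b≤h h≤t) (R h) (R₁ h) stop (<⇒≤ h<z) q
      rotated-≥ (inj₂ touch) {z} p q | inj₂ h<z = ≤-trans (lo≤D p q)
        (between D (R h) (≤-reflexive (trans touch (trans (sym vh) (sym (R₁ h)))))
           (≤-respʳ (sym R≡up) (D≤up s′≤x ≤-refl)) (<⇒≤ h<z) (≤-trans q t≤x))

      -- Before the pivot the line lies below `D`, between the pivot and `e′` it lies below `P`, and
      -- beyond `e′` the ceiling is affine, so the two ends suffice.
      rotated-≤ : ∀ {z} → s′ ≤ z → z ≤ x → R h at z ≤ up z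
      rotated-≤ {z} p q = go (≤-<-split z (hx h)) (≤-<-split z e′)
        where
        left : ∀ {z} → s′ ≤ z → z ≤ x → z ≤ hx h → R h at z ≤ up z
        left p q r = ≤-trans
          (beyondˡ (R h) D (≤-respˡ (trans (sym vh) (sym (R₁ h))) (lo≤D s≤h h≤ht))
            (≤-respʳ (sym R≡up) (D≤up s′≤x ≤-refl)) h<x r) (D≤up p q)
        R≤P : ∀ {z} → hx h ≤ z → z ≤ x → R h at z ≤ P at z
        R≤P = between (R h) P (≤-respˡ (trans (sym vh) (sym (R₁ h))) (lo≤P s≤h h≤ht))
                              (≤-respˡ (sym R≡up) P≥)
        middle : ∀ {z} → s′ ≤ z → hx h ≤ z → z ≤ e′ → R h at z ≤ up z
        middle p r e = ≤-trans (R≤P r (≤-trans e e′≤x)) (P≤up p e)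
        right : ∀ {z} w → s′ ≤ w → e′ ≤ w → w ≤ x → R h at w ≤ up w → w ≤ z → z ≤ x → R h at z ≤ up z
        right w s≤w e≤w w≤x r = affine-≥ (R h) (affine-⊆ e≤w ≤-refl up-affine) r (≤-reflexive R≡up)
        go : z ≤ hx h ⊎ hx h < z → z ≤ e′ ⊎ e′ < z → R h at z ≤ up z
        go (inj₁ z≤h) _ = left p q z≤h
        go (inj₂ h<z) (inj₁ z≤e) = middle p (<⇒≤ h<z) z≤e
        go (inj₂ h<z) (inj₂ e<z) with ≤-<-split (hx h) e′
        ... | inj₁ h≤e = right e′ s′≤e′ ≤-refl e′≤x (middle s′≤e′ h≤e ≤-refl) (<⇒≤ e<z) q
        ... | inj₂ e<h = right (hx h) s′≤h (<⇒≤ e<h) (<⇒≤ h<x) (left s′≤h (<⇒≤ h<x) ≤-refl) (<⇒≤ h<z) q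
          where s′≤h = ≤-trans s′≤e′ (<⇒≤ e<h)

  -- The two sides and the input

  data Side : Set where
    lower upper : Side

  opp : Side → Side
  opp lower = upper
  opp upper = lower

  signed : Side → Carrier → Carrier
  signed lower w = w
  signed upper w = - w

  oriented : Side → Line → Line
  oriented lower L = L
  oriented upper L = mirror L

  oriented-at : ∀ s L z → oriented s L at z ≡ signed s (L at z)
  oriented-at lower L z = refl
  oriented-at upper L z = mirror-at L z

  record Instance : Set (c ⊔ ℓ) where
    field
      n        : ℕ
      t        : ℕ → Carrier
      a        : Carrier → Carrier
      ε        : Carrier
      0<ε      : 0# < ε
      t-rising : ∀ {i} → i ℕ.< n → t i < t (suc i)
      a-affine : ∀ {i} → i ℕ.< n → AffineBetween (t i) (t (suc i)) a
      a-const  : ∀ {z} → z ≤ t 0 → a z ≡ a (t 0)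
      a-mono   : ∀ {x y} → x ≤ y → y ≤ t n → a x ≤ a y

  -- Crossing points of lines

  crossing : Line → Line → Carrier
  crossing K L = (intercept L - intercept K) * (slope K - slope L) ⁻¹

  crossing-meets : ∀ K L → slope K ≢ slope L → K at crossing K L ≡ L at crossing K L
  crossing-meets K@(line m k) L@(line m′ k′) m≢m′ = begin
    m * x + k                        ≡⟨ solve 5 (λ m k m′ k′ x → m :* x :+ k := (m :- m′) :* x :+ (m′ :* x :+ k)) refl m k m′ k′ x ⟩
    (m - m′) * x + (m′ * x + k)      ≡⟨ cong (_+ (m′ * x + k)) dx ⟩
    (k′ - k) + (m′ * x + k)          ≡⟨ solve 3 (λ k k′ w → (k′ :- k) :+ (w :+ k) := w :+ k′) refl k k′ (m′ * x) ⟩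
    m′ * x + k′                      ∎
    where
    open ≡-Reasoning
    x = crossing K L
    d≢0 : m - m′ ≢ 0#
    d≢0 e = m≢m′ (begin
      m              ≡⟨ solve 2 (λ m m′ → m := (m :- m′) :+ m′) refl m m′ ⟩
      (m - m′) + m′  ≡⟨ cong (_+ m′) e ⟩
      0# + m′        ≡⟨ CR.+-identityˡ m′ ⟩
      m′             ∎)
    dx : (m - m′) * x ≡ k′ - k
    dx = begin
      (m - m′) * ((k′ - k) * (m - m′) ⁻¹)  ≡⟨ solve 3 (λ d e i → d :* (e :* i) := e :* (d :* i)) refl (m - m′) (k′ - k) ((m - m′) ⁻¹) ⟩
      (k′ - k) * ((m - m′) * (m - m′) ⁻¹)  ≡⟨ cong ((k′ - k) *_) (*-inverseʳ _ d≢0) ⟩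
      (k′ - k) * 1#                        ≡⟨ CR.*-identityʳ _ ⟩
      k′ - k                               ∎

  module _ (K L : Line) {p q r : Carrier} (p<q : p < q) (q<r : q < r)
    (L≤K : L at p ≤ K at p) (K≤L : K at q ≤ L at q) (K<L : K at r < L at r) where

    -- Strictness at `r` excludes parallel lines. It makes the bend at a new breakpoint genuine and
    -- lets `crossing` divide by the difference of the slopes.
    slopes-differ : slope K ≢ slope L
    slopes-differ eq = <⇒≱ K<L (go K L eq L≤K)
      where
      go : ∀ K L → slope K ≡ slope L → L at p ≤ K at p → L at r ≤ K at r
      go (line m k) (line .m k′) refl r = 0≤⇒≤ (≤-respʳ
        (solve 5 (λ m k k′ p r → (m :* p :+ k) :- (m :* p :+ k′) := (m :* r :+ k) :- (m :* r :+ k′)) refl m k k′ p _)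
        (≤⇒0≤ r))

    module _ {x : Carrier} (meet : K at x ≡ L at x) where
      crossing-≥ : p ≤ x
      crossing-≥ with ≤-<-split p x
      ... | inj₁ r = r
      ... | inj₂ x<p = ⊥-elim (<⇒≱ K<L (beyondʳ L K (≤-reflexive meet) L≤K x<p (<⇒≤ (<-trans p<q q<r))))

      crossing-≤ : x ≤ q
      crossing-≤ with ≤-<-split x q | ≤-<-split x r
      ... | inj₁ s | _ = s
      ... | inj₂ q<x | inj₁ x≤r = ⊥-elim (proj₂ (between-< K L K≤L K<L q<x x≤r) meet)
      ... | inj₂ q<x | inj₂ r<x = ⊥-elim (proj₂ (beyondʳ-< K L L≤K K<L (<-trans p<q q<r) (<⇒≤ r<x)) meet)

  -- Functions glued from lines

  pieces : (ℕ → Carrier) → (ℕ → Line) → ℕ → Carrier → Carrier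
  pieces bx ln zero    z = ln 0 at z
  pieces bx ln (suc k) z with z ≤? bx k
  ... | yes _ = pieces bx ln k z
  ... | no  _ = ln (suc k) at z

  module _ {bx : ℕ → Carrier} {ln : ℕ → Line} where

    pieces-≤ : ∀ k {z} → z ≤ bx k → pieces bx ln (suc k) z ≡ pieces bx ln k z
    pieces-≤ k {z} p with z ≤? bx k
    ... | yes _ = refl
    ... | no q  = ⊥-elim (q p)

    pieces-> : ∀ k {z} → bx k < z → pieces bx ln (suc k) z ≡ ln (suc k) at z
    pieces-> k {z} p with z ≤? bx k
    ... | yes q = ⊥-elim (<⇒≱ p q)
    ... | no _  = refl

    pieces-cong : ∀ {bx′ ln′} k → (∀ {i} → i ℕ.< k → bx′ i ≡ bx i) → (∀ {i} → i ℕ.≤ k → ln′ i ≡ ln i) →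
                  ∀ z → pieces bx′ ln′ k z ≡ pieces bx ln k z
    pieces-cong zero    p q z = cong (_at z) (q ℕ.z≤n)
    pieces-cong {bx′} {ln′} (suc k) p q z with ≤-<-split z (bx k)
    ... | inj₁ z≤ = trans (pieces-≤′ (≤-respʳ (sym (p ℕ.≤-refl)) z≤)) (trans
      (pieces-cong k (λ r → p (ℕ.m<n⇒m<1+n r)) (λ r → q (ℕ.m≤n⇒m≤1+n r)) z) (sym (pieces-≤ k z≤)))
      where
      pieces-≤′ : z ≤ bx′ k → pieces bx′ ln′ (suc k) z ≡ pieces bx′ ln′ k z
      pieces-≤′ r with z ≤? bx′ k
      ... | yes _ = refl
      ... | no s  = ⊥-elim (s r)
    ... | inj₂ z> = trans (pieces->′ (<-respˡ (sym (p ℕ.≤-refl)) z>)) (trans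
      (cong (_at z) (q ℕ.≤-refl)) (sym (pieces-> k z>)))
      where
      pieces->′ : bx′ k < z → pieces bx′ ln′ (suc k) z ≡ ln′ (suc k) at z
      pieces->′ r with z ≤? bx′ k
      ... | yes s = ⊥-elim (<⇒≱ r s)
      ... | no _  = refl

    pieces-final : ∀ k {z} → (∀ {i} → i ℕ.< k → bx i < z) → pieces bx ln k z ≡ ln k at z
    pieces-final zero    _ = refl
    pieces-final (suc k) p = pieces-> k (p ℕ.≤-refl)

  -- Continuity by way of Lipschitz bounds

  record Lipschitz (f : Carrier → Carrier) (K : Carrier) : Set (c ⊔ ℓ) where
    field
      0≤K   : 0# ≤ K
      mono  : ∀ {x y} → x ≤ y → f x ≤ f y
      bound : ∀ {x y} → x ≤ y → f y - f x ≤ K * (y - x)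

  line-lipschitz : ∀ L → 0# ≤ slope L → Lipschitz (L at_) (slope L)
  line-lipschitz L 0≤m = record
    { 0≤K = 0≤m ; mono = slope-mono L 0≤m
    ; bound = λ {x} {y} _ → ≤-reflexive (solve 4 (λ m k x y → (m :* y :+ k) :- (m :* x :+ k) := m :* (y :- x))
        refl (slope L) (intercept L) x y) }

  private
    combine : ∀ {K m u v w x b y} → 0# ≤ K → 0# ≤ m → x ≤ b → b ≤ y →
      v - u ≤ K * (b - x) → w - v ≤ m * (y - b) → w - u ≤ (K + m) * (y - x)
    combine {K} {m} {u} {v} {w} {x} {b} {y} 0≤K 0≤m x≤b b≤y p q = 0≤⇒≤ (≤-respʳ
      (solve 8 (λ K m u v w x b y →
        ((K :* (b :- x) :- (v :- u)) :+ (m :* (y :- b) :- (w :- v))) :+ (K :* (y :- b) :+ m :* (b :- x))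
        := (K :+ m) :* (y :- x) :- (w :- u)) refl K m u v w x b y)
      (+-nonNeg (+-nonNeg (≤⇒0≤ p) (≤⇒0≤ q))
                (+-nonNeg (*-nonNeg 0≤K (≤⇒0≤ b≤y)) (*-nonNeg 0≤m (≤⇒0≤ x≤b)))))

    weaken : ∀ {K m d w} → 0# ≤ m → 0# ≤ d → w ≤ K * d → w ≤ (K + m) * d
    weaken {K} {m} {d} {w} p q r = 0≤⇒≤ (≤-respʳ
      (solve 4 (λ K m d w → (K :* d :- w) :+ m :* d := (K :+ m) :* d :- w) refl K m d w)
      (+-nonNeg (≤⇒0≤ r) (*-nonNeg p q)))

  lipschitz⇒continuous : ∀ {f K} → Lipschitz f K → ∀ tmax → Continuous tmax f
  lipschitz⇒continuous {f} {K} Lf tmax x _ e 0<e = δ , *-pos 0<e (⁻¹-pos 0<K′) ,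
    λ y _ p q → near y p q (≤-<-split x y)
    where
    module Lf = Lipschitz Lf
    -- One more than `K`, so that the division is possible even if `K` is 0, as for a constant
    -- function.
    K′ = K + 1#
    0<K′ : 0# < K′
    0<K′ = +-nonNeg-pos Lf.0≤K 0<1
    δ = e * K′ ⁻¹
    K′δ : K′ * δ ≡ e
    K′δ = trans (solve 3 (λ k e i → k :* (e :* i) := e :* (k :* i)) refl K′ e (K′ ⁻¹))
            (trans (cong (e *_) (*-inverseʳ K′ (≢-sym (proj₂ 0<K′)))) (CR.*-identityʳ e))
    close : ∀ {u v} → u ≤ v → v < u + δ → f v < f u + e
    close {u} {v} p q = 0<⇒< (<-respʳ
      (solve 6 (λ K i a b d v-u → (K :* v-u :- (b :- a)) :+ i :* v-u :+ (K :+ i) :* (d :- v-u) := (a :+ (K :+ i) :* d) :- b)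
        refl K 1# (f u) (f v) δ (v - u))
      (+-nonNeg-pos (+-nonNeg (≤⇒0≤ (Lf.bound p)) (*-nonNeg (<⇒≤ 0<1) (≤⇒0≤ p)))
        (*-pos 0<K′ (<-respʳ (solve 3 (λ u v d → (u :+ d) :- v := d :- (v :- u)) refl u v δ) (<⇒0< q)))))
      ⟨<⟩ cong (f u +_) K′δ
      where
      _⟨<⟩_ : ∀ {x y z} → x < y → y ≡ z → x < z
      p ⟨<⟩ refl = p
    swap : ∀ {u v w} → u < v + w → u - w < v
    swap {u} {v} {w} p = 0<⇒< (<-respʳ (solve 3 (λ u v w → (v :+ w) :- u := v :- (u :- w)) refl u v w) (<⇒0< p))
    swap′ : ∀ {u v w} → u - w < v → u < v + w
    swap′ {u} {v} {w} p = 0<⇒< (<-respʳ (solve 3 (λ u v w → v :- (u :- w) := (v :+ w) :- u) refl u v w) (<⇒0< p))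
    near : ∀ y → x - δ < y → y < x + δ → x ≤ y ⊎ y < x → f x - e < f y × f y < f x + e
    near y p q (inj₁ x≤y) = swap (≤-<-trans (Lf.mono x≤y) (x<x+pos 0<e)) , close x≤y q
    near y p q (inj₂ y<x) = swap (close (<⇒≤ y<x) (swap′ p)) , ≤-<-trans (Lf.mono (<⇒≤ y<x)) (x<x+pos 0<e)

  record Joined (bx : ℕ → Carrier) (ln : ℕ → Line) (κ : ℕ) : Set (c ⊔ ℓ) where
    field
      sorted : ∀ {i} → suc i ℕ.< κ → bx i < bx (suc i)
      meet   : ∀ {i} → i ℕ.< κ → ln i at bx i ≡ ln (suc i) at bx i
      bend   : ∀ {i} → i ℕ.< κ → slope (ln i) ≢ slope (ln (suc i))
      nonneg : ∀ {i} → i ℕ.≤ κ → 0# ≤ slope (ln i)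
      flat   : slope (ln 0) ≡ 0#

    bx-mono : ∀ {i j} → i ℕ.≤ j → j ℕ.< κ → bx i ≤ bx j
    bx-mono {i} i≤j j<κ = go (ℕ.≤⇒≤′ i≤j) j<κ
      where
      go : ∀ {j} → i ℕ.≤′ j → j ℕ.< κ → bx i ≤ bx j
      go ℕ.≤′-refl     _ = ≤-refl
      go (ℕ.≤′-step p) q = ≤-trans (go p (ℕ.<⇒≤ q)) (<⇒≤ (sorted q))

    -- Mutual with `pieces-at`: at a joint the value is taken from the left line, so the right line
    -- covers its closed piece only because the two meet there.
    pieces-from : ∀ k → k ℕ.< κ → ∀ {z} → bx k ≤ z → pieces bx ln (suc k) z ≡ ln (suc k) at z
    pieces-at : ∀ k → k ℕ.< κ → pieces bx ln k (bx k) ≡ ln k at bx k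
    pieces-from k k<κ {z} p = go (≤-<-split z (bx k))
      where
      go : z ≤ bx k ⊎ bx k < z → pieces bx ln (suc k) z ≡ ln (suc k) at z
      go (inj₂ q) = pieces-> k q
      go (inj₁ q) = subst (λ w → pieces bx ln (suc k) w ≡ ln (suc k) at w) (≤-antisym p q)
        (trans (pieces-≤ k ≤-refl) (trans (pieces-at k k<κ) (meet k<κ)))
    pieces-at zero    _   = refl
    pieces-at (suc k) k<κ = pieces-from k (ℕ.<⇒≤ k<κ) (<⇒≤ (sorted k<κ))

    pieces-before : ∀ {i} k → i ℕ.≤ k → k ℕ.≤ κ → ∀ {z} → (i ℕ.< k → z ≤ bx i) → pieces bx ln k z ≡ pieces bx ln i z
    pieces-before {i} k i≤k k≤κ {z} p = go (ℕ.≤⇒≤′ i≤k) k≤κ p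
      where
      go : ∀ {k} → i ℕ.≤′ k → k ℕ.≤ κ → (i ℕ.< k → z ≤ bx i) → pieces bx ln k z ≡ pieces bx ln i z
      go ℕ.≤′-refl         _ _ = refl
      go (ℕ.≤′-step {k} r) q p = trans (pieces-≤ k (≤-trans z≤ (bx-mono (ℕ.≤′⇒≤ r) q))) (go r (ℕ.<⇒≤ q) (λ _ → z≤))
        where z≤ = p (ℕ.s≤s (ℕ.≤′⇒≤ r))

    -- The sum of two constants serves in place of their maximum: an increment across the joint is
    -- split there, and the sum bounds both parts.
    pieces-lipschitz : ∀ k → k ℕ.≤ κ → ∃ λ K → Lipschitz (pieces bx ln k) K
    pieces-lipschitz zero    _   = slope (ln 0) , line-lipschitz (ln 0) (nonneg ℕ.z≤n)
    pieces-lipschitz (suc k) k<κ = extend (pieces-lipschitz k (ℕ.<⇒≤ k<κ))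
      where
      f  = pieces bx ln k
      f′ = pieces bx ln (suc k)
      N  = ln (suc k)
      b  = bx k
      m  = slope N
      LN = line-lipschitz N (nonneg k<κ)
      module LN = Lipschitz LN
      at-b : f b ≡ N at b
      at-b = trans (pieces-at k k<κ) (meet k<κ)
      extend : (∃ λ K → Lipschitz f K) → ∃ λ K → Lipschitz f′ K
      extend (K , Lf) = K + m , record { 0≤K = +-nonNeg Lf.0≤K LN.0≤K
        ; mono = λ p → mono′ p (≤-<-split _ b) (≤-<-split _ b)
        ; bound = λ p → bound′ p (≤-<-split _ b) (≤-<-split _ b) }
        where
        module Lf = Lipschitz Lf
        mono′ : ∀ {x y} → x ≤ y → x ≤ b ⊎ b < x → y ≤ b ⊎ b < y → f′ x ≤ f′ y
        mono′ p (inj₁ q) (inj₁ r) = subst₂ _≤_ (sym (pieces-≤ k q)) (sym (pieces-≤ k r)) (Lf.mono p)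
        mono′ p (inj₁ q) (inj₂ r) = subst₂ _≤_ (sym (pieces-≤ k q)) (sym (pieces-> k r))
          (≤-trans (Lf.mono q) (≤-respˡ (sym at-b) (LN.mono (<⇒≤ r))))
        mono′ p (inj₂ q) (inj₁ r) = ⊥-elim (<⇒≱ q (≤-trans p r))
        mono′ p (inj₂ q) (inj₂ r) = subst₂ _≤_ (sym (pieces-> k q)) (sym (pieces-> k r)) (LN.mono p)
        bound′ : ∀ {x y} → x ≤ y → x ≤ b ⊎ b < x → y ≤ b ⊎ b < y → f′ y - f′ x ≤ (K + m) * (y - x)
        bound′ p (inj₁ q) (inj₁ r) = ≤-respˡ (cong₂ _-_ (sym (pieces-≤ k r)) (sym (pieces-≤ k q)))
          (weaken LN.0≤K (≤⇒0≤ p) (Lf.bound p))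
        bound′ {x} {y} p (inj₁ q) (inj₂ r) = ≤-respˡ (cong₂ _-_ (sym (pieces-> k r)) (sym (pieces-≤ k q)))
          (combine Lf.0≤K LN.0≤K q (<⇒≤ r) (Lf.bound q)
            (≤-respˡ (cong (λ w → N at y - w) (sym at-b)) (LN.bound (<⇒≤ r))))
        bound′ p (inj₂ q) (inj₁ r) = ⊥-elim (<⇒≱ q (≤-trans p r))
        bound′ {x} {y} p (inj₂ q) (inj₂ r) = ≤-respʳ (cong (_* (y - x)) (CR.+-comm m K))
          (≤-respˡ (cong₂ _-_ (sym (pieces-> k r)) (sym (pieces-> k q)))
          (weaken Lf.0≤K (≤⇒0≤ p) (LN.bound p)))

  -- The memory of the program

  update-same : ∀ {a} {A : Set a} (f : ℕ → A) i v → update f i v i ≡ v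
  update-same f i v with i ℕ.≡ᵇ i | ℕ.≡⇒≡ᵇ i i refl
  ... | true | _ = refl

  update-other : ∀ {a} {A : Set a} (f : ℕ → A) i v {j} → j ≢ i → update f i v j ≡ f j
  update-other f i v {j} p with j ℕ.≡ᵇ i in eq
  ... | true  = ⊥-elim (p (ℕ.≡ᵇ⇒≡ j i (subst 𝔹.T (sym eq) tt)))
  ... | false = refl

  -- The memory as seen by the program.  One side plays the role Y and is extended next, the other one
  -- plays the role X.  MY is the extreme line through the window that touches the hull yb … yt of Y at its
  -- bottom; its second contact is the vertex at position yT of the hull of X.
  record View : Set c where
    field
      len yi xi yb yt xb xt yT xT rem k guard : ℕ
      ts os hx hy lm lk bx by               : ℕ → Carrier
      ε′ sg ym yk xm xk                   : Carrier

    MY MX : Line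
    MY = line ym yk
    MX = line xm xk
    links : ℕ → Line
    links i = line (lm i) (lk i)

  -- Orientation as arithmetic: the program keeps this factor in a cell and multiplies by it when it
  -- outputs a link.
  sign : Side → Carrier
  sign lower = 1#
  sign upper = 0# - 1#

  sign-oriented : ∀ s m k → line (sign s * m) (sign s * k) ≡ oriented s (line m k)
  sign-oriented lower m k = cong₂ line (CR.*-identityˡ m) (CR.*-identityˡ k)
  sign-oriented upper m k = cong₂ line (eq m) (eq k)
    where
    eq : ∀ m → (0# - 1#) * m ≡ - m
    eq m = trans (solve 2 (λ i m → (con (pos 0) :- i) :* m := :- (i :* m)) refl 1# m) (cong -_ (CR.*-identityˡ m))

  sign-opp : ∀ s → 0# - sign s ≡ sign (opp s)
  sign-opp lower = refl
  sign-opp upper = solve 1 (λ i → con (pos 0) :- (con (pos 0) :- i) := i) refl 1#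

  opp-opp : ∀ s → opp (opp s) ≡ s
  opp-opp lower = refl
  opp-opp upper = refl

  oriented-involutive : ∀ s L → oriented s (oriented s L) ≡ L
  oriented-involutive lower L = refl
  oriented-involutive upper L = cong₂ line (-‿involutive _) (-‿involutive _)

  -- Points enter alternately, the lower one first. So when the upper side is next, the lower side
  -- is one point ahead.
  lead : Side → ℕ → ℕ
  lead lower j = j
  lead upper j = suc j

  -- The zero of an affine function with values `d₀` and `- d₁` at two points is their mean with
  -- weights `d₁` and `d₀`. Here the function is the height of `MY` above the obstacle between the
  -- top of the hull of Y and the next point.
  exitV : View → Carrier
  exitV v = (hx yt * (os yi - MY at ts yi) + ts yi * (MY at hx yt - hy yt))
            * ((MY at hx yt - hy yt) + (os yi - MY at ts yi)) ⁻¹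
    where open View v

  -- The window end `q` overwrites the top of the hull of Y and becomes its only vertex; the hull of
  -- X is cut at the contact of the finished link. The new wedge lies between that link, seen from
  -- X, and the line `N` from the window end to the ceiling over the next point.
  startStage : View → View
  startStage v = record v
    { hx = update hx yt q ; hy = update hy yt (MY at q)
    ; xb = yT ; yb = yt ; yT = xt
    ; xm = 0# - ym ; xk = 0# - yk
    ; ym = slope N ; yk = intercept N }
    where
    open View v
    q = exitV v
    N = through q (MY at q) (ts yi) (os yi + ε′)

  emitted : View → Line
  emitted v = line (sg * ym) (sg * yk)
    where open View v

  -- A breakpoint is determined only by the link after it, so link `k + 1` is output together with
  -- breakpoint `k`.
  emit : View → View
  emit v = record v
    { bx = update bx k x ; by = update by k (links k at x) ; k = suc k
    ; lm = update lm (suc k) (slope N) ; lk = update lk (suc k) (intercept N) }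
    where
    open View v
    N = emitted v
    x = crossing (links k) N

  0-mirror : ∀ m k → line (0# - m) (0# - k) ≡ mirror (line m k)
  0-mirror m k = cong₂ line (CR.+-identityˡ _) (CR.+-identityˡ _)

  swapV : View → View
  swapV v = record v { yi = xi ; xi = yi ; yb = xb ; xb = yb ; yt = xt ; xt = yt ; yT = xT ; xT = yT
                     ; ym = xm ; xm = ym ; yk = xk ; xk = yk ; sg = 0# - sg }
    where open View v

  appendV : View → View
  appendV v = record v { yt = suc yt ; hx = update hx (suc yt) (ts yi) ; hy = update hy (suc yt) (os yi) }
    where open View v

  lineV : View → View
  lineV v = record v { xm = slope N ; xk = intercept N ; guard = yb }
    where
    open View v
    N = through (hx xb) (hy xb) (ts yi) (0# - os yi)

  nextV : View → View
  nextV v = swapV (record v { yi = suc yi ; rem = ℕ.pred rem })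
    where open View v

  scanStepV : View → View
  scanStepV v = record v { hx = update hx xt (ts xi) ; hy = update hy xt (os xi)
                         ; yi = suc yi ; xi = suc xi ; rem = ℕ.pred (ℕ.pred rem) }
    where open View v

  finalV : View → View
  finalV v = record (emit v)
    { bx = update (View.bx (emit v)) (suc k) (ts (ℕ.pred yi)) ; by = update (View.by (emit v)) (suc k) (MY at ts (ℕ.pred yi))
    ; len = suc (suc k) }
    where open View v

  constantV : View → View
  constantV v = record v { bx = update bx 0 (ts (ℕ.pred xi)) ; by = update by 0 (MX at ts (ℕ.pred xi)) ; len = 1 }
    where open View v

  -- Definitionally the view that popping, appending and `nextV` lead to, so that `pushed` speaks
  -- directly about the state of the program.
  swapped : ℕ → ℕ → View → View
  swapped t′ T′ v = record v
    { yi = xi ; xi = suc yi ; yb = xb ; xb = yb ; yt = xt ; xt = suc t′ ; yT = T′ ; xT = yT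
    ; ym = xm ; xm = ym ; yk = xk ; xk = yk ; sg = 0# - sg ; rem = ℕ.pred rem
    ; hx = update hx (suc t′) (ts yi) ; hy = update hy (suc t′) (os yi) }
    where open View v

  -- A new point (x , v) hides the last vertices of a hull.  Those up to position g stay: g is the bottom
  -- or the contact of a line that dominates f.
  module Popping (hx hy : ℕ → Carrier) (f : Carrier → Carrier) (b g : ℕ) (b≤g : b ℕ.≤ g) (x v : Carrier) where

    front : ℕ → Line
    front t = through (hx t) (hy t) x v

    record Popped (t : ℕ) : Set (c ⊔ ℓ) where
      field
        hull : Hull hx hy f b t
        g≤t  : g ℕ.≤ t
        t<x  : hx t < x
        cap  : ∀ {z} → hx t ≤ z → z ≤ x → f z ≤ front t at z

    pop-start : ∀ {t} → Hull hx hy f b t → g ℕ.≤ t → hx t < x → AffineBetween (hx t) x f → f x ≡ v → Popped t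
    pop-start {t} H g≤t t<x A fx = record { hull = H ; g≤t = g≤t ; t<x = t<x
      ; cap = affine-≤ (front t) A (≤-reflexive (trans (sym (val H (b≤t H) ℕ.≤-refl)) (sym (through₁ _ _ _ _))))
                                   (≤-reflexive (trans fx (sym (through₂ _ _ t<x)))) }

    pop-next : ∀ {t} → suc g ℕ.≤ t → hy t ≤ front (ℕ.pred t) at hx t → Popped t → Popped (ℕ.pred t)
    pop-next {suc t} (ℕ.s≤s g≤t) below P = record
      { hull = hull-init hull b≤t′ ; g≤t = g≤t
      ; t<x = <-trans (rising hull b≤t′ ℕ.≤-refl) t<x
      ; cap = pop hull b≤t′ t<x below cap }
      where
      open Popped P hiding (g≤t)
      b≤t′ = ℕ.≤-trans b≤g g≤t

    -- Both reasons to stop yield concavity at the remaining top: a failed height test by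
    -- `pop-stop`, the guard by `guard-stop`.
    pop-done : ∀ {t hx′ hy′} → Popped t →
      ¬ (suc g ℕ.≤ t) ⊎ ¬ (hy t ≤ front (ℕ.pred t) at hx t) →
      g ≡ b ⊎ (∃ λ D → (∀ {z} → hx b ≤ z → z ≤ hx g → f z ≤ D at z) × D at hx g ≡ hy g × v ≤ D at x) →
      (∀ {h} → b ℕ.≤ h → h ℕ.≤ t → hx′ h ≡ hx h × hy′ h ≡ hy h) → hx′ (suc t) ≡ x → hy′ (suc t) ≡ v → f x ≡ v →
      Hull hx′ hy′ f b (suc t)
    pop-done {t} {hx′} {hy′} P stop guard same x≡ v≡ fx =
      push (hull-cong same hull) (subst₂ _<_ (sym ht) (sym x≡) t<x)
        (trans v≡ (trans (sym fx) (cong f (sym x≡))))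
        (λ {z} p q → subst (λ L → f z ≤ L at z) (sym front≡) (cap (≤-respˡ ht p) (≤-respʳ x≡ q)))
        (final t refl)
      where
      open Popped P
      ht : hx′ t ≡ hx t
      ht = proj₁ (same (b≤t hull) ℕ.≤-refl)
      front≡ : edge hx′ hy′ t ≡ front t
      front≡ = trans (cong₂ (λ u w → through u w _ _) ht (proj₂ (same (b≤t hull) ℕ.≤-refl))) (cong₂ (through _ _) x≡ v≡)
      final : ∀ t₁ → t ≡ t₁ → t ≡ b ⊎ (∃ λ t₀ → t ≡ suc t₀ × b ℕ.≤ t₀ × hy′ (suc t) ≤ edge hx′ hy′ t₀ at hx′ (suc t))
      final zero    refl = inj₁ (sym (ℕ.n≤0⇒n≡0 (b≤t hull)))
      final (suc t₀) refl = go (ℕ.m≤n⇒m<n∨m≡n (b≤t hull))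
        where
        go : b ℕ.< suc t₀ ⊎ b ≡ suc t₀ → _
        go (inj₂ b≡) = inj₁ (sym b≡)
        go (inj₁ (ℕ.s≤s b≤t₀)) = inj₂ (t₀ , refl , b≤t₀ , subst₂ _≤_ (sym v≡)
            (trans (cong (edge hx hy t₀ at_) (sym x≡)) (cong (_at hx′ (suc (suc t₀))) edge≡)) (stopped stop guard))
          where
          same₀ = same b≤t₀ (ℕ.n≤1+n t₀)
          same₁ = same (ℕ.m≤n⇒m≤1+n b≤t₀) ℕ.≤-refl
          edge≡ : edge hx hy t₀ ≡ edge hx′ hy′ t₀
          edge≡ = trans (cong₂ (λ u w → through u w _ _) (sym (proj₁ same₀)) (sym (proj₂ same₀)))
                        (cong₂ (through _ _) (sym (proj₁ same₁)) (sym (proj₂ same₁)))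
          stopped : ¬ (suc g ℕ.≤ suc t₀) ⊎ ¬ (hy (suc t₀) ≤ front t₀ at hx (suc t₀)) → g ≡ b ⊎ _ → v ≤ edge hx hy t₀ at x
          stopped (inj₂ r) _ = pop-stop hull b≤t₀ t<x (<⇒≤ (≰⇒< r))
          stopped (inj₁ r) (inj₁ refl) = ⊥-elim (r (ℕ.s≤s b≤t₀))
          stopped (inj₁ r) (inj₂ (D , dom-D , touch , v≤)) = guard-stop D hull b≤t₀ t<x
            (≤-respˡ (sym (val hull b≤t₀ (ℕ.n≤1+n t₀))) (dom-D (hull-mono hull ℕ.≤-refl b≤t₀ (ℕ.n≤1+n t₀))
              (≤-trans (hull-mono hull b≤t₀ (ℕ.n≤1+n t₀) ℕ.≤-refl) (≤-reflexive (cong hx (sym g≡))))))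
            (subst (λ i → D at hx i ≡ hy i) g≡ touch) v≤
            where
            g≡ : g ≡ suc t₀
            g≡ = ℕ.≤-antisym g≤t (ℕ.≮⇒≥ r)

  -- The corridor and its competitors

  module Corridor (I : Instance) where
    open Instance I

    t-mono : ∀ {i j} → i ℕ.≤ j → j ℕ.≤ n → t i ≤ t j
    t-mono = rising⇒mono t-rising

    -- The upper wall is seen upside down, so that on either side a line has to stay
    -- above the obstacle obs and below up.
    obs up : Side → Carrier → Carrier
    obs lower z = a z
    obs upper z = - (a z + ε)
    up lower z = a z + ε
    up upper z = - a z

    obs-opp : ∀ s z → obs (opp s) z ≡ - up s z
    obs-opp lower z = refl
    obs-opp upper z = sym (-‿involutive _)

    up-opp : ∀ s z → up (opp s) z ≡ - obs s z
    up-opp lower z = refl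
    up-opp upper z = sym (-‿involutive _)

    obs<up : ∀ s z → obs s z < up s z
    obs<up lower z = x<x+pos 0<ε
    obs<up upper z = neg-mono-< (x<x+pos 0<ε)

    obs-affine : ∀ s {i} → i ℕ.< n → AffineBetween (t i) (t (suc i)) (obs s)
    obs-affine lower i<n = a-affine i<n
    obs-affine upper i<n with a-affine i<n
    ... | line m k , eq = affine-neg (line m (k + ε) , λ p q →
          trans (cong (_+ ε) (eq p q)) (CR.+-assoc _ _ _))

    up-affine : ∀ s {i} → i ℕ.< n → AffineBetween (t i) (t (suc i)) (up s)
    up-affine s {i} i<n = go (affine-neg (obs-affine (opp s) i<n))
      where
      go : AffineBetween (t i) (t (suc i)) (λ z → - obs (opp s) z) → AffineBetween (t i) (t (suc i)) (up s)
      go (K , eq) = K , λ {z} p q → trans (trans (sym (-‿involutive _)) (cong -_ (sym (obs-opp s z)))) (eq p q)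

    Inside : Carrier → Carrier → Set ℓ
    Inside z w = ∀ s → obs s z ≤ signed s w

    inside : ∀ {z w} → a z ≤ w → w ≤ a z + ε → Inside z w
    inside p q lower = p
    inside p q upper = neg-mono-≤ q

    inside-≤ : ∀ {z w} → Inside z w → w ≤ a z + ε
    inside-≤ i = subst₂ _≤_ (-‿involutive _) (-‿involutive _) (neg-mono-≤ (i upper))

    Above Below : Side → Line → Carrier → Carrier → Set (c ⊔ ℓ)
    Above s L x y = ∀ {z} → x ≤ z → z ≤ y → obs s z ≤ L at z
    Below s L x y = ∀ {z} → x ≤ z → z ≤ y → L at z ≤ up s z

    obs≤mirror : ∀ s L {z} → L at z ≤ up s z → obs (opp s) z ≤ mirror L at z
    obs≤mirror s L {z} p = subst₂ _≤_ (sym (obs-opp s z)) (sym (mirror-at L z)) (neg-mono-≤ p)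

    mirror≤up : ∀ s L {z} → obs s z ≤ L at z → mirror L at z ≤ up (opp s) z
    mirror≤up s L {z} p = subst₂ _≤_ (sym (mirror-at L z)) (sym (up-opp s z)) (neg-mono-≤ p)

    mirror-obs : ∀ s L {z} → obs (opp s) z ≤ mirror L at z → L at z ≤ up s z
    mirror-obs s L {z} p = subst₂ _≤_ (neg-mirror-at L z)
      (trans (cong -_ (obs-opp s z)) (-‿involutive _)) (neg-mono-≤ p)

    oriented-opp : ∀ s L z → oriented (opp s) L at z ≡ mirror (oriented s L) at z
    oriented-opp lower L z = refl
    oriented-opp upper L z = sym (trans (mirror-at (mirror L) z) (neg-mirror-at L z))

    oriented-≤up : ∀ s L {z} → obs (opp s) z ≤ oriented (opp s) L at z → oriented s L at z ≤ up s z
    oriented-≤up s L {z} p = mirror-obs s (oriented s L) (≤-respʳ (oriented-opp s L z) p)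

    oriented-≥obs : ∀ s L {z} → oriented s L at z ≤ up s z → obs (opp s) z ≤ oriented (opp s) L at z
    oriented-≥obs s L {z} p = ≤-respʳ (sym (oriented-opp s L z)) (obs≤mirror s (oriented s L) p)

    by-side : ∀ {p} h (P : Side → Set p) → P h → P (opp h) → ∀ s → P s
    by-side lower P x y lower = x
    by-side lower P x y upper = y
    by-side upper P x y lower = y
    by-side upper P x y upper = x

    -- The pieces are closed intervals, so consecutive lines agree at the breakpoint between them.
    record Competitor : Set (c ⊔ ℓ) where
      field
        n′       : ℕ
        τ        : ℕ → Carrier
        μ        : ℕ → Line
        g        : Carrier → Carrier
        τ-rising : ∀ {i} → i ℕ.< n′ → τ i < τ (suc i)
        τ-last   : τ n′ ≡ t n
        first    : ∀ {z} → z ≤ τ 0 → g z ≡ μ 0 at z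
        next     : ∀ {i} → i ℕ.< n′ → ∀ {z} → τ i ≤ z → z ≤ τ (suc i) → g z ≡ μ (suc i) at z
        within   : ∀ {z} → z ≤ t n → Inside z (g z)

      τ≤last : ∀ {i} → i ℕ.≤ n′ → τ i ≤ t n
      τ≤last i≤n′ = ≤-respʳ τ-last (rising⇒mono τ-rising i≤n′ ℕ.≤-refl)

      next-inside : ∀ {i} → i ℕ.< n′ → ∀ s {z} → τ i ≤ z → z ≤ τ (suc i) → obs s z ≤ oriented s (μ (suc i)) at z
      next-inside {i} i<n′ s {z} p q = ≤-respʳ
        (trans (cong (signed s) (next i<n′ p q)) (sym (oriented-at s (μ (suc i)) z)))
        (within (≤-trans q (τ≤last i<n′)) s)

    -- Where the straight continuation of a link leaves the corridor: having
    -- touched the far side at p, the line hits side h at q and is outside until ξ.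
    record Window (h : Side) (L : Line) (p q ξ : Carrier) : Set (c ⊔ ℓ) where
      field
        p<q     : p < q
        q<ξ     : q < ξ
        ξ≤last  : ξ ≤ t n
        touch   : L at p ≡ up h p
        hit     : L at q ≡ obs h q
        below   : Below h L p q
        outside : ∀ {z} → q < z → z ≤ ξ → L at z < obs h z

    -- Where the next link begins to be bound by each wall: by the one that was hit from `q` on, by
    -- the opposite one already from `p` on, since the next link may branch off anywhere between `p`
    -- and `q`.
    start : (h : Side) (p q : Carrier) → Side → Carrier
    start lower p q lower = q
    start lower p q upper = p
    start upper p q lower = p
    start upper p q upper = q

    start-hit : ∀ h p q → start h p q h ≡ q
    start-hit lower p q = refl
    start-hit upper p q = refl

    start-touch : ∀ h p q → start h p q (opp h) ≡ p
    start-touch lower p q = refl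
    start-touch upper p q = refl

    -- The induction hypothesis of optimality. Its last part is about the line of the competitor
    -- after its breakpoint `τ κ`, and it covers points before that breakpoint, where the competitor
    -- follows another line.
    Reach : ℕ → (Side → Carrier) → Carrier → Set (c ⊔ ℓ)
    Reach κ st q = ∀ (C : Competitor) → let open Competitor C in
      κ ℕ.< n′ × τ κ ≤ q ×
      (q < τ (suc κ) → ∀ s {z} → st s ≤ z → z ≤ τ (suc κ) → obs s z ≤ oriented s (μ (suc κ)) at z)

    module _ {h L p q ξ} (W : Window h L p q ξ) (C : Competitor) where
      open Window W
      open Competitor C

      -- Only the far wall between `p` and `τ κ` needs an argument. The line is not above `L` at
      -- `τ κ`, but above it beyond `q`, where `L` is outside. Hence it is not above `L` before
      -- `τ κ` either, and `L` respects the far wall there.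
      window-crossed : ∀ {κ} → κ ℕ.< n′ → τ κ ≤ q →
        (p ≤ τ κ → oriented h (μ (suc κ)) at τ κ ≤ L at τ κ) →
        q < τ (suc κ) → ∀ s {z} → start h p q s ≤ z → z ≤ τ (suc κ) → obs s z ≤ oriented s (μ (suc κ)) at z
      window-crossed {κ} κ<n′ τ≤q left q<τ′ = by-side h _
        (λ r s → next-inside κ<n′ h (≤-trans τ≤q (≤-respˡ (start-hit h p q) r)) s)
        (λ {z} r s → far (≤-respˡ (start-touch h p q) r) s (≤-<-split (τ κ) z))
        where
        M = oriented h (μ (suc κ))
        -- A point where `L` is outside and the competitor still follows the same line.
        z₀ = min ξ (τ (suc κ))
        q<z₀ : q < z₀
        q<z₀ = <-min _ _ q<ξ q<τ′
        far : ∀ {z} → p ≤ z → z ≤ τ (suc κ) → τ κ ≤ z ⊎ z < τ κ → obs (opp h) z ≤ oriented (opp h) (μ (suc κ)) at z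
        far r s (inj₁ τ≤z) = next-inside κ<n′ (opp h) τ≤z s
        far {z} r s (inj₂ z<τ) = oriented-≥obs h (μ (suc κ)) (≤-trans
          (beyondˡ M L (left (≤-trans r (<⇒≤ z<τ)))
            (≤-trans (<⇒≤ (outside q<z₀ (min-≤ˡ _ _)))
              (next-inside κ<n′ h (≤-trans τ≤q (<⇒≤ q<z₀)) (min-≤ʳ _ _)))
            (≤-<-trans τ≤q q<z₀) (<⇒≤ z<τ))
          (below r (≤-trans (<⇒≤ z<τ) τ≤q)))

    -- `L` lies on the obstacle at `b` and on the opposite wall at `u`. A line through the window is
    -- not below `L` at `b` and not above it at `u`, hence not above it later. So `L` drags it out
    -- of the corridor after `q′`, and the competitor has to bend by then.
    reach-step : ∀ {κ st q y L b u q′ ξ} → Reach κ st q →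
      L at b ≡ obs y b → st y ≤ b → st (opp y) ≤ u → b < u → q < u → Window y L u q′ ξ →
      Reach (suc κ) (start y u q′) q′
    reach-step {κ} {st} {q} {y} {L} {b} {u} {q′} {ξ} R Lb sb su b<u q<u W C
      with R C
    ... | κ<n′ , τ≤q , valid = sκ<n′ , τ′≤q′ , window-crossed W C sκ<n′ τ′≤q′ left
      where
      open Window W
      open Competitor C
      M = oriented y (μ (suc κ))
      M≤L : u ≤ τ (suc κ) → ∀ {z} → u ≤ z → M at z ≤ L at z
      M≤L u≤τ = beyondʳ M L
        (≤-respˡ (sym Lb) (valid q<τ′ y sb (≤-trans (<⇒≤ b<u) u≤τ)))
        (≤-respʳ (sym touch) (oriented-≤up y (μ (suc κ)) (valid q<τ′ (opp y) su u≤τ))) b<u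
        where q<τ′ = <-≤-trans q<u u≤τ
      τ′≤q′ : τ (suc κ) ≤ q′
      τ′≤q′ with ≤-<-split (τ (suc κ)) q′
      ... | inj₁ p = p
      ... | inj₂ q′<τ′ = ⊥-elim (<⇒≱
          (<-≤-trans (outside q′<z₀ (min-≤ˡ ξ (τ (suc κ))))
            (valid (<-trans q<u u<τ′) y (≤-trans sb (<⇒≤ (<-trans (<-trans b<u p<q) q′<z₀))) (min-≤ʳ _ _)))
          (M≤L (<⇒≤ u<τ′) (<⇒≤ (<-trans p<q q′<z₀))))
        where
        u<τ′ = <-trans p<q q′<τ′
        q′<z₀ : q′ < min ξ (τ (suc κ))
        q′<z₀ = <-min _ _ q<ξ q′<τ′
      sκ<n′ : suc κ ℕ.< n′
      sκ<n′ with ℕ.m≤n⇒m<n∨m≡n κ<n′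
      ... | inj₁ p = p
      -- The last breakpoint of the competitor is `t n`, which lies beyond `q′`.
      ... | inj₂ refl = ⊥-elim (<⇒≱ (<-≤-trans q<ξ ξ≤last) (≤-respˡ τ-last τ′≤q′))
      -- Two consecutive lines of the competitor agree at their common breakpoint, so the bound by
      -- `L` passes from one to the next there.
      left : u ≤ τ (suc κ) → oriented y (μ (suc (suc κ))) at τ (suc κ) ≤ L at τ (suc κ)
      left u≤τ = ≤-respˡ (trans (oriented-at y _ _) (trans
          (cong (signed y) (trans (sym (next κ<n′ (<⇒≤ (τ-rising κ<n′)) ≤-refl))
                                  (next sκ<n′ ≤-refl (<⇒≤ (τ-rising sκ<n′)))))
          (sym (oriented-at y _ _))))
        (M≤L u≤τ u≤τ)

    private
      steep : ∀ m k e {z₀} → 0# < e → 0# < m →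
        ∃ λ z → z ≤ z₀ × (m * z + k) + e < m * z₀ + k
      steep m k e {z₀} 0<e 0<m@(_ , m≢) = z₀ - d , 0≤⇒≤ (≤-respʳ
          (solve 2 (λ z d → d := z :- (z :- d)) refl z₀ d) (<⇒≤ (*-pos (+-pos-nonNeg 0<e (<⇒≤ 0<e)) (⁻¹-pos 0<m)))) ,
        0<⇒< (<-respʳ (begin
          e                                       ≡⟨ solve 1 (λ e → e := (e :+ e) :- e) refl e ⟩
          (e + e) - e                             ≡⟨ cong (_- e) (sym md) ⟩
          m * d - e                               ≡⟨ solve 5 (λ m d e z k → m :* d :- e :=
                (m :* z :+ k) :- ((m :* (z :- d) :+ k) :+ e)) refl m d e z₀ k ⟩
          (m * z₀ + k) - ((m * (z₀ - d) + k) + e) ∎) 0<e)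
        where
        open ≡-Reasoning
        -- Twice `e / m`, so that the drop exceeds `e` strictly.
        d = (e + e) * m ⁻¹
        md : m * d ≡ e + e
        md = begin
          m * ((e + e) * m ⁻¹)  ≡⟨ solve 3 (λ m f i → m :* (f :* i) := f :* (m :* i)) refl m (e + e) (m ⁻¹) ⟩
          (e + e) * (m * m ⁻¹)  ≡⟨ cong ((e + e) *_) (*-inverseʳ m (≢-sym m≢)) ⟩
          (e + e) * 1#          ≡⟨ CR.*-identityʳ _ ⟩
          e + e                 ∎

      reflected : ∀ {u v e y} → y ≤ v → u ≤ y + e → - v ≤ - u + e
      reflected {u} {v} {e} {y} p q = 0≤⇒≤ (≤-respʳ
        (solve 4 (λ u v e y → ((y :+ e) :- u) :+ (v :- y) := (:- u :+ e) :- (:- v)) refl u v e y)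
        (+-nonNeg (≤⇒0≤ q) (≤⇒0≤ p)))

    -- Far to the left a rising line falls below any strip; a falling line is treated as a rising
    -- one by reflection.
    confined⇒flat : ∀ L {z₀ y} → (∀ {z} → z ≤ z₀ → y ≤ L at z × L at z ≤ y + ε) → slope L ≡ 0#
    confined⇒flat (line m k) {z₀} {y} conf = go (≤-<-split m 0#) (≤-<-split 0# m)
      where
      rises : ¬ (∃ λ z → z ≤ z₀ × (m * z + k) + ε < m * z₀ + k)
      rises (z , z≤z₀ , gap) = <⇒≱ gap (≤-trans (proj₂ (conf ≤-refl)) (+-monoˡ-≤ ε (proj₁ (conf z≤z₀))))
      falls : ¬ (∃ λ z → z ≤ z₀ × (- m * z + - k) + ε < - m * z₀ + - k)
      falls (z , z≤z₀ , gap) = <⇒≱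
        (subst₂ _<_ (cong (_+ ε) (mirror-at (line m k) z)) (mirror-at (line m k) z₀) gap)
        (reflected (proj₁ (conf ≤-refl)) (proj₂ (conf z≤z₀)))
      go : m ≤ 0# ⊎ 0# < m → 0# ≤ m ⊎ m < 0# → m ≡ 0#
      go (inj₁ p)   (inj₁ q)   = ≤-antisym p q
      go (inj₂ 0<m) _          = ⊥-elim (rises (steep m k ε 0<ε 0<m))
      go _          (inj₂ m<0) = ⊥-elim (falls (steep (- m) (- k) ε 0<ε (<-respˡ -0#≈0# (neg-mono-< m<0))))

    flat-at : ∀ L → slope L ≡ 0# → ∀ x y → L at x ≡ L at y
    flat-at (line _ k) refl x y = trans (cong (_+ k) (trans (CR.zeroˡ x) (sym (CR.zeroˡ y)))) refl

    -- Before `t 0` the competitor is confined to a strip of height `ε`, so its first line is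
    -- horizontal, and it is not above `L`, which touches the ceiling at `t 0`.
    reach-start : ∀ {q ξ L} → slope L ≡ 0# → Window lower L (t 0) q ξ → Reach 0 (start lower (t 0) q) q
    reach-start {q} {ξ} {L} L-flat W C = 0<n′ , τ≤q , window-crossed W C 0<n′ τ≤q left
      where
      open Window W
      open Competitor C
      z₁ = min (t 0) (τ 0)
      conf : ∀ {z} → z ≤ z₁ → a (t 0) ≤ μ 0 at z × μ 0 at z ≤ a (t 0) + ε
      conf {z} z≤z₁ = subst₂ _≤_ aeq geq (within z≤n lower) ,
                      subst₂ _≤_ geq (cong (_+ ε) aeq) (inside-≤ (within z≤n))
        where
        z≤t₀ = ≤-trans z≤z₁ (min-≤ˡ _ _)
        z≤n  = ≤-trans z≤t₀ (t-mono ℕ.z≤n ℕ.≤-refl)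
        aeq  = a-const z≤t₀
        geq  = first (≤-trans z≤z₁ (min-≤ʳ _ _))
      g≤L : ∀ {z} → z ≤ τ 0 → g z ≤ L at z
      g≤L {z} p = subst₂ _≤_ (trans (flat-at (μ 0) (confined⇒flat (μ 0) conf) z₁ z) (sym (first p)))
                             (trans (sym touch) (flat-at L L-flat (t 0) z)) (proj₂ (conf ≤-refl))
      τ≤q : τ 0 ≤ q
      τ≤q with ≤-<-split (τ 0) q
      ... | inj₁ p = p
      ... | inj₂ q<τ = ⊥-elim (<⇒≱
          (<-≤-trans (outside (<-min _ _ q<ξ q<τ) (min-≤ˡ ξ (τ 0)))
            (within (≤-trans (min-≤ʳ ξ (τ 0)) (τ≤last ℕ.z≤n)) lower))
          (g≤L (min-≤ʳ _ _)))
      0<n′ : 0 ℕ.< n′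
      0<n′ = ℕ.n≢0⇒n>0 λ { refl → <⇒≱ (<-≤-trans q<ξ ξ≤last) (≤-respˡ τ-last τ≤q) }
      left : t 0 ≤ τ 0 → μ 1 at τ 0 ≤ L at τ 0
      left _ = ≤-respˡ (next 0<n′ ≤-refl (<⇒≤ (τ-rising 0<n′))) (g≤L ≤-refl)

    -- The path formed by the emitted links

    record Path (bx by : ℕ → Carrier) (ln : ℕ → Line) (κ : ℕ) (e : Carrier) : Set (c ⊔ ℓ) where
      field
        joined : Joined bx ln κ
        height : ∀ {i} → i ℕ.< κ → by i ≡ ln i at bx i
        valid  : ∀ {z} → z ≤ e → Inside z (pieces bx ln κ z)

    oriented-meet : ∀ s K L {x} → K at x ≡ L at x → oriented s K at x ≡ oriented s L at x
    oriented-meet s K L {x} p = trans (oriented-at s K x) (trans (cong (signed s) p) (sym (oriented-at s L x)))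

    oriented-slope : ∀ s K L → slope K ≡ slope L → slope (oriented s K) ≡ slope (oriented s L)
    oriented-slope lower K L p = p
    oriented-slope upper K L p = cong -_ p

    module _ {bx by ln κ h p q ξ} (P : Path bx by ln κ q) (before : ∀ {i} → i ℕ.< κ → bx i < p)
      (W : Window h (oriented h (ln κ)) p q ξ)
      (N : Line) {e : Carrier} (q<e : q < e)
      (N-valid : ∀ s {z} → start h p q s ≤ z → z ≤ e → obs s z ≤ oriented s N at z) where
      open Path P
      open Joined joined
      open Window W

      private
        K = ln κ
        K′ = oriented h K
        N′ = oriented h N
        x = crossing K N
        z₀ = min ξ e
        q<z₀ : q < z₀
        q<z₀ = <-min _ _ q<ξ q<e
        N≥ : ∀ {z} → q ≤ z → z ≤ e → obs h z ≤ N′ at z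
        N≥ r = N-valid h (≤-respˡ (sym (start-hit h p q)) r)
        N≤ : ∀ {z} → p ≤ z → z ≤ e → obs (opp h) z ≤ oriented (opp h) N at z
        N≤ r = N-valid (opp h) (≤-respˡ (sym (start-touch h p q)) r)
        c₁ : N′ at p ≤ K′ at p
        c₁ = ≤-respʳ (sym touch) (oriented-≤up h N (N≤ ≤-refl (<⇒≤ (<-trans p<q q<e))))
        c₂ : K′ at q ≤ N′ at q
        c₂ = ≤-respˡ (sym hit) (N≥ ≤-refl (<⇒≤ q<e))
        c₃ : K′ at z₀ < N′ at z₀
        c₃ = <-≤-trans (outside q<z₀ (min-≤ˡ _ _)) (N≥ (<⇒≤ q<z₀) (min-≤ʳ _ _))
        bends : slope K ≢ slope N
        bends eq = slopes-differ K′ N′ p<q q<z₀ c₁ c₂ c₃ (oriented-slope h K N eq)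
        meets : K at x ≡ N at x
        meets = crossing-meets K N bends
        meets′ : K′ at x ≡ N′ at x
        meets′ = oriented-meet h K N meets
        p≤x : p ≤ x
        p≤x = crossing-≥ K′ N′ p<q q<z₀ c₁ c₂ c₃ meets′

      crossing≤hit : crossing (ln κ) N ≤ q
      crossing≤hit = crossing-≤ K′ N′ p<q q<z₀ c₁ c₂ c₃ meets′

      -- The new breakpoint lies between `p` and `q`, behind all earlier ones. Between it and `q`
      -- the new link is not yet bound by the wall of side `h`, but it lies on the safe side of the
      -- old link, which is valid up to `q`.
      path-extend : ∀ {bx′ by′ ln′} → 0# ≤ slope N →
        (∀ {i} → i ℕ.< κ → bx′ i ≡ bx i) → (∀ {i} → i ℕ.< κ → by′ i ≡ by i) → (∀ {i} → i ℕ.≤ κ → ln′ i ≡ ln i) →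
        bx′ κ ≡ crossing (ln κ) N → by′ κ ≡ ln κ at crossing (ln κ) N → ln′ (suc κ) ≡ N →
        Path bx′ by′ ln′ (suc κ) e
      path-extend {bx′} {by′} {ln′} 0≤N bx≡ by≡ ln≡ bxκ byκ lnκ = record
        { joined = record
          { sorted = λ r → sorted′ (ℕ.m≤n⇒m<n∨m≡n (ℕ.s≤s⁻¹ r))
          ; meet   = λ r → meet′ (ℕ.m≤n⇒m<n∨m≡n (ℕ.s≤s⁻¹ r))
          ; bend   = λ r → bend′ (ℕ.m≤n⇒m<n∨m≡n (ℕ.s≤s⁻¹ r))
          ; nonneg = λ r → nonneg′ (ℕ.m≤n⇒m<n∨m≡n r)
          ; flat   = trans (cong slope (ln≡ ℕ.z≤n)) flat }
        ; height = λ r → height′ (ℕ.m≤n⇒m<n∨m≡n (ℕ.s≤s⁻¹ r))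
        ; valid  = λ {z} r → valid′ r (≤-<-split z x) }
        where
        sorted′ : ∀ {i} → suc i ℕ.< κ ⊎ suc i ≡ κ → bx′ i < bx′ (suc i)
        sorted′ (inj₁ r) = subst₂ _<_ (sym (bx≡ (ℕ.<⇒≤ r))) (sym (bx≡ r)) (sorted r)
        sorted′ {i} (inj₂ refl) = subst₂ _<_ (sym (bx≡ ℕ.≤-refl)) (sym bxκ) (<-≤-trans (before ℕ.≤-refl) p≤x)
        meet′ : ∀ {i} → i ℕ.< κ ⊎ i ≡ κ → ln′ i at bx′ i ≡ ln′ (suc i) at bx′ i
        meet′ (inj₁ r) = trans (cong₂ _at_ (ln≡ (ℕ.<⇒≤ r)) (bx≡ r))
          (trans (meet r) (sym (cong₂ _at_ (ln≡ r) (bx≡ r))))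
        meet′ (inj₂ refl) = trans (cong₂ _at_ (ln≡ ℕ.≤-refl) bxκ) (trans meets (sym (cong₂ _at_ lnκ bxκ)))
        bend′ : ∀ {i} → i ℕ.< κ ⊎ i ≡ κ → slope (ln′ i) ≢ slope (ln′ (suc i))
        bend′ (inj₁ r) eq = bend r (trans (cong slope (sym (ln≡ (ℕ.<⇒≤ r)))) (trans eq (cong slope (ln≡ r))))
        bend′ (inj₂ refl) eq = bends (trans (cong slope (sym (ln≡ ℕ.≤-refl))) (trans eq (cong slope lnκ)))
        nonneg′ : ∀ {i} → i ℕ.< suc κ ⊎ i ≡ suc κ → 0# ≤ slope (ln′ i)
        nonneg′ (inj₁ r) = ≤-respʳ (cong slope (sym (ln≡ (ℕ.s≤s⁻¹ r)))) (nonneg (ℕ.s≤s⁻¹ r))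
        nonneg′ (inj₂ refl) = ≤-respʳ (cong slope (sym lnκ)) 0≤N
        height′ : ∀ {i} → i ℕ.< κ ⊎ i ≡ κ → by′ i ≡ ln′ i at bx′ i
        height′ (inj₁ r) = trans (by≡ r) (trans (height r) (sym (cong₂ _at_ (ln≡ (ℕ.<⇒≤ r)) (bx≡ r))))
        height′ (inj₂ refl) = trans byκ (sym (cong₂ _at_ (ln≡ ℕ.≤-refl) bxκ))
        valid′ : ∀ {z} → z ≤ e → z ≤ x ⊎ x < z → Inside z (pieces bx′ ln′ (suc κ) z)
        valid′ {z} r (inj₁ z≤x) s = ≤-respʳ (cong (signed s) (sym
            (trans (pieces-≤ κ (≤-respʳ (sym bxκ) z≤x)) (pieces-cong κ bx≡ ln≡ z))))
          (valid (≤-trans z≤x crossing≤hit) s)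
        valid′ {z} r (inj₂ x<z) s = ≤-respʳ
            (trans (oriented-at s N z) (cong (signed s) (sym (trans (pieces-> κ (<-respˡ (sym bxκ) x<z)) (cong (_at z) lnκ)))))
          (by-side h (λ s → obs s z ≤ oriented s N at z) (near (≤-<-split q z)) (N≤ (≤-trans p≤x (<⇒≤ x<z)) r) s)
          where
          near : q ≤ z ⊎ z < q → obs h z ≤ N′ at z
          near (inj₁ q≤z) = N≥ q≤z r
          near (inj₂ z<q) = ≤-trans
            (≤-respʳ (trans (cong (signed h) (pieces-final κ (λ i<κ → <-≤-trans (before i<κ) (≤-trans p≤x (<⇒≤ x<z)))))
                            (sym (oriented-at h K z))) (valid (<⇒≤ z<q) h))
            (between K′ N′ (≤-reflexive meets′) c₂ (<⇒≤ x<z) (<⇒≤ z<q))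

    -- Invariants of the stages

    up≡obs+ε : ∀ s z → obs s z + ε ≡ up s z
    up≡obs+ε lower z = refl
    up≡obs+ε upper z = solve 2 (λ a e → :- (a :+ e) :+ e := :- a) refl (a z) ε

    -- The arrays ts, os, hx and hy hold the data of both sides; those of side s start at offset s.
    offset : Side → ℕ
    offset lower = 0
    offset upper = suc n

    regions-disjoint : ∀ s {i j} → offset s ℕ.≤ i → i ℕ.< offset s ℕ.+ suc n →
      offset (opp s) ℕ.≤ j → j ℕ.< offset (opp s) ℕ.+ suc n → j ≢ i
    regions-disjoint lower p q r s refl = ℕ.<⇒≱ q r
    regions-disjoint upper p q r s refl = ℕ.<⇒≱ s p

    -- One extreme line of the wedge with the hull that it turns about. `s₀` and `s₁` are the starts
    -- of the window on its own and on the opposite side; either wall is respected as far as its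
    -- hull goes.
    record Flank (hx hy : ℕ → Carrier) (s : Side) (s₀ s₁ : Carrier) (b t t′ : ℕ) (L : Line) : Set (c ⊔ ℓ) where
      field
        hull    : Hull hx hy (obs s) b t
        start≤  : s₀ ≤ hx b
        above   : Above s L s₀ (hx t)
        below   : Below s L s₁ (hx t′)
        contact : L at hx b ≡ hy b

    -- The second contact lies to the right of the first and of the window. `reach-step` needs both
    -- facts, and the first one makes links rise.
    Touch : (hx : ℕ → Carrier) (s : Side) (b b′ t′ u : ℕ) (L : Line) (q : Carrier) → Set (c ⊔ ℓ)
    Touch hx s b b′ t′ u L q = b′ ℕ.≤ u × u ℕ.≤ t′ × L at hx u ≡ up s (hx u) × hx b < hx u × q < hx u

    -- The second contact of an extreme line may be the next point of the other side, which is not on its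
    -- hull yet.
    Pending : (hx : ℕ → Carrier) (s : Side) (b : ℕ) (L : Line) (j : ℕ) → Set (c ⊔ ℓ)
    Pending hx s b L j = up s (t j) ≤ L at t j × hx b < t j

    record Layout (y : Side) (jy jx : ℕ) (v : View) : Set c where
      open View v
      field
        yi≡  : yi ≡ offset y ℕ.+ jy
        xi≡  : xi ≡ offset (opp y) ℕ.+ jx
        yb≥  : offset y ℕ.≤ yb
        yt<  : yt ℕ.< offset y ℕ.+ jy
        xb≥  : offset (opp y) ℕ.≤ xb
        xt<  : xt ℕ.< offset (opp y) ℕ.+ jx
        1≤jy : 1 ℕ.≤ jy
        jx≡  : jx ≡ lead y jy
        -- The two walls have `n + 1` points each, and `rem` counts those to come.
        rem≡ : rem ℕ.+ (jy ℕ.+ jx) ≡ suc n ℕ.+ suc n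
        sg≡  : sg ≡ sign y
        ε≡   : ε′ ≡ ε
        ts≡  : ∀ s {j} → j ℕ.≤ n → ts (offset s ℕ.+ j) ≡ t j
        os≡  : ∀ s {j} → j ℕ.≤ n → os (offset s ℕ.+ j) ≡ obs s (t j)

    record Output (h : Side) (p q ξ : Carrier) (v : View) : Set (c ⊔ ℓ) where
      open View v
      field
        window : Window h (oriented h (links k)) p q ξ
        path   : Path bx by links k q
        before : ∀ {i} → i ℕ.< k → bx i < p
        reach  : Reach k (start h p q) q

    -- jy and jx count the points already on the hulls of the sides Y and X = opp y.
    record Core (y : Side) (jy jx : ℕ) (v : View) : Set (c ⊔ ℓ) where
      open View v
      field
        layout  : Layout y jy jx v
        h       : Side
        p q ξ   : Carrier
        output  : Output h p q ξ v
        flankY  : Flank hx hy y (start h p q y) (start h p q (opp y)) yb yt xt MY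
        flankX  : Flank hx hy (opp y) (start h p q (opp y)) (start h p q y) xb xt yt MX
        topX    : hx xt ≡ t (ℕ.pred jx)
        q<next  : jy ℕ.≤ n → q < t jy
        dueX    : Touch hx (opp y) xb yb yt xT MX q ⊎ Pending hx (opp y) xb MX jy

    -- The state before a point of Y is tested. The second contact of `MY` is settled, so the stage
    -- may end with this line.
    record Ready (y : Side) (jy jx : ℕ) (v : View) : Set (c ⊔ ℓ) where
      open View v
      field
        core   : Core y jy jx v
      open Core core public
      field
        topY   : hx yt ≡ t (ℕ.pred jy)
        touchY : Touch hx y yb xb xt yT MY q

    -- The next point of Y does not end the stage. Right after the start of a stage the top of the
    -- hull of Y is the window end and not a point of the input, hence bounds instead of an equation
    -- for it.
    record Checked (y : Side) (jy jx : ℕ) (v : View) : Set (c ⊔ ℓ) where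
      open View v
      field
        core   : Core y jy jx v
      open Core core public
      field
        jy≤n   : jy ℕ.≤ n
        topY≥  : t (ℕ.pred jy) ≤ hx yt
        topY<  : hx yt < t jy
        yT≤    : xb ℕ.≤ yT × yT ℕ.≤ xt
        clear  : obs y (t jy) ≤ MY at t jy
        -- A pending contact lies beyond the hull of X, so the other line may turn up to the top of
        -- that hull.
        dueY   : Touch hx y yb xb xt yT MY q ⊎ (yT ≡ xt × Pending hx y yb MY jx)

    t-pred< : ∀ {j} → 1 ℕ.≤ j → j ℕ.≤ n → t (ℕ.pred j) < t j
    t-pred< (ℕ.s≤s _) p = t-rising p

    obs-affine′ : ∀ s {j} → 1 ℕ.≤ j → j ℕ.≤ n → AffineBetween (t (ℕ.pred j)) (t j) (obs s)
    obs-affine′ s (ℕ.s≤s _) p = obs-affine s p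

    up-affine′ : ∀ s {j} → 1 ℕ.≤ j → j ℕ.≤ n → AffineBetween (t (ℕ.pred j)) (t j) (up s)
    up-affine′ s (ℕ.s≤s _) p = up-affine s p

    jx-range : ∀ {y jy jx v} → Layout y jy jx v → jy ℕ.≤ jx × jx ℕ.≤ suc jy
    jx-range {lower} l rewrite Layout.jx≡ l = ℕ.≤-refl , ℕ.n≤1+n _
    jx-range {upper} l rewrite Layout.jx≡ l = ℕ.n≤1+n _ , ℕ.≤-refl

    -- Where a line leaves the corridor

    weighted : (d₀ d₁ x₀ x₁ : Carrier) → Carrier
    weighted d₀ d₁ x₀ x₁ = (x₀ * d₁ + x₁ * d₀) * (d₀ + d₁) ⁻¹

    module _ {x₀ x₁ : Carrier} (L K : Line) (x₀<x₁ : x₀ < x₁) (p : K at x₀ ≤ L at x₀) (q : L at x₁ < K at x₁) where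
      private
        d₀ = L at x₀ - K at x₀
        d₁ = K at x₁ - L at x₁
        D = d₀ + d₁
        0<D : 0# < D
        0<D = +-nonNeg-pos (≤⇒0≤ p) (<⇒0< q)
        w = weighted d₀ d₁ x₀ x₁
        Dw : D * w ≡ x₀ * d₁ + x₁ * d₀
        Dw = trans (solve 3 (λ d e i → d :* (e :* i) := e :* (d :* i)) refl D (x₀ * d₁ + x₁ * d₀) (D ⁻¹))
               (trans (cong ((x₀ * d₁ + x₁ * d₀) *_) (*-inverseʳ D (≢-sym (proj₂ 0<D)))) (CR.*-identityʳ _))

      weighted-≥ : x₀ ≤ w
      weighted-≥ = 0≤⇒≤ (0≤-cancel-* 0<D (≤-respʳ (begin
        d₀ * (x₁ - x₀)                      ≡⟨ solve 4 (λ d e x y → d :* (y :- x) := (x :* e :+ y :* d) :- (d :+ e) :* x) refl d₀ d₁ x₀ x₁ ⟩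
        (x₀ * d₁ + x₁ * d₀) - D * x₀        ≡⟨ cong (_- D * x₀) (sym Dw) ⟩
        D * w - D * x₀                      ≡⟨ solve 3 (λ d w x → d :* w :- d :* x := d :* (w :- x)) refl D w x₀ ⟩
        D * (w - x₀)                        ∎) (*-nonNeg (≤⇒0≤ p) (≤⇒0≤ (<⇒≤ x₀<x₁)))))
        where open ≡-Reasoning

      weighted-< : w < x₁
      weighted-< = 0<⇒< (0<-cancel-* 0<D (<-respʳ (begin
        d₁ * (x₁ - x₀)                      ≡⟨ solve 4 (λ d e x y → e :* (y :- x) := (d :+ e) :* y :- (x :* e :+ y :* d)) refl d₀ d₁ x₀ x₁ ⟩
        D * x₁ - (x₀ * d₁ + x₁ * d₀)        ≡⟨ cong (λ u → D * x₁ - u) (sym Dw) ⟩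
        D * x₁ - D * w                      ≡⟨ solve 3 (λ d w x → d :* x :- d :* w := d :* (x :- w)) refl D w x₁ ⟩
        D * (x₁ - w)                        ∎) (*-pos (<⇒0< q) (<⇒0< x₀<x₁))))
        where open ≡-Reasoning

      weighted-meets : L at w ≡ K at w
      weighted-meets = trans (solve 2 (λ u v → u := (u :- v) :+ v) refl (L at w) (K at w))
        (trans (cong (_+ K at w) (*-cancel-≢0 (≢-sym (proj₂ 0<D)) (begin
          D * (L at w - K at w)
            ≡⟨ solve 6 (λ D w m k m′ k′ → D :* ((m :* w :+ k) :- (m′ :* w :+ k′)) :=
                  (m :- m′) :* (D :* w) :+ (k :- k′) :* D) refl D w (slope L) (intercept L) (slope K) (intercept K) ⟩
          (slope L - slope K) * (D * w) + (intercept L - intercept K) * D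
            ≡⟨ cong (λ u → (slope L - slope K) * u + (intercept L - intercept K) * D) Dw ⟩
          (slope L - slope K) * (x₀ * d₁ + x₁ * d₀) + (intercept L - intercept K) * D
            ≡⟨ solve 6 (λ m k m′ k′ x y →
                 let d = (m :* x :+ k) :- (m′ :* x :+ k′); e = (m′ :* y :+ k′) :- (m :* y :+ k) in
                 (m :- m′) :* (x :* e :+ y :* d) :+ (k :- k′) :* (d :+ e) := con (pos 0)) refl
                 (slope L) (intercept L) (slope K) (intercept K) x₀ x₁ ⟩
          0# ∎))) (CR.+-identityˡ _))
        where open ≡-Reasoning

    exit : Side → Line → (x₀ x₁ : Carrier) → Carrier
    exit s L x₀ x₁ = weighted (L at x₀ - obs s x₀) (obs s x₁ - L at x₁) x₀ x₁

    record Exit (s : Side) (L : Line) (x₀ x₁ : Carrier) : Set (c ⊔ ℓ) where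
      field
        exit≥   : x₀ ≤ exit s L x₀ x₁
        exit<   : exit s L x₀ x₁ < x₁
        exit-at : L at exit s L x₀ x₁ ≡ obs s (exit s L x₀ x₁)
        outside : ∀ {z} → exit s L x₀ x₁ < z → z ≤ x₁ → L at z < obs s z

    exits : ∀ s L {x₀ x₁} → AffineBetween x₀ x₁ (obs s) → x₀ < x₁ → obs s x₀ ≤ L at x₀ → L at x₁ < obs s x₁ → Exit s L x₀ x₁
    exits s L {x₀} {x₁} A@(K , eq) x₀<x₁ p q = record
      { exit≥   = ≤-respʳ (sym w≡) w≥
      ; exit<   = <-respˡ (sym w≡) w<
      ; exit-at = subst (λ w → L at w ≡ obs s w) (sym w≡) (trans wm (sym (eq w≥ (<⇒≤ w<))))
      ; outside = λ {z} r → affine-> L (affine-⊆ (≤-respʳ (sym w≡) w≥) ≤-refl A)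
          (≤-reflexive (subst (λ w → L at w ≡ obs s w) (sym w≡) (trans wm (sym (eq w≥ (<⇒≤ w<)))))) q r }
      where
      e₀ = eq ≤-refl (<⇒≤ x₀<x₁)
      e₁ = eq (<⇒≤ x₀<x₁) ≤-refl
      p′ = ≤-respˡ e₀ p
      q′ = <-respʳ e₁ q
      w≡ : exit s L x₀ x₁ ≡ weighted (L at x₀ - K at x₀) (K at x₁ - L at x₁) x₀ x₁
      w≡ = cong₂ (λ u v → weighted (L at x₀ - u) (v - L at x₁) x₀ x₁) e₀ e₁
      w≥ = weighted-≥ L K x₀<x₁ p′ q′
      w< = weighted-< L K x₀<x₁ p′ q′
      wm = weighted-meets L K x₀<x₁ p′ q′

    -- Starting a stage

    record Blocked (y : Side) (jy jx : ℕ) (v : View) : Set (c ⊔ ℓ) where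
      open View v
      field
        layout  : Layout y jy jx v
        jy≤n    : jy ℕ.≤ n
        yb≤yt   : yb ℕ.≤ yt
        topY    : hx yt ≡ t (ℕ.pred jy)
        valY    : hy yt ≡ obs y (hx yt)
        hullX   : Hull hx hy (obs (opp y)) xb xt
        topX    : hx xt ≡ t (ℕ.pred jx)
        xb≤yT   : xb ℕ.≤ yT
        yT≤xt   : yT ℕ.≤ xt
        touch   : MY at hx yT ≡ up y (hx yT)
        below   : Below y MY (hx yT) (hx xt)
        clear   : obs y (hx yt) ≤ MY at hx yt
        blocked : MY at t jy < obs y (t jy)

    module _ {y jy jx v} (B : Blocked y jy jx v) where
      open Blocked B
      open Layout layout
      open View v
      private
        L = MY
        x = t jy
        e = hx yt
        p = hx yT
        q = exitV v
        pred≤ : ℕ.pred jx ℕ.≤ jy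
        pred≤ = ℕ.pred-mono-≤ (proj₂ (jx-range layout))
        e<x : e < x
        e<x = <-respˡ (sym topY) (t-pred< 1≤jy jy≤n)
        e≤top : e ≤ hx xt
        e≤top = subst₂ _≤_ (sym topY) (sym topX)
          (t-mono (ℕ.pred-mono-≤ (proj₁ (jx-range layout))) (ℕ.≤-trans pred≤ jy≤n))
        top≤x : hx xt ≤ x
        top≤x = ≤-respˡ (sym topX) (t-mono pred≤ jy≤n)
        obsA : AffineBetween e x (obs y)
        obsA = affine-⊆ (≤-reflexive (sym topY)) ≤-refl (obs-affine′ y 1≤jy jy≤n)
        upA : AffineBetween e x (up y)
        upA = affine-⊆ (≤-reflexive (sym topY)) ≤-refl (up-affine′ y 1≤jy jy≤n)
        p≤top : p ≤ hx xt
        p≤top = hull-mono hullX xb≤yT yT≤xt ℕ.≤-refl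
        X = exits y L obsA e<x clear blocked
        open Exit X
        tsx : ts yi ≡ x
        tsx = trans (cong ts yi≡) (ts≡ y jy≤n)
        osx : os yi ≡ obs y x
        osx = trans (cong os yi≡) (os≡ y jy≤n)
        q≡ : q ≡ exit y L e x
        q≡ = trans (cong₂ (λ u w → weighted (L at e - hy yt) (u - L at w) e w) osx tsx)
                   (cong (λ u → weighted (L at e - u) (obs y x - L at x) e x) valY)
        q≥ : e ≤ q
        q≥ = ≤-respʳ (sym q≡) exit≥
        q< : q < x
        q< = <-respˡ (sym q≡) exit<
        q-at : L at q ≡ obs y q
        q-at = subst (λ w → L at w ≡ obs y w) (sym q≡) exit-at
        q-out : ∀ {z} → q < z → z ≤ x → L at z < obs y z
        q-out r = outside (<-respˡ q≡ r)
        -- At `p` the line is at the ceiling, strictly above the obstacle, so it can neither be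
        -- running into the obstacle there nor have done so before.
        p<q : p < q
        p<q = go (≤-<-split q p)
          where
          L>obs : obs y p < L at p
          L>obs = <-respʳ (sym touch) (obs<up y p)
          go : q ≤ p ⊎ p < q → p < q
          go (inj₂ r) = r
          go (inj₁ q≤p) = ⊥-elim (<-irrefl (<-≤-trans L>obs (go′ (≤-<-split p q))))
            where
            go′ : p ≤ q ⊎ q < p → L at p ≤ obs y p
            go′ (inj₁ p≤q) = ≤-reflexive (subst (λ w → L at w ≡ obs y w) (≤-antisym q≤p p≤q) q-at)
            go′ (inj₂ q<p) = <⇒≤ (q-out q<p (≤-trans p≤top top≤x))
        below-q : ∀ {z} → p ≤ z → z ≤ q → L at z ≤ up y z
        below-q {z} r s = go (≤-<-split z (hx xt))
          where
          go : z ≤ hx xt ⊎ hx xt < z → L at z ≤ up y z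
          go (inj₁ z≤) = below r z≤
          go (inj₂ z>) = affine-≥ L (affine-⊆ e≤top (<⇒≤ q<) upA) (below p≤top ≤-refl)
            (subst (_≤ up y q) (sym q-at) (<⇒≤ (obs<up y q))) (<⇒≤ z>) s

      blocked-window : Window y L p q x
      blocked-window = record { p<q = p<q ; q<ξ = q< ; ξ≤last = t-mono jy≤n ℕ.≤-refl
        ; touch = touch ; hit = q-at ; below = below-q ; outside = q-out }

      above-exit : ∀ {s₀} → Above y L s₀ e → Above y L s₀ q
      above-exit {s₀} A {z} r s with ≤-<-split z e
      ... | inj₁ z≤e = A r z≤e
      ... | inj₂ e<z = affine-≤ L (affine-⊆ ≤-refl (<⇒≤ q<) obsA) clear (≤-reflexive (sym q-at)) (<⇒≤ e<z) s

      below-exit : ∀ {s₁} → Below y L s₁ (hx xt) → Below y L s₁ q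
      below-exit {s₁} A {z} r s with ≤-<-split z (hx xt)
      ... | inj₁ z≤ = A r z≤
      ... | inj₂ z> = below-q (≤-trans p≤top (<⇒≤ z>)) s

      private
        v′ = startStage v
        module v′ = View v′
        -- The sides occupy disjoint regions of the arrays, so overwriting position `yt` leaves the
        -- hull of X intact.
        x≢yt : ∀ {h} → xb ℕ.≤ h → h ℕ.≤ xt → h ≢ yt
        x≢yt r s = regions-disjoint y (ℕ.≤-trans yb≥ yb≤yt)
          (ℕ.<-≤-trans yt< (ℕ.+-monoʳ-≤ _ (ℕ.m≤n⇒m≤1+n jy≤n)))
          (ℕ.≤-trans xb≥ r)
          (ℕ.≤-<-trans s (ℕ.<-≤-trans xt< (ℕ.+-monoʳ-≤ _ (ℕ.≤-trans (proj₂ (jx-range layout)) (ℕ.s≤s jy≤n)))))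

        hx′≡ : ∀ {h} → xb ℕ.≤ h → h ℕ.≤ xt → v′.hx h ≡ hx h
        hx′≡ r s = update-other hx yt q (x≢yt r s)
        hy′≡ : ∀ {h} → xb ℕ.≤ h → h ℕ.≤ xt → v′.hy h ≡ hy h
        hy′≡ r s = update-other hy yt _ (x≢yt r s)
        hx′yt : v′.hx yt ≡ q
        hx′yt = update-same hx yt q
        hy′yt : v′.hy yt ≡ L at q
        hy′yt = update-same hy yt _
        N = v′.MY
        N≡ : N ≡ through q (L at q) x (up y x)
        N≡ = cong₂ (through q (L at q)) tsx (trans (cong₂ _+_ osx ε≡) (up≡obs+ε y x))
        N-q : N at q ≡ L at q
        N-q = trans (cong (_at q) N≡) (through₁ _ _ _ _)
        N-x : N at x ≡ up y x
        N-x = trans (cong (_at x) N≡) (through₂ _ _ q<)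
        M≡ : v′.MX ≡ mirror L
        M≡ = 0-mirror _ _
        N≤L : ∀ {z} → z ≤ q → N at z ≤ L at z
        N≤L = beyondˡ N L (≤-reflexive N-q) (≤-respʳ (sym N-x) (<⇒≤ (<-trans blocked (obs<up y x)))) q<
        N≤up : ∀ {z} → p ≤ z → z ≤ x → N at z ≤ up y z
        N≤up {z} r s with ≤-<-split z q
        ... | inj₁ z≤q = ≤-trans (N≤L z≤q) (below-q r z≤q)
        ... | inj₂ q<z = affine-≥ N (affine-⊆ q≥ ≤-refl upA)
          (≤-respˡ (sym N-q) (below-q (<⇒≤ p<q) ≤-refl)) (≤-reflexive N-x) (<⇒≤ q<z) s

        layout′ : Layout y jy jx v′
        layout′ = record
          { yi≡ = yi≡ ; xi≡ = xi≡ ; yb≥ = ℕ.≤-trans yb≥ yb≤yt ; yt< = yt< ; xb≥ = ℕ.≤-trans xb≥ xb≤yT ; xt< = xt<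
          ; 1≤jy = 1≤jy ; jx≡ = jx≡ ; rem≡ = rem≡ ; sg≡ = sg≡ ; ε≡ = ε≡ ; ts≡ = ts≡ ; os≡ = os≡ }

      -- The finished link passes below the blocking point, so its reflection is too high there and
      -- its second contact is pending. The line `N` ends at the ceiling over the same abscissa, so
      -- it clears that point.
      stage-started : Output y p q x v → Checked y jy jx v′
      stage-started out = record
        { core = record
          { layout = layout′ ; h = y ; p = p ; q = q ; ξ = x
          ; output = record { Output out }
          ; flankY = record
            { hull = hull-singleton (trans hy′yt (trans q-at (cong (obs y) (sym hx′yt))))
            ; start≤ = ≤-reflexive (trans (start-hit y p q) (sym hx′yt))
            ; above = λ {z} r s → subst (λ w → obs y w ≤ N at w)
                (≤-antisym (≤-respˡ (start-hit y p q) r) (≤-respʳ hx′yt s))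
                (≤-reflexive (sym (trans N-q q-at)))
            ; below = λ r s → N≤up (≤-respˡ (start-touch y p q) r) (≤-trans (≤-respʳ hx′xt s) top≤x)
            ; contact = trans (cong (N at_) hx′yt) (trans N-q (sym hy′yt)) }
          ; flankX = record
            { hull = hull-tail (hull-cong (λ r s → hx′≡ r s , hy′≡ r s) hullX) xb≤yT yT≤xt
            ; start≤ = ≤-reflexive (trans (start-touch y p q) (sym hx′yT))
            ; above = λ {z} r s → subst (λ M → obs (opp y) z ≤ M at z) (sym M≡)
                (obs≤mirror y L (below (≤-respˡ (start-touch y p q) r) (≤-respʳ hx′xt s)))
            ; below = λ {z} r s → subst (λ M → M at z ≤ up (opp y) z) (sym M≡)
                (mirror≤up y L (subst (λ w → obs y w ≤ L at w)
                  (≤-antisym (≤-respˡ (start-hit y p q) r) (≤-respʳ hx′yt s)) (≤-reflexive (sym q-at))))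
            ; contact = trans (cong₂ _at_ M≡ hx′yT) (trans (mirror-at L p)
                (trans (cong -_ touch) (trans (sym (obs-opp y p)) (trans (sym (val hullX xb≤yT yT≤xt))
                  (sym (hy′≡ xb≤yT yT≤xt)))))) }
          ; topX = trans hx′xt topX
          ; q<next = λ _ → q<
          ; dueX = inj₂ (subst (λ M → up (opp y) x ≤ M at x) (sym M≡)
              (subst₂ _≤_ (sym (up-opp y x)) (sym (mirror-at L x)) (neg-mono-≤ (<⇒≤ blocked))) ,
              <-respˡ (sym hx′yT) (<-trans p<q q<)) }
        ; jy≤n = jy≤n
        ; topY≥ = ≤-respʳ (sym hx′yt) (≤-respˡ topY q≥)
        ; topY< = <-respˡ (sym hx′yt) q<
        ; yT≤ = yT≤xt , ℕ.≤-refl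
        ; clear = ≤-respʳ (sym N-x) (<⇒≤ (obs<up y x))
        ; dueY = due y refl }
        where
        hx′xt : v′.hx xt ≡ hx xt
        hx′xt = hx′≡ (b≤t hullX) ℕ.≤-refl
        hx′yT : v′.hx yT ≡ p
        hx′yT = hx′≡ xb≤yT yT≤xt
        -- `N` touches the wall X over `x`. If Y is the lower side, that point of X is still to
        -- come; if Y is the upper side, it is already the top of the hull of X.
        due : ∀ s → s ≡ y → Touch v′.hx y yt yT xt xt N q ⊎ (xt ≡ xt × Pending v′.hx y yt N jx)
        due lower refl = inj₂ (refl , subst (λ j → Pending v′.hx lower yt N j) (sym jx≡)
          (≤-reflexive (sym N-x) , <-respˡ (sym hx′yt) q<))
        due upper refl = inj₁ (yT≤xt , ℕ.≤-refl ,
          subst (λ w → N at w ≡ up upper w) (sym ht) N-x ,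
          subst₂ _<_ (sym hx′yt) (sym ht) q< , <-respʳ (sym ht) q<)
          where
          ht : v′.hx xt ≡ x
          ht = trans hx′xt (trans topX (cong (λ j → t (ℕ.pred j)) jx≡))

    -- Finishing or continuing a stage

    module _ {y jy jx v} (R : Ready y jy jx v) where
      open Ready R
      open Layout layout
      open Output output
      open View v
      private
        module Y = Flank flankY
        module X = Flank flankX
        N = emitted v
        v′ = emit v
        module v′ = View v′
        N≡ : N ≡ oriented y MY
        N≡ = trans (cong (λ s → line (s * ym) (s * yk)) sg≡) (sign-oriented y ym yk)
        N-oriented : oriented y N ≡ MY
        N-oriented = trans (cong (oriented y) N≡) (oriented-involutive y MY)
        hy-yb : MY at hx yb ≡ obs y (hx yb)
        hy-yb = trans Y.contact (val Y.hull ℕ.≤-refl (b≤t Y.hull))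
        b = hx yb
        u = hx yT
        u-touch : MY at u ≡ up y u
        u-touch = proj₁ (proj₂ (proj₂ touchY))
        b<u : b < u
        b<u = proj₁ (proj₂ (proj₂ (proj₂ touchY)))
        q<u : q < u
        q<u = proj₂ (proj₂ (proj₂ (proj₂ touchY)))
        xb≤yT = proj₁ touchY
        yT≤xt = proj₁ (proj₂ touchY)
        u≤top : u ≤ hx xt
        u≤top = hull-mono X.hull xb≤yT yT≤xt ℕ.≤-refl
        links-new : v′.links (suc k) ≡ N
        links-new = cong₂ line (update-same lm (suc k) _) (update-same lk (suc k) _)
        links-old : ∀ {i} → i ℕ.≤ k → v′.links i ≡ links i
        links-old r = cong₂ line (update-other lm (suc k) _ (ℕ.<⇒≢ (ℕ.s≤s r)))
                                 (update-other lk (suc k) _ (ℕ.<⇒≢ (ℕ.s≤s r)))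

      module _ {e} (q<e : q < e)
        (valid-Y : Above y MY (start h p q y) e) (valid-X : Below y MY (start h p q (opp y)) e) where
        private
          N-valid : ∀ s {z} → start h p q s ≤ z → z ≤ e → obs s z ≤ oriented s N at z
          N-valid = by-side y _
            (λ {z} r s → subst (λ M → obs y z ≤ M at z) (sym N-oriented) (valid-Y r s))
            (λ {z} r s → oriented-≥obs y N (subst (λ M → M at z ≤ up y z) (sym N-oriented) (valid-X r s)))

        emitted-before : ∀ {i} → i ℕ.< suc k → v′.bx i ≤ q
        emitted-before r = go (ℕ.m≤n⇒m<n∨m≡n (ℕ.s≤s⁻¹ r))
          where
          go : ∀ {i} → i ℕ.< k ⊎ i ≡ k → v′.bx i ≤ q
          go (inj₁ r)    = ≤-respˡ (sym (update-other bx k _ (ℕ.<⇒≢ r)))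
            (<⇒≤ (<-trans (before r) (Window.p<q window)))
          go (inj₂ refl) = ≤-respˡ (sym (update-same bx k _)) (crossing≤hit path before window N q<e N-valid)

        emitted-path : 0# ≤ slope N → Path v′.bx v′.by v′.links (suc k) e
        emitted-path 0≤N = path-extend path before window N q<e N-valid 0≤N
          (λ r → update-other bx k _ (ℕ.<⇒≢ r)) (λ r → update-other by k _ (ℕ.<⇒≢ r)) links-old
          (update-same bx k _) (update-same by k _) links-new

      -- A link that touches the lower wall and later the upper one rises, as `a` is non-decreasing
      -- and `ε` positive. If Y is the lower side, `b` and `u` are such contacts. If Y is the upper
      -- side, `u` is on the lower wall, and the contact after it is the point `q′` where the link
      -- is blocked.
      emitted-rising : t (ℕ.pred jx) ≤ t n → (∀ {q′} → y ≡ upper → u < q′ → q′ ≤ t n → MY at q′ ≡ obs upper q′ → 0# ≤ slope N)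
        × (y ≡ lower → 0# ≤ slope N)
      emitted-rising top≤n = falling , rising-lower
        where
        u≤n : u ≤ t n
        u≤n = ≤-trans u≤top (≤-respˡ (sym topX) top≤n)
        falling : ∀ {q′} → y ≡ upper → u < q′ → q′ ≤ t n → MY at q′ ≡ obs upper q′ → 0# ≤ slope N
        falling {q′} refl u<q′ q′≤n hit = subst (λ M → 0# ≤ slope M) (sym N≡)
          (<⇒≤ (rising⇒slope-pos (mirror MY) u<q′ (subst₂ _<_
            (sym (trans (mirror-at MY u) (trans (cong -_ u-touch) (-‿involutive _))))
            (sym (trans (mirror-at MY q′) (trans (cong -_ hit) (-‿involutive _))))
            (≤-<-trans (a-mono (<⇒≤ u<q′) q′≤n) (x<x+pos 0<ε)))))
        rising-lower : y ≡ lower → 0# ≤ slope N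
        rising-lower refl = subst (λ M → 0# ≤ slope M) (sym N≡)
          (<⇒≤ (rising⇒slope-pos MY b<u (subst₂ _<_ (sym hy-yb) (sym u-touch)
            (≤-<-trans (a-mono (<⇒≤ b<u) u≤n) (x<x+pos 0<ε)))))

      module _ (jy≤n : jy ℕ.≤ n) (stuck : MY at t jy < obs y (t jy)) where
        private
          layout′ : Layout y jy jx v′
          layout′ = record { Layout layout }
          startX≤u : start h p q (opp y) ≤ u
          startX≤u = ≤-trans X.start≤ (hull-mono X.hull ℕ.≤-refl xb≤yT yT≤xt)
          startY≤top : start h p q y ≤ hx yt
          startY≤top = ≤-trans Y.start≤ (hull-mono Y.hull ℕ.≤-refl (b≤t Y.hull) ℕ.≤-refl)
          blocked : Blocked y jy jx v′
          blocked = record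
            { layout = layout′ ; jy≤n = jy≤n ; yb≤yt = b≤t Y.hull ; topY = topY
            ; valY = val Y.hull (b≤t Y.hull) ℕ.≤-refl ; hullX = X.hull ; topX = topX
            ; xb≤yT = xb≤yT ; yT≤xt = yT≤xt ; touch = u-touch
            ; below = λ r s → Y.below (≤-trans startX≤u r) s
            ; clear = Y.above startY≤top ≤-refl ; blocked = stuck }
          q′ = exitV v′
          W : Window y MY u q′ (t jy)
          W = blocked-window blocked
          module W = Window W
          top≤n : t (ℕ.pred jx) ≤ t n
          top≤n = t-mono (ℕ.≤-trans (ℕ.pred-mono-≤ (proj₂ (jx-range layout))) jy≤n) ℕ.≤-refl
          q′≤n : q′ ≤ t n
          q′≤n = ≤-trans (<⇒≤ W.q<ξ) W.ξ≤last
          q<q′ : q < q′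
          q<q′ = <-trans q<u W.p<q
          0≤N : 0# ≤ slope N
          0≤N = go y refl
            where
            go : ∀ s → s ≡ y → 0# ≤ slope N
            go lower eq = proj₂ (emitted-rising top≤n) (sym eq)
            go upper eq = proj₁ (emitted-rising top≤n) (sym eq) W.p<q q′≤n (trans W.hit (cong (λ s → obs s q′) (sym eq)))
          validY = above-exit blocked Y.above
          validX = below-exit blocked Y.below
          output′ : Output y u q′ (t jy) v′
          output′ = record
            { window = subst (λ M → Window y M u q′ (t jy))
                (sym (trans (cong (oriented y) links-new) N-oriented)) W
            ; path = emitted-path q<q′ validY validX 0≤N
            ; before = λ r → ≤-<-trans (emitted-before q<q′ validY validX r) q<u
            ; reach = reach-step reach hy-yb Y.start≤ startX≤u b<u q<u W }

        stage-finished : Checked y jy jx (startStage (emit v))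
        stage-finished = stage-started blocked output′

      stage-continues : jy ℕ.≤ n → obs y (t jy) ≤ MY at t jy → Checked y jy jx v
      stage-continues jy≤n ok = record
        { core = core ; jy≤n = jy≤n ; topY≥ = ≤-reflexive (sym topY)
        ; topY< = <-respˡ (sym topY) (t-pred< 1≤jy jy≤n)
        ; yT≤ = xb≤yT , yT≤xt ; clear = ok ; dueY = inj₁ touchY }

    -- Turning the opposite line and adding the point

    record Turned (y : Side) (jy jx : ℕ) (v : View) : Set (c ⊔ ℓ) where
      open View v
      field
        layout  : Layout y jy jx v
        h       : Side
        p q ξ   : Carrier
        output  : Output h p q ξ v
        hullY   : Hull hx hy (obs y) yb yt
        startY≤ : start h p q y ≤ hx yb
        aboveY  : Above y MY (start h p q y) (t jy)
        belowY  : Below y MY (start h p q (opp y)) (hx xt)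
        contactY : MY at hx yb ≡ hy yb
        hullX   : Hull hx hy (obs (opp y)) xb xt
        startX≤ : start h p q (opp y) ≤ hx xb
        aboveX  : Above (opp y) MX (start h p q (opp y)) (hx xt)
        belowX  : Below (opp y) MX (start h p q y) (t jy)
        contactX : MX at hx xb ≡ hy xb
        topX    : hx xt ≡ t (ℕ.pred jx)
        jy≤n    : jy ℕ.≤ n
        topY≥   : t (ℕ.pred jy) ≤ hx yt
        topY<   : hx yt < t jy
        q<next  : q < t jy
        dueY    : Touch hx y yb xb xt yT MY q ⊎ Pending hx y yb MY jx
        guard≤  : yb ℕ.≤ guard × guard ℕ.≤ yt
        guarded : guard ≡ yb ⊎ MX at hx guard ≡ up (opp y) (hx guard)

    module _ {y jy jx v} (C : Checked y jy jx v) where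
      open Checked C
      open Layout layout
      open View v
      private
        module Y = Flank flankY
        module X = Flank flankX
        x = t jy
        sY = start h p q y
        sX = start h p q (opp y)
        pred≤ : ℕ.pred jx ℕ.≤ jy
        pred≤ = ℕ.pred-mono-≤ (proj₂ (jx-range layout))
        top≤x : hx xt ≤ x
        top≤x = ≤-respˡ (sym topX) (t-mono pred≤ jy≤n)
        sY≤top : sY ≤ hx yt
        sY≤top = ≤-trans Y.start≤ (hull-mono Y.hull ℕ.≤-refl (b≤t Y.hull) ℕ.≤-refl)
        obsA : AffineBetween (hx yt) x (obs y)
        obsA = affine-⊆ topY≥ ≤-refl (obs-affine′ y 1≤jy jy≤n)
        upA : AffineBetween (hx yt) x (up (opp y))
        upA = affine-⊆ topY≥ ≤-refl (up-affine′ (opp y) 1≤jy jy≤n)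
        aboveY′ : Above y MY sY x
        aboveY′ {z} r s with ≤-<-split z (hx yt)
        ... | inj₁ z≤ = Y.above r z≤
        ... | inj₂ z> = affine-≤ MY obsA (Y.above sY≤top ≤-refl) clear (<⇒≤ z>) s
        tsx : ts yi ≡ x
        tsx = trans (cong ts yi≡) (ts≡ y jy≤n)
        osx : os yi ≡ obs y x
        osx = trans (cong os yi≡) (os≡ y jy≤n)
        forget : Touch hx y yb xb xt yT MY q ⊎ (yT ≡ xt × Pending hx y yb MY jx) →
                 Touch hx y yb xb xt yT MY q ⊎ Pending hx y yb MY jx
        forget (inj₁ r)       = inj₁ r
        forget (inj₂ (_ , r)) = inj₂ r

      ceiling≡ : 0# - os yi ≡ up (opp y) x
      ceiling≡ = trans (CR.+-identityˡ _) (trans (cong -_ osx) (sym (up-opp y x)))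

      below-next : ¬ (0# - os yi ≤ MX at ts yi) → ¬ (up (opp y) x ≤ MX at x)
      below-next r = r ∘ subst₂ _≤_ (sym ceiling≡) (cong (MX at_) (sym tsx))

      -- A pending line would reach the ceiling over the next point, so a line that stays below it
      -- has a settled contact.
      touched : ¬ (0# - os yi ≤ MX at ts yi) → Touch hx (opp y) xb yb yt xT MX q
      touched r = go dueX
        where
        go : _ ⊎ _ → _
        go (inj₁ d) = d
        go (inj₂ d) = ⊥-elim (below-next r (proj₁ d))

      kept : ¬ (0# - os yi ≤ MX at ts yi) → Turned y jy jx (record v { guard = xT })
      kept r = record
        { layout = record { Layout layout }
        ; h = h ; p = p ; q = q ; ξ = ξ
        ; output = record { Output output }
        ; hullY = Y.hull ; startY≤ = Y.start≤ ; aboveY = aboveY′ ; belowY = Y.below ; contactY = Y.contact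
        ; hullX = X.hull ; startX≤ = X.start≤ ; aboveX = X.above
        ; belowX = λ {z} r′ s → below-all r′ s (≤-<-split z (hx yt)) ; contactX = X.contact
        ; topX = topX ; jy≤n = jy≤n ; topY≥ = topY≥ ; topY< = topY< ; q<next = q<next jy≤n
        ; dueY = forget dueY
        ; guard≤ = proj₁ T , proj₁ (proj₂ T) ; guarded = inj₂ (proj₁ (proj₂ (proj₂ T))) }
        where
        open Output output
        T = touched r
        below-all : ∀ {z} → sY ≤ z → z ≤ x → z ≤ hx yt ⊎ hx yt < z → MX at z ≤ up (opp y) z
        below-all r′ s (inj₁ z≤) = X.below r′ z≤
        below-all r′ s (inj₂ z>) = affine-≥ MX upA (X.below sY≤top ≤-refl)
          (<⇒≤ (≰⇒< (below-next r))) (<⇒≤ z>) s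

      module Turning (r : 0# - os yi ≤ MX at ts yi) where
        private
          r′ : up (opp y) x ≤ MX at x
          r′ = subst₂ _≤_ ceiling≡ (cong (MX at_) tsx) r
          xb<x : hx xb < x
          xb<x = go dueX
            where
            go : _ ⊎ _ → _
            go (inj₁ d) = <-≤-trans (proj₁ (proj₂ (proj₂ (proj₂ d))))
              (≤-trans (hull-mono Y.hull (proj₁ d) (proj₁ (proj₂ d)) ℕ.≤-refl) (<⇒≤ topY<))
            go (inj₂ d) = proj₂ d
        -- `mirror MY` serves as `D`: seen from X, the other extreme line respects its ceiling up to
        -- `x` because the next point of Y is clear of `MY`.
        module Rot = Rotation {up = up (opp y)} (obs<up (opp y)) X.hull sX sY (hx yt) x X.start≤ top≤x
          MX X.above X.below X.contact r′ xb<x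
          (mirror MY) (λ r s → obs≤mirror y MY (Y.below r s)) (λ r s → mirror≤up y MY (aboveY′ r s))
          sY≤top (<⇒≤ topY<) upA

        R : ℕ → Line
        R i = through (hx i) (hy i) (ts yi) (0# - os yi)

        private
          R≡ : ∀ i → R i ≡ Rot.R i
          R≡ i = cong₂ (through (hx i) (hy i)) tsx ceiling≡

        Turn : ℕ → Set (c ⊔ ℓ)
        Turn i = Rot.Rotating i × i ℕ.≤ yT

        turn-start : Turn xb
        turn-start = Rot.rotating-start , proj₁ yT≤

        turn-step : ∀ {i} → suc i ℕ.≤ yT → ¬ (hy (suc i) ≤ R i at hx (suc i)) → Turn i → Turn (suc i)
        turn-step {i} i<yT below (ρ , _) =
          Rot.rotate ρ (ℕ.<-≤-trans i<yT (proj₂ yT≤))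
            (<-respˡ (cong (_at hx (suc i)) (R≡ i)) (≰⇒< below)) , i<yT

        turned : ∀ {i} → Turn i → ¬ (suc i ℕ.≤ yT) ⊎ hy (suc i) ≤ R i at hx (suc i) →
          Turned y jy jx (record v { xb = i ; xm = slope (R i) ; xk = intercept (R i) ; guard = yb })
          × R i at x ≡ up (opp y) x × hx i < x
        turned {i} (ρ , i≤yT) stop = record
          { layout = record { yi≡ = yi≡ ; xi≡ = xi≡ ; yb≥ = yb≥ ; yt< = yt< ; xb≥ = ℕ.≤-trans xb≥ b≤h ; xt< = xt<
              ; 1≤jy = 1≤jy ; jx≡ = jx≡ ; rem≡ = rem≡ ; sg≡ = sg≡ ; ε≡ = ε≡ ; ts≡ = ts≡ ; os≡ = os≡ }
          ; h = h ; p = p ; q = q ; ξ = ξ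
          ; output = record { Output output }
          ; hullY = Y.hull ; startY≤ = Y.start≤ ; aboveY = aboveY′ ; belowY = Y.below ; contactY = Y.contact
          ; hullX = hull-tail X.hull b≤h h≤t
          ; startX≤ = ≤-trans X.start≤ (hull-mono X.hull ℕ.≤-refl b≤h h≤t)
          ; aboveX = λ {z} r s → subst (λ M → obs (opp y) z ≤ M at z) (sym (R≡ i)) (Rot.rotated-≥ ρ (stopped dueY) r s)
          ; belowX = λ {z} r s → subst (λ M → M at z ≤ up (opp y) z) (sym (R≡ i)) (Rot.rotated-≤ ρ r s)
          ; contactX = through₁ _ _ _ _
          ; topX = topX ; jy≤n = jy≤n ; topY≥ = topY≥ ; topY< = topY< ; q<next = q<next jy≤n
          ; dueY = moved dueY
          ; guard≤ = ℕ.≤-refl , b≤t Y.hull ; guarded = inj₁ refl } ,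
          trans (cong (_at x) (R≡ i)) (through₂ _ _ h<x) , h<x
          where
          open Output output
          open Rot.Rotating ρ
          moved : Touch hx y yb xb xt yT MY q ⊎ (yT ≡ xt × Pending hx y yb MY jx) →
                  Touch hx y yb i xt yT MY q ⊎ Pending hx y yb MY jx
          moved (inj₁ (_ , d))  = inj₁ (i≤yT , d)
          moved (inj₂ (_ , d))  = inj₂ d
          stopped : Touch hx y yb xb xt yT MY q ⊎ (yT ≡ xt × Pending hx y yb MY jx) →
            (i ≡ xt ⊎ (i ℕ.< xt × hy (suc i) ≤ Rot.R i at hx (suc i))) ⊎ mirror MY at hx i ≡ obs (opp y) (hx i)
          stopped d = go (ℕ.m≤n⇒m<n∨m≡n h≤t) stop d
            where
            go : i ℕ.< xt ⊎ i ≡ xt → ¬ (suc i ℕ.≤ yT) ⊎ hy (suc i) ≤ R i at hx (suc i) →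
              Touch hx y yb xb xt yT MY q ⊎ (yT ≡ xt × Pending hx y yb MY jx) → _
            go (inj₂ i≡xt) _ _ = inj₁ (inj₁ i≡xt)
            go (inj₁ i<xt) (inj₂ s) _ = inj₁ (inj₂ (i<xt , ≤-respʳ (cong (_at hx (suc i)) (R≡ i)) s))
            go (inj₁ i<xt) (inj₁ s) (inj₂ (yT≡xt , _)) = ⊥-elim (s (subst (i ℕ.<_) (sym yT≡xt) i<xt))
            go (inj₁ i<xt) (inj₁ s) (inj₁ (_ , _ , d , _)) = inj₂ (trans (mirror-at MY (hx i))
              (trans (cong (λ w → - w) (subst (λ w → MY at hx w ≡ up y (hx w)) (sym i≡yT) d)) (sym (obs-opp y (hx i)))))
              where
              i≡yT : i ≡ yT
              i≡yT = ℕ.≤-antisym i≤yT (ℕ.≮⇒≥ s)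

    rem-positive : ∀ {y jy jx v} → Layout y jy jx v → jy ℕ.≤ n → 1 ℕ.≤ View.rem v
    rem-positive {y} {jy} {jx} {v} l jy≤n = go (View.rem v) (Layout.rem≡ l)
      where
      go : ∀ r → r ℕ.+ (jy ℕ.+ jx) ≡ suc n ℕ.+ suc n → 1 ℕ.≤ r
      go (suc r) _  = ℕ.s≤s ℕ.z≤n
      go zero    eq = ⊥-elim (ℕ.<⇒≢ (ℕ.+-mono-<-≤ (ℕ.s≤s jy≤n)
        (ℕ.≤-trans (proj₂ (jx-range l)) (ℕ.s≤s jy≤n))) eq)

    module _ {y jy jx v} (S : Turned y jy jx v) where
      open Turned S
      open Layout layout
      open View v
      open Popping hx hy (obs y) yb guard (proj₁ guard≤) (ts yi) (os yi)
      private
        x = t jy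
        tsx : ts yi ≡ x
        tsx = trans (cong ts yi≡) (ts≡ y jy≤n)
        osx : os yi ≡ obs y x
        osx = trans (cong os yi≡) (os≡ y jy≤n)
        os-ts : obs y (ts yi) ≡ os yi
        os-ts = trans (cong (obs y) tsx) (sym osx)

      popping-start : Popped yt
      popping-start = pop-start hullY (proj₂ guard≤) (<-respʳ (sym tsx) topY<)
        (subst (λ x → AffineBetween (hx yt) x (obs y)) (sym tsx) (affine-⊆ topY≥ ≤-refl (obs-affine′ y 1≤jy jy≤n))) os-ts

      -- The second contact of `MX` is on the new hull: after a turn it is the new point itself,
      -- otherwise it is the guard, which popping has spared.
      pushed : ∀ {t′ T′} → t′ ℕ.≤ yt → Popped t′ →
        ¬ (suc guard ℕ.≤ t′) ⊎ ¬ (hy t′ ≤ front (ℕ.pred t′) at hx t′) →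
        (T′ ≡ suc t′ × MX at x ≡ up (opp y) x × hx xb < x) ⊎ (T′ ≡ guard × Touch hx (opp y) xb yb yt T′ MX q) →
        Ready (opp y) jx (suc jy) (swapped t′ T′ v)
      pushed {t′} {T′} t′≤yt P stop touch = record
        { core = record
          { layout = record
            { yi≡ = xi≡
            ; xi≡ = trans (cong suc yi≡) (trans (sym (ℕ.+-suc _ jy)) (cong (λ s → offset s ℕ.+ suc jy) (sym (opp-opp y))))
            ; yb≥ = xb≥ ; yt< = xt<
            ; xb≥ = subst (λ s → offset s ℕ.≤ yb) (sym (opp-opp y)) yb≥
            ; xt< = subst (λ s → suc t′ ℕ.< offset s ℕ.+ suc jy) (sym (opp-opp y))
                (subst (suc t′ ℕ.<_) (sym (ℕ.+-suc _ jy)) (ℕ.s≤s (ℕ.≤-<-trans t′≤yt yt<)))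
            ; 1≤jy = ℕ.≤-trans 1≤jy (proj₁ (jx-range layout))
            ; jx≡ = lead-opp y jx≡
            ; rem≡ = rem′ rem (rem-positive layout jy≤n) rem≡
            ; sg≡ = trans (cong (λ s → 0# - s) sg≡) (sign-opp y) ; ε≡ = ε≡ ; ts≡ = ts≡ ; os≡ = os≡ }
          ; h = h ; p = p ; q = q ; ξ = ξ ; output = record { Output output }
          ; flankY = record
            { hull = hull-cong (λ r s → x-old r s , x-old′ r s) hullX
            ; start≤ = ≤-respʳ (sym (x-old ℕ.≤-refl (b≤t hullX))) startX≤
            ; above = λ r s → aboveX r (≤-respʳ (x-old (b≤t hullX) ℕ.≤-refl) s)
            ; below = λ r s → belowX (≤-respˡ (cong st (opp-opp y)) r) (≤-respʳ (trans new-x tsx) s)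
            ; contact = trans (cong (MX at_) (x-old ℕ.≤-refl (b≤t hullX))) (trans contactX (sym (x-old′ ℕ.≤-refl (b≤t hullX)))) }
          ; flankX = record
            { hull = subst (λ s → Hull hx′ hy′ (obs s) yb (suc t′)) (sym (opp-opp y)) hull′
            ; start≤ = subst₂ _≤_ (cong st (sym (opp-opp y))) (sym yb-old) startY≤
            ; above = λ {z} r s → subst (λ s → obs s z ≤ MY at z) (sym (opp-opp y))
                (aboveY (≤-respˡ (cong st (opp-opp y)) r) (≤-respʳ (trans new-x tsx) s))
            ; below = λ {z} r s → subst (λ s → MY at z ≤ up s z) (sym (opp-opp y))
                (belowY r (≤-respʳ (x-old (b≤t hullX) ℕ.≤-refl) s))
            ; contact = trans (cong (MY at_) yb-old) (trans contactY (sym (proj₂ (old ℕ.≤-refl (b≤t hull))))) }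
          ; topX = trans new-x tsx
          ; q<next = λ jx≤n → <-≤-trans q<next (t-mono (proj₁ (jx-range layout)) jx≤n)
          ; dueX = subst (λ s → Touch hx′ s yb xb xt yT MY q ⊎ Pending hx′ s yb MY jx) (sym (opp-opp y)) (due dueY) }
        ; topY = trans (x-old (b≤t hullX) ℕ.≤-refl) topX
        ; touchY = touch′ touch }
        where
        open Popped P
        st = start h p q
        hx′ = update hx (suc t′) (ts yi)
        hy′ = update hy (suc t′) (os yi)
        new-x : hx′ (suc t′) ≡ ts yi
        new-x = update-same hx (suc t′) _
        old : ∀ {h} → yb ℕ.≤ h → h ℕ.≤ t′ → hx′ h ≡ hx h × hy′ h ≡ hy h
        old _ r = update-other hx (suc t′) _ (ℕ.<⇒≢ (ℕ.s≤s r)) , update-other hy (suc t′) _ (ℕ.<⇒≢ (ℕ.s≤s r))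
        yb-old : hx′ yb ≡ hx yb
        yb-old = proj₁ (old ℕ.≤-refl (b≤t hull))
        far : ∀ {h} → xb ℕ.≤ h → h ℕ.≤ xt → h ≢ suc t′
        far r s = regions-disjoint y (ℕ.≤-trans yb≥ (ℕ.m≤n⇒m≤1+n (b≤t hull)))
          (ℕ.≤-<-trans (ℕ.≤-trans (ℕ.s≤s t′≤yt) yt<) (ℕ.+-monoʳ-< _ (ℕ.s≤s jy≤n)))
          (ℕ.≤-trans xb≥ r)
          (ℕ.≤-<-trans s (ℕ.<-≤-trans xt< (ℕ.+-monoʳ-≤ _ (ℕ.≤-trans (proj₂ (jx-range layout)) (ℕ.s≤s jy≤n)))))
        x-old : ∀ {h} → xb ℕ.≤ h → h ℕ.≤ xt → hx′ h ≡ hx h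
        x-old r s = update-other hx (suc t′) _ (far r s)
        x-old′ : ∀ {h} → xb ℕ.≤ h → h ℕ.≤ xt → hy′ h ≡ hy h
        x-old′ r s = update-other hy (suc t′) _ (far r s)
        -- Seen from Y, the line `MX` bounds the wall from above as far as `x`, so it also dominates
        -- the new point.
        guard-line : guard ≡ yb ⊎ MX at hx guard ≡ up (opp y) (hx guard) →
          guard ≡ yb ⊎ (∃ λ D → (∀ {z} → hx yb ≤ z → z ≤ hx guard → obs y z ≤ D at z) × D at hx guard ≡ hy guard × os yi ≤ D at ts yi)
        guard-line (inj₁ r) = inj₁ r
        guard-line (inj₂ r) = inj₂ (mirror MX , (λ p q → D≥ (≤-trans startY≤ p) (≤-trans q g≤x)) ,
          trans (mirror-at MX _) (trans (cong (λ w → - w) r) (trans (sym (obs-opp (opp y) _))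
            (trans (cong (λ s → obs s (hx guard)) (opp-opp y)) (sym (val hullY (proj₁ guard≤) (proj₂ guard≤)))))) ,
          subst₂ (λ u w → u ≤ mirror MX at w) (sym osx) (sym tsx) (D≥ (≤-trans startY≤ (≤-trans (hull-mono hullY ℕ.≤-refl (b≤t hullY) ℕ.≤-refl) (<⇒≤ topY<))) ≤-refl))
          where
          g≤x : hx guard ≤ x
          g≤x = ≤-trans (hull-mono hullY (proj₁ guard≤) (proj₂ guard≤) ℕ.≤-refl) (<⇒≤ topY<)
          D≥ : ∀ {z} → st y ≤ z → z ≤ x → obs y z ≤ mirror MX at z
          D≥ {z} p q = subst (λ s → obs s z ≤ mirror MX at z) (opp-opp y) (obs≤mirror (opp y) MX (belowX p q))
        hull′ : Hull hx′ hy′ (obs y) yb (suc t′)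
        hull′ = pop-done P stop (guard-line guarded) old new-x (update-same hy (suc t′) _) os-ts
        lead-opp : ∀ y {jx} → jx ≡ lead y jy → suc jy ≡ lead (opp y) jx
        lead-opp lower refl = refl
        lead-opp upper refl = refl
        rem′ : ∀ r → 1 ℕ.≤ r → r ℕ.+ (jy ℕ.+ jx) ≡ suc n ℕ.+ suc n → ℕ.pred r ℕ.+ (jx ℕ.+ suc jy) ≡ suc n ℕ.+ suc n
        rem′ (suc r) _ eq = trans (cong (r ℕ.+_) (trans (ℕ.+-suc jx jy) (cong suc (ℕ.+-comm jx jy)))) (trans (ℕ.+-suc r _) eq)
        due : Touch hx y yb xb xt yT MY q ⊎ Pending hx y yb MY jx → Touch hx′ y yb xb xt yT MY q ⊎ Pending hx′ y yb MY jx
        due (inj₁ (r , s , d , e , f)) = inj₁ (r , s , subst (λ w → MY at w ≡ up y w) (sym (x-old r s)) d ,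
          subst₂ _<_ (sym yb-old) (sym (x-old r s)) e , <-respʳ (sym (x-old r s)) f)
        due (inj₂ (d , e)) = inj₂ (d , <-respˡ (sym yb-old) e)
        touch′ : (T′ ≡ suc t′ × MX at x ≡ up (opp y) x × hx xb < x) ⊎ (T′ ≡ guard × Touch hx (opp y) xb yb yt T′ MX q) →
          Touch hx′ (opp y) xb yb (suc t′) T′ MX q
        touch′ (inj₁ (refl , d , e)) = ℕ.m≤n⇒m≤1+n (b≤t hull) , ℕ.≤-refl ,
          subst (λ w → MX at w ≡ up (opp y) w) (sym nx) d ,
          subst₂ _<_ (sym (x-old ℕ.≤-refl (b≤t hullX))) (sym nx) e , <-respʳ (sym nx) q<next
          where nx = trans new-x tsx
        touch′ (inj₂ (refl , r , _ , d , e , f)) = r , ℕ.m≤n⇒m≤1+n g≤t ,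
          subst (λ w → MX at w ≡ up (opp y) w) (sym go) d ,
          subst₂ _<_ (sym (x-old ℕ.≤-refl (b≤t hullX))) (sym go) e , <-respʳ (sym go) f
          where go = proj₁ (old r g≤t)

    -- The first link

    height₀ : Carrier
    height₀ = a (t 0) + ε

    flat₀ : Line
    flat₀ = line 0# height₀

    flat₀-at : ∀ z → flat₀ at z ≡ height₀
    flat₀-at z = trans (cong (_+ height₀) (CR.zeroˡ z)) (CR.+-identityˡ _)

    -- While the first link is being extended, the upper side plays the role Y and the hull of the lower
    -- side is not needed beyond its last point.
    record Scanning (j : ℕ) (v : View) : Set (c ⊔ ℓ) where
      open View v
      field
        1≤j  : 1 ℕ.≤ j
        j≤   : j ℕ.≤ suc n
        yi≡  : yi ≡ suc n ℕ.+ j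
        xi≡  : xi ≡ j
        yb≡  : yb ≡ suc n
        yt<  : yt ℕ.< suc n ℕ.+ j
        xb≡  : xb ≡ 0
        xt≡  : xt ≡ 0
        xT≡  : xT ≡ suc n
        k≡   : k ≡ 0
        rem≡ : rem ℕ.+ (j ℕ.+ j) ≡ suc n ℕ.+ suc n
        sg≡  : sg ≡ sign upper
        ε≡   : ε′ ≡ ε
        ts≡  : ∀ s {i} → i ℕ.≤ n → ts (offset s ℕ.+ i) ≡ t i
        os≡  : ∀ s {i} → i ℕ.≤ n → os (offset s ℕ.+ i) ≡ obs s (t i)
        hull : Hull hx hy (obs upper) yb yt
        left : hx yb ≡ t 0
        topY : hx yt ≡ t (ℕ.pred j)
        topX : hx 0 ≡ t (ℕ.pred j)
        valX : hy 0 ≡ a (t (ℕ.pred j))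
        MX≡  : MX ≡ flat₀
        lm≡  : links 0 ≡ flat₀
        low  : a (t (ℕ.pred j)) ≤ height₀

    module _ {j v} (S : Scanning j v) where
      open Scanning S
      open View v

      scan-rem : 1 ℕ.≤ rem → j ℕ.≤ n
      scan-rem 1≤rem with j ℕ.≤? n
      ... | yes p = p
      ... | no p  = ⊥-elim (ℕ.<⇒≢ (ℕ.+-mono-≤ 1≤rem (ℕ.+-mono-≤ (ℕ.≰⇒> p) (ℕ.≰⇒> p))) (sym rem≡))

      scan-end : ¬ (1 ℕ.≤ rem) → j ≡ suc n
      scan-end rem≰ = go (ℕ.m≤n⇒m<n∨m≡n j≤)
        where
        go : j ℕ.< suc n ⊎ j ≡ suc n → j ≡ suc n
        go (inj₂ eq) = eq
        go (inj₁ p)  = ⊥-elim (ℕ.<⇒≢ (ℕ.+-mono-< p p)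
          (trans (cong (ℕ._+ (j ℕ.+ j)) (sym (ℕ.n<1⇒n≡0 (ℕ.≰⇒> rem≰)))) rem≡))

      scan-rem-zero : j ≡ suc n → ¬ (1 ℕ.≤ rem)
      scan-rem-zero refl 1≤rem = ℕ.<-irrefl refl (scan-rem 1≤rem)

      module _ (j≤n : j ℕ.≤ n) where
        open Popping hx hy (obs upper) yb yb ℕ.≤-refl (ts yi) (os yi)
        private
          tsx : ts yi ≡ t j
          tsx = trans (cong ts yi≡) (ts≡ upper j≤n)
          osx : os yi ≡ obs upper (t j)
          osx = trans (cong os yi≡) (os≡ upper j≤n)
          os-ts : obs upper (ts yi) ≡ os yi
          os-ts = trans (cong (obs upper) tsx) (sym osx)
          tsX : ts xi ≡ t j
          tsX = trans (cong ts xi≡) (ts≡ lower j≤n)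
          osX : os xi ≡ a (t j)
          osX = trans (cong os xi≡) (os≡ lower j≤n)

        scan-compare : os xi ≤ MX at ts xi → a (t j) ≤ height₀
        scan-compare p = subst₂ _≤_ osX (trans (cong (_at ts xi) MX≡) (flat₀-at _)) p

        scan-exceeds : ¬ (os xi ≤ MX at ts xi) → height₀ < a (t j)
        scan-exceeds p = subst₂ _<_ (trans (cong (_at ts xi) MX≡) (flat₀-at _)) osX (≰⇒< p)

        scan-pop-start : Popped yt
        scan-pop-start = pop-start hull (b≤t hull) (subst₂ _<_ (sym topY) (sym tsx) (t-pred< 1≤j j≤n))
          (subst₂ (λ x y → AffineBetween x y (obs upper)) (sym topY) (sym tsx) (obs-affine′ upper 1≤j j≤n)) os-ts

        scan-step : ∀ {i} → i ℕ.≤ yt → Popped i → ¬ (suc yb ℕ.≤ i) ⊎ ¬ (hy i ≤ front (ℕ.pred i) at hx i) →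
          os xi ≤ MX at ts xi → Scanning (suc j) (scanStepV (appendV (record v { yt = i ; guard = yb })))
        scan-step {i} i≤yt P stop below = record
          { 1≤j = ℕ.s≤s ℕ.z≤n ; j≤ = ℕ.s≤s j≤n
          ; yi≡ = trans (cong suc yi≡) (sym (ℕ.+-suc (suc n) j)) ; xi≡ = cong suc xi≡ ; yb≡ = yb≡
          ; yt< = subst (suc i ℕ.<_) (sym (ℕ.+-suc (suc n) j)) (ℕ.s≤s (ℕ.≤-<-trans i≤yt yt<))
          ; xb≡ = xb≡ ; xt≡ = xt≡ ; xT≡ = xT≡ ; k≡ = k≡
          ; rem≡ = rem′ rem rem≡
          ; sg≡ = sg≡ ; ε≡ = ε≡ ; ts≡ = ts≡ ; os≡ = os≡
          ; hull = hull-cong (λ p _ → hx-far p , hy-far p)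
              (pop-done P stop (inj₁ refl) (λ _ q → update-other hx (suc i) _ (ℕ.<⇒≢ (ℕ.s≤s q)) , update-other hy (suc i) _ (ℕ.<⇒≢ (ℕ.s≤s q)))
                (update-same hx (suc i) _) (update-same hy (suc i) _) os-ts)
          ; left = trans (hx-far ℕ.≤-refl) (trans (update-other hx (suc i) _ (ℕ.<⇒≢ (ℕ.s≤s (b≤t (Popped.hull P))))) left)
          ; topY = trans (hx-far (ℕ.m≤n⇒m≤1+n (b≤t (Popped.hull P)))) (trans (update-same hx (suc i) _) tsx)
          ; topX = trans (cong (update hx₁ xt (ts xi)) (sym xt≡)) (trans (update-same hx₁ xt _) tsX)
          ; valX = trans (cong (update hy₁ xt (os xi)) (sym xt≡)) (trans (update-same hy₁ xt _) osX)
          ; MX≡ = MX≡ ; lm≡ = lm≡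
          ; low = scan-compare below }
          where
          hx₁ = update hx (suc i) (ts yi)
          hy₁ = update hy (suc i) (os yi)
          xt-far : ∀ {h} → yb ℕ.≤ h → h ≢ xt
          xt-far p refl = ℕ.n≮0 (subst₂ ℕ._≤_ yb≡ xt≡ p)
          hx-far : ∀ {h} → yb ℕ.≤ h → update hx₁ xt (ts xi) h ≡ hx₁ h
          hx-far p = update-other hx₁ xt _ (xt-far p)
          hy-far : ∀ {h} → yb ℕ.≤ h → update hy₁ xt (os xi) h ≡ hy₁ h
          hy-far p = update-other hy₁ xt _ (xt-far p)
          rem′ : ∀ r → r ℕ.+ (j ℕ.+ j) ≡ suc n ℕ.+ suc n → ℕ.pred (ℕ.pred r) ℕ.+ (suc j ℕ.+ suc j) ≡ suc n ℕ.+ suc n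
          rem′ zero eq = ⊥-elim (ℕ.<⇒≢ (ℕ.+-mono-< (ℕ.s≤s j≤n) (ℕ.s≤s j≤n)) eq)
          rem′ (suc zero) eq = ⊥-elim (ℕ.<⇒≢ (ℕ.+-mono-≤-< (ℕ.s≤s j≤n) (ℕ.s≤s j≤n)) eq)
          rem′ (suc (suc r)) eq = trans (ℕ.+-suc r (j ℕ.+ suc j))
            (trans (cong suc (trans (cong (r ℕ.+_) (ℕ.+-suc j j)) (ℕ.+-suc r (j ℕ.+ j)))) eq)

        module _ (exceeds : height₀ < a (t j)) where
          private
            v₁ = swapV v
            x = t j
            top = t (ℕ.pred j)
            top≤n : top ≤ t n
            top≤n = t-mono (ℕ.≤-trans ℕ.pred[n]≤n j≤n) ℕ.≤-refl
            flat-≡ : ∀ z → View.MY v₁ at z ≡ height₀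
            flat-≡ z = trans (cong (_at z) MX≡) (flat₀-at z)
            below₀ : ∀ {z} → t 0 ≤ z → z ≤ top → View.MY v₁ at z ≤ a z + ε
            below₀ {z} p q = ≤-respˡ (sym (flat-≡ z)) (+-monoˡ-≤ ε (a-mono p (≤-trans q top≤n)))
            above₀ : ∀ {z} → z ≤ top → a z ≤ View.MY v₁ at z
            above₀ {z} q = ≤-respʳ (sym (flat-≡ z)) (≤-trans (a-mono q top≤n) low)
            hxT : hx xT ≡ t 0
            hxT = trans (cong hx (trans xT≡ (sym yb≡))) left
            hxt : hx xt ≡ top
            hxt = trans (cong hx xt≡) topX

          -- The end of the scan has the form of any other blocked stage: Y is the lower side, and
          -- `flat₀` touches the upper wall at `t 0`. Of the lower wall only the last point enters,
          -- as starting a stage discards the hull of Y.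
          first-blocked : Blocked lower j j v₁
          first-blocked = record
            { layout = record
              { yi≡ = xi≡ ; xi≡ = yi≡ ; yb≥ = ℕ.z≤n ; yt< = subst (ℕ._< j) (sym xt≡) 1≤j
              ; xb≥ = ℕ.≤-reflexive (sym yb≡) ; xt< = yt< ; 1≤jy = 1≤j ; jx≡ = refl ; rem≡ = rem≡
              ; sg≡ = trans (cong (λ s → 0# - s) sg≡) (sign-opp upper) ; ε≡ = ε≡ ; ts≡ = ts≡ ; os≡ = os≡ }
            ; jy≤n = j≤n
            ; yb≤yt = ℕ.≤-reflexive (trans xb≡ (sym xt≡))
            ; topY = hxt
            ; valY = trans (cong hy xt≡) (trans valX (cong a (sym hxt)))
            ; hullX = hull ; topX = topY
            ; xb≤yT = ℕ.≤-reflexive (trans yb≡ (sym xT≡))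
            ; yT≤xt = ℕ.≤-trans (ℕ.≤-reflexive (trans xT≡ (sym yb≡))) (b≤t hull)
            ; touch = trans (flat-≡ _) (cong (λ z → a z + ε) (sym hxT))
            ; below = λ p q → below₀ (≤-respˡ hxT p) (≤-respʳ topY q)
            ; clear = above₀ (≤-reflexive hxt)
            ; blocked = ≤-<-trans (≤-reflexive (flat-≡ x)) exceeds }

          private
            q = exitV v₁
            W : Window lower (View.MY v₁) (hx xT) q x
            W = blocked-window first-blocked
            module W = Window W
            W₀ : Window lower flat₀ (t 0) q x
            W₀ = subst₂ (λ L p → Window lower L p q x) MX≡ hxT W
            links₀ : View.links v₁ k ≡ flat₀
            links₀ = trans (cong links k≡) lm≡

            flat-inside : ∀ {z} → z ≤ q → Inside z height₀
            flat-inside {z} z≤q = inside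
              (≤-respʳ (flat-≡ z) (above-exit first-blocked {s₀ = z} (λ _ r → above₀ (≤-respʳ hxt r)) ≤-refl z≤q))
              (≤-above (≤-<-split (t 0) z))
              where
              ≤-above : t 0 ≤ z ⊎ z < t 0 → height₀ ≤ a z + ε
              ≤-above (inj₁ p) = +-monoˡ-≤ ε (a-mono p (≤-trans z≤q (≤-trans (<⇒≤ W.q<ξ) W.ξ≤last)))
              ≤-above (inj₂ p) = ≤-reflexive (cong (_+ ε) (sym (a-const (<⇒≤ p))))

          first-output : Output lower (hx xT) q x v₁
          first-output = record
            { window = subst (λ L → Window lower L (hx xT) q x) (trans MX≡ (sym links₀)) W
            ; path = subst (λ κ → Path bx by links κ q) (sym k≡) (record
              { joined = record { sorted = λ () ; meet = λ () ; bend = λ ()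
                                ; nonneg = λ { ℕ.z≤n → ≤-reflexive (sym (cong slope lm≡)) } ; flat = cong slope lm≡ }
              ; height = λ ()
              ; valid = λ {z} p s → ≤-respʳ (cong (signed s) (sym (trans (cong (_at z) lm≡) (flat₀-at z)))) (flat-inside p s) })
            ; before = λ {i} r → ⊥-elim (ℕ.n≮0 (subst (i ℕ.<_) k≡ r))
            ; reach = subst₂ (λ κ p → Reach κ (start lower p q) q) (sym k≡) (sym hxT) (reach-start {L = flat₀} refl W₀) }

          first-stage : Checked lower j j (startStage v₁)
          first-stage = stage-started first-blocked first-output

    -- The finished path

    record Answer (v : View) : Set (c ⊔ ℓ) where
      open View v
      field
        κ       : ℕ
        ln      : ℕ → Line
        len≡    : len ≡ suc κ
        path    : Path bx by ln κ (t n)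
        last-x  : bx κ ≡ t n
        last-y  : by κ ≡ ln κ at t n
        before  : ∀ {i} → i ℕ.< κ → bx i < t n
        fewest  : ∀ (C : Competitor) → κ ℕ.≤ Competitor.n′ C
        -- The potential of the running time is nonnegative at the end.
        settled : yb ℕ.≤ yt × xb ℕ.≤ xt

    path-cong : ∀ {bx by bx′ by′ ln κ e} → (∀ {i} → i ℕ.< κ → bx′ i ≡ bx i) → (∀ {i} → i ℕ.< κ → by′ i ≡ by i) →
      Path bx by ln κ e → Path bx′ by′ ln κ e
    path-cong {bx} {by} {bx′} {by′} {ln} {κ} bx≡ by≡ P = record
      { joined = record
        { sorted = λ r → subst₂ _<_ (sym (bx≡ (ℕ.<⇒≤ r))) (sym (bx≡ r)) (sorted r)
        ; meet = λ {i} r → subst (λ x → ln i at x ≡ ln (suc i) at x) (sym (bx≡ r)) (meet r)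
        ; bend = bend ; nonneg = nonneg ; flat = flat }
      ; height = λ {i} r → trans (by≡ r) (trans (height r) (cong (ln i at_) (sym (bx≡ r))))
      ; valid = λ {z} r s → ≤-respʳ (cong (signed s) (sym (pieces-cong κ bx≡ (λ _ → refl) z))) (valid r s) }
      where
      open Path P
      open Joined joined

    -- With the lower side in the role Y, the contacts `b` and `u` alone make the last link rise; no
    -- later hit is required.
    final-answer : ∀ {v} → Ready lower (suc n) (suc n) v → Answer (finalV v)
    final-answer {v} R = record
      { κ = suc k ; ln = v₁.links ; len≡ = refl
      ; path = path-cong (λ r → update-other v₁.bx (suc k) _ (ℕ.<⇒≢ r)) (λ r → update-other v₁.by (suc k) _ (ℕ.<⇒≢ r))
          (emitted-path R q<n valid-Y valid-X (proj₂ (emitted-rising R ≤-refl) refl))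
      ; last-x = trans (update-same v₁.bx (suc k) _) tsn
      ; last-y = trans (update-same v₁.by (suc k) _) (trans (cong (MY at_) tsn) (cong (_at t n) (sym links≡)))
      ; before = λ r → ≤-<-trans (≤-reflexive (update-other v₁.bx (suc k) _ (ℕ.<⇒≢ r)))
          (≤-<-trans (emitted-before R q<n valid-Y valid-X r) q<n)
      -- `Reach` gives `k < n′`, and `suc k` is the index of the last breakpoint.
      ; fewest = λ C → proj₁ (reach C)
      ; settled = b≤t (Flank.hull flankY) , b≤t (Flank.hull flankX) }
      where
      open Ready R
      open Output output
      open Layout layout
      open View v
      module v₁ = View (emit v)
      q<n : q < t n
      q<n = <-≤-trans (Window.q<ξ window) (Window.ξ≤last window)
      valid-Y : Above lower MY (start h p q lower) (t n)
      valid-Y r s = Flank.above flankY r (≤-respʳ (sym topY) s)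
      valid-X : Below lower MY (start h p q upper) (t n)
      valid-X r s = Flank.below flankY r (≤-respʳ (sym topX) s)
      tsn : ts (ℕ.pred yi) ≡ t n
      tsn = trans (cong (λ i → ts (ℕ.pred i)) yi≡) (ts≡ lower ℕ.≤-refl)
      links≡ : v₁.links (suc k) ≡ MY
      links≡ = trans (cong₂ line (update-same lm (suc k) _) (update-same lk (suc k) _))
        (trans (cong (λ s → line (s * ym) (s * yk)) sg≡) (sign-oriented lower ym yk))

    constant-answer : ∀ {v} → Scanning (suc n) v → Answer (constantV v)
    constant-answer {v} S = record
      { κ = 0 ; ln = λ _ → flat₀ ; len≡ = refl
      ; path = record
        { joined = record { sorted = λ () ; meet = λ () ; bend = λ () ; nonneg = λ _ → ≤-refl ; flat = refl }
        ; height = λ ()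
        ; valid = λ {z} p → inside (≤-respʳ (sym (flat₀-at z)) (≤-trans (a-mono p ≤-refl) low))
            (≤-respˡ (sym (flat₀-at z)) (above-start z p (≤-<-split (t 0) z))) }
      ; last-x = tsn
      ; last-y = trans (cong₂ _at_ MX≡ tsn) refl
      ; before = λ ()
      ; fewest = λ _ → ℕ.z≤n
      ; settled = b≤t hull , ℕ.≤-reflexive (trans xb≡ (sym xt≡)) }
      where
      open Scanning S
      open View v
      tsn : ts (ℕ.pred xi) ≡ t n
      tsn = trans (cong (λ i → ts (ℕ.pred i)) xi≡) (ts≡ lower ℕ.≤-refl)
      above-start : ∀ z → z ≤ t n → t 0 ≤ z ⊎ z < t 0 → height₀ ≤ a z + ε
      above-start z p (inj₁ q) = +-monoˡ-≤ ε (a-mono q p)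
      above-start z p (inj₂ q) = ≤-reflexive (cong (_+ ε) (sym (a-const (<⇒≤ q))))

-- The program

Straight : Program → Set
Straight skip = ⊤
Straight (_ ≔ _) = ⊤
Straight (_ [ _ ]≔ _) = ⊤
Straight (p ⨾ q) = Straight p × Straight q
Straight (IF _ THEN _ ELSE _) = ⊥
Straight (WHILE _ DO _) = ⊥

-- Meant for straight-line programs. The last clause is the cost of `skip`; for branches and loops
-- it is a dummy.
cost : Program → ℕ
cost (_ ≔ e) = suc (costᴵ e)
cost (_ [ i ]≔ e) = suc (costᴵ i ℕ.+ costˢ e)
cost (p ⨾ q) = cost p ℕ.+ cost q
cost _ = 1

cell : ℕ → SExp
cell m = m [ lit 0 ]

value : (m k x : SExp) → SExp
value m k x = m ⊗ x ⊕ k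

slopeᴱ interceptᴱ : (x₁ y₁ x₂ y₂ : SExp) → SExp
slopeᴱ x₁ y₁ x₂ y₂ = (y₂ ⊖ y₁) ⊘ (x₂ ⊖ x₁)
interceptᴱ x₁ y₁ x₂ y₂ = y₁ ⊖ slopeᴱ x₁ y₁ x₂ y₂ ⊗ x₁

through-at : (x₁ y₁ x₂ y₂ x : SExp) → SExp
through-at x₁ y₁ x₂ y₂ x = value (slopeᴱ x₁ y₁ x₂ y₂) (interceptᴱ x₁ y₁ x₂ y₂) x

module MemoryMap where
  rYi rXi rYb rYt rXb rXt rYT rXT rRem rK rGuard rTmp : ℕ
  rYi = 1
  rXi = 2
  rYb = 3
  rYt = 4
  rXb = 5
  rXt = 6
  rYT = 7
  rXT = 8
  rRem = 9
  rK = 10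
  rGuard = 11
  rTmp = 12

  -- Arrays 0, 1 and 2 are prescribed by the input format.
  aBx aBy aε aTs aOs aHx aHy aLm aLk aSg aYm aYk aXm aXk aTmp aTmp′ : ℕ
  aBx = 0
  aBy = 1
  aε = 2
  aTs = 3
  aOs = 4
  aHx = 6
  aHy = 7
  aLm = 10
  aLk = 11
  aSg = 12
  aYm = 13
  aYk = 14
  aXm = 15
  aXk = 16
  aTmp = 17
  aTmp′ = 18
open MemoryMap

xᴱ yᴱ ceilingᴱ hxTop hyTop : SExp
xᴱ = aTs [ reg rYi ]
yᴱ = aOs [ reg rYi ]
ceilingᴱ = zero ⊖ yᴱ
hxTop = aHx [ reg rYt ]
hyTop = aHy [ reg rYt ]

MYᴱ MXᴱ : SExp → SExp
MYᴱ = value (cell aYm) (cell aYk)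
MXᴱ = value (cell aXm) (cell aXk)

startStageᴾ : Program
startStageᴾ =
  aTmp [ lit 0 ]≔ (hxTop ⊗ (yᴱ ⊖ MYᴱ xᴱ) ⊕ xᴱ ⊗ (MYᴱ hxTop ⊖ hyTop)) ⊘ ((MYᴱ hxTop ⊖ hyTop) ⊕ (yᴱ ⊖ MYᴱ xᴱ)) ⨾
  -- The height at the window end is taken from the old line, so it is saved before `aYm` is
  -- overwritten.
  aTmp′ [ lit 0 ]≔ MYᴱ (cell aTmp) ⨾
  aHx [ reg rYt ]≔ cell aTmp ⨾
  aHy [ reg rYt ]≔ cell aTmp′ ⨾
  aXm [ lit 0 ]≔ zero ⊖ cell aYm ⨾
  aXk [ lit 0 ]≔ zero ⊖ cell aYk ⨾
  aYm [ lit 0 ]≔ slopeᴱ (cell aTmp) (cell aTmp′) xᴱ (yᴱ ⊕ cell aε) ⨾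
  aYk [ lit 0 ]≔ cell aTmp′ ⊖ cell aYm ⊗ cell aTmp ⨾
  rXb ≔ reg rYT ⨾
  rYb ≔ reg rYt ⨾
  rYT ≔ reg rXt

emitᴾ : Program
emitᴾ =
  aTmp [ lit 0 ]≔ (cell aSg ⊗ cell aYk ⊖ aLk [ reg rK ]) ⊘ (aLm [ reg rK ] ⊖ cell aSg ⊗ cell aYm) ⨾
  aBx [ reg rK ]≔ cell aTmp ⨾
  aBy [ reg rK ]≔ value (aLm [ reg rK ]) (aLk [ reg rK ]) (cell aTmp) ⨾
  aLm [ inc (reg rK) ]≔ cell aSg ⊗ cell aYm ⨾
  aLk [ inc (reg rK) ]≔ cell aSg ⊗ cell aYk ⨾
  rK ≔ inc (reg rK)

swapRegisters : ℕ → ℕ → Program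
swapRegisters r r′ = rTmp ≔ reg r ⨾ r ≔ reg r′ ⨾ r′ ≔ reg rTmp

swapCells : ℕ → ℕ → Program
swapCells m m′ = aTmp [ lit 0 ]≔ cell m ⨾ m [ lit 0 ]≔ cell m′ ⨾ m′ [ lit 0 ]≔ cell aTmp

swapᴾ : Program
swapᴾ =
  swapRegisters rYi rXi ⨾ swapRegisters rYb rXb ⨾ swapRegisters rYt rXt ⨾ swapRegisters rYT rXT ⨾
  swapCells aYm aXm ⨾ swapCells aYk aXk ⨾ aSg [ lit 0 ]≔ zero ⊖ cell aSg

-- The comparison is not strict, so vertices on the line are popped as well; the guard keeps a
-- contact from being lost in such a tie.
popTest : BExp
popTest = inc (reg rGuard) ≤ᴵ reg rYt and
  hyTop ≤ˢ through-at (aHx [ dec (reg rYt) ]) (aHy [ dec (reg rYt) ]) xᴱ yᴱ hxTop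

popᴾ appendᴾ : Program
popᴾ = WHILE popTest DO rYt ≔ dec (reg rYt)
appendᴾ = rYt ≔ inc (reg rYt) ⨾ aHx [ reg rYt ]≔ xᴱ ⨾ aHy [ reg rYt ]≔ yᴱ

turnTest : BExp
turnTest = inc (reg rXb) ≤ᴵ reg rYT and
  neg (aHy [ inc (reg rXb) ] ≤ˢ
       through-at (aHx [ reg rXb ]) (aHy [ reg rXb ]) xᴱ ceilingᴱ (aHx [ inc (reg rXb) ]))

turnᴾ lineᴾ : Program
turnᴾ = WHILE turnTest DO rXb ≔ inc (reg rXb)
lineᴾ =
  aXm [ lit 0 ]≔ slopeᴱ (aHx [ reg rXb ]) (aHy [ reg rXb ]) xᴱ ceilingᴱ ⨾
  aXk [ lit 0 ]≔ aHy [ reg rXb ] ⊖ cell aXm ⊗ aHx [ reg rXb ] ⨾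
  rGuard ≔ reg rYb

nextᴾ : Program
nextᴾ = rYi ≔ inc (reg rYi) ⨾ rRem ≔ dec (reg rRem) ⨾ swapᴾ

touchTest : BExp
touchTest = ceilingᴱ ≤ˢ MXᴱ xᴱ

finishᴾ : Program
finishᴾ =
  (IF touchTest
   THEN turnᴾ ⨾ lineᴾ ⨾ popᴾ ⨾ appendᴾ ⨾ rXT ≔ reg rYt
   ELSE (rGuard ≔ reg rXT ⨾ popᴾ ⨾ appendᴾ)) ⨾
  nextᴾ

clearTest : BExp
clearTest = yᴱ ≤ˢ MYᴱ xᴱ

mainTest : BExp
mainTest = lit 1 ≤ᴵ reg rRem

bodyᴾ mainᴾ : Program
bodyᴾ = (IF clearTest THEN skip ELSE (emitᴾ ⨾ startStageᴾ)) ⨾ finishᴾ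
mainᴾ = WHILE mainTest DO bodyᴾ

scanTest : BExp
scanTest = lit 1 ≤ᴵ reg rRem and aOs [ reg rXi ] ≤ˢ MXᴱ (aTs [ reg rXi ])

scanStepᴾ scanBodyᴾ scanᴾ : Program
scanStepᴾ =
  aHx [ reg rXt ]≔ aTs [ reg rXi ] ⨾ aHy [ reg rXt ]≔ aOs [ reg rXi ] ⨾
  rYi ≔ inc (reg rYi) ⨾ rXi ≔ inc (reg rXi) ⨾ rRem ≔ dec (dec (reg rRem))
scanBodyᴾ = rGuard ≔ reg rYb ⨾ popᴾ ⨾ appendᴾ ⨾ scanStepᴾ
scanᴾ = WHILE scanTest DO scanBodyᴾ

copyTest : BExp
copyTest = inc (reg rXi) ≤ᴵ reg 0

-- The arrays with the input also receive the output, so the points are copied beforehand, once for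
-- each side.
copyBody copyᴾ : SExp → Program
copyBody e = aTs [ reg rYi ]≔ aBx [ reg rXi ] ⨾ aOs [ reg rYi ]≔ e ⨾
  rYi ≔ inc (reg rYi) ⨾ rXi ≔ inc (reg rXi) ⨾ rRem ≔ inc (reg rRem)
copyᴾ e = WHILE copyTest DO copyBody e

initᴾ : Program
initᴾ =
  -- `reg 0` holds `n + 1`, the first position of the upper side. Point 0 of either side counts as
  -- processed, whence the two decrements of `rRem`.
  rYi ≔ inc (reg 0) ⨾ rXi ≔ lit 1 ⨾ rYb ≔ reg 0 ⨾ rYt ≔ reg 0 ⨾ rXb ≔ lit 0 ⨾ rXt ≔ lit 0 ⨾
  rXT ≔ reg 0 ⨾ rYT ≔ lit 0 ⨾ rK ≔ lit 0 ⨾ rRem ≔ dec (dec (reg rRem)) ⨾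
  aHx [ reg 0 ]≔ aTs [ reg 0 ] ⨾ aHy [ reg 0 ]≔ aOs [ reg 0 ] ⨾
  aHx [ lit 0 ]≔ cell aTs ⨾ aHy [ lit 0 ]≔ cell aOs ⨾
  aXm [ lit 0 ]≔ zero ⨾ aXk [ lit 0 ]≔ cell aOs ⊕ cell aε ⨾
  aLm [ lit 0 ]≔ zero ⨾ aLk [ lit 0 ]≔ cell aXk ⨾ aSg [ lit 0 ]≔ zero ⊖ one

finalᴾ constantᴾ : Program
finalᴾ = emitᴾ ⨾ aBx [ reg rK ]≔ aTs [ dec (reg rYi) ] ⨾ aBy [ reg rK ]≔ MYᴱ (aTs [ dec (reg rYi) ]) ⨾ 0 ≔ inc (reg rK)
constantᴾ = aBx [ lit 0 ]≔ aTs [ dec (reg rXi) ] ⨾ aBy [ lit 0 ]≔ MXᴱ (aTs [ dec (reg rXi) ]) ⨾ 0 ≔ lit 1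

clearᴾ : Program
clearᴾ = rYi ≔ lit 0 ⨾ rXi ≔ lit 0 ⨾ rRem ≔ lit 0

lowerᴱ upperᴱ : SExp
lowerᴱ = aBy [ reg rXi ]
upperᴱ = zero ⊖ (aBy [ reg rXi ] ⊕ cell aε)

-- The first stage starts without `emitᴾ`, since link 0 is stored by `initᴾ`, and without
-- `clearTest`, since a new line clears the point that blocked the old one.
stagesᴾ simplifyᴾ : Program
stagesᴾ = IF mainTest THEN swapᴾ ⨾ startStageᴾ ⨾ finishᴾ ⨾ mainᴾ ⨾ finalᴾ ELSE constantᴾ
simplifyᴾ =
  clearᴾ ⨾ copyᴾ lowerᴱ ⨾
  rXi ≔ lit 0 ⨾ copyᴾ upperᴱ ⨾
  initᴾ ⨾ scanᴾ ⨾ stagesᴾ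

-- Running programs

module Machine {c ℓ} (F : OrderedField c ℓ) where
  open OrderedField F
  open RealRAM F
  open Geometry F hiding (solve; _:+_; _:*_; _:-_; :-_; _:=_; con)
  open +-*-Solver using (solve; _:+_; _:*_; _:=_; con)

  run : Program → Store → Store
  run (r ≔ e) σ = setRegister σ r (⟦ e ⟧ᴵ σ)
  run (m [ i ]≔ e) σ = setCell σ m (⟦ i ⟧ᴵ σ) (⟦ e ⟧ˢ σ)
  run (p ⨾ q) σ = run q (run p σ)
  run _ σ = σ

  straight : ∀ p {_ : Straight p} σ → p , σ ⇓[ cost p ] run p σ
  straight skip σ = skip
  straight (_ ≔ _) σ = assign
  straight (_ [ _ ]≔ _) σ = write
  straight (p ⨾ q) {sp , sq} σ = seq (straight p {sp} σ) (straight q {sq} (run p σ))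

  -- In `Inv m s σ` the number `m` bounds the iterations left and `s` is the time spent so far, so
  -- that time bounds can be part of an invariant.
  while-loop : ∀ {a b body} (Inv : ℕ → ℕ → Store → Set a) →
    (∀ {s} σ → Inv 0 s σ → ⟦ b ⟧ᴮ σ ≡ false) →
    (∀ {m s} σ → Inv (suc m) s σ → ⟦ b ⟧ᴮ σ ≡ true →
      Σ[ k ∈ ℕ ] Σ[ σ′ ∈ Store ] (body , σ ⇓[ k ] σ′) × Inv m (s ℕ.+ suc (costᴮ b ℕ.+ k)) σ′) →
    ∀ m {s σ} → Inv m s σ →
    Σ[ k ∈ ℕ ] Σ[ σ′ ∈ Store ] Σ[ m′ ∈ ℕ ] Σ[ s′ ∈ ℕ ]
      (WHILE b DO body , σ ⇓[ k ] σ′) × Inv m′ s′ σ′ × ⟦ b ⟧ᴮ σ′ ≡ false × s ℕ.+ k ≡ s′ ℕ.+ suc (costᴮ b)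
  while-loop {b = b} Inv stop step zero {s} {σ} j =
    _ , σ , 0 , s , while-false (stop σ j) , j , stop σ j , refl
  while-loop {b = b} Inv stop step (suc m) {s} {σ} j with ⟦ b ⟧ᴮ σ in eq
  ... | false = _ , σ , suc m , s , while-false eq , j , eq , refl
  ... | true with step σ j eq
  ...   | k₁ , σ₁ , run₁ , j₁ with while-loop Inv stop step m j₁
  ...     | k , σ′ , m′ , s′ , runs , j′ , eq′ , total =
    _ , σ′ , m′ , s′ , while-true eq run₁ runs , j′ , eq′ ,
    trans (trans (cong (λ w → s ℕ.+ suc w) (sym (ℕ.+-assoc (costᴮ b) k₁ k))) (sym (ℕ.+-assoc s (suc (costᴮ b ℕ.+ k₁)) k))) total

  ∧-true : ∀ {x y} → x ∧ y ≡ true → x ≡ true × y ≡ true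
  ∧-true {true} {true} _ = refl , refl

  ∧-false : ∀ {x y} → x ∧ y ≡ false → x ≡ false ⊎ y ≡ false
  ∧-false {false} _ = inj₁ refl
  ∧-false {true}  p = inj₂ p

  does-true : ∀ {p} {P : Set p} (d : Dec P) → does d ≡ true → P
  does-true (yes p) _ = p

  does-false : ∀ {p} {P : Set p} (d : Dec P) → does d ≡ false → ¬ P
  does-false (no p) _ = p

  false-does : ∀ {p} {P : Set p} (d : Dec P) → ¬ P → does d ≡ false
  false-does (no _) _ = refl
  false-does (yes p) ¬p = ⊥-elim (¬p p)

  -- Temporary registers and cells are left out, as no value survives in them from one block to the
  -- next.
  view : Store → View
  view σ = record
    { len = register σ 0 ; yi = register σ rYi ; xi = register σ rXi ; yb = register σ rYb ; yt = register σ rYt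
    ; xb = register σ rXb ; xt = register σ rXt ; yT = register σ rYT ; xT = register σ rXT
    ; rem = register σ rRem ; k = register σ rK ; guard = register σ rGuard
    ; ts = array σ aTs ; os = array σ aOs ; hx = array σ aHx ; hy = array σ aHy
    ; lm = array σ aLm ; lk = array σ aLk ; bx = array σ aBx ; by = array σ aBy
    ; ε′ = array σ aε 0 ; sg = array σ aSg 0
    ; ym = array σ aYm 0 ; yk = array σ aYk 0 ; xm = array σ aXm 0 ; xk = array σ aXk 0 }

  scanTestV : View → Bool
  scanTestV v = does (1 ℕ.≤? rem) ∧ does (os xi ≤? MX at ts xi)
    where open View v

  turnLine : View → ℕ → Line
  turnLine v i = through (hx i) (hy i) (ts yi) (0# - os yi)
    where open View v

  popLine : View → ℕ → Line
  popLine v i = through (hx i) (hy i) (ts yi) (os yi)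
    where open View v

  turnTestV popTestV clearTestV touchTestV : View → Bool
  turnTestV v = does (suc xb ℕ.≤? yT) ∧ not (does (hy (suc xb) ≤? turnLine v xb at hx (suc xb)))
    where open View v
  popTestV v = does (suc guard ℕ.≤? yt) ∧ does (hy yt ≤? popLine v (ℕ.pred yt) at hx yt)
    where open View v
  clearTestV v = does (os yi ≤? MY at ts yi)
    where open View v
  touchTestV v = does (0# - os yi ≤? MX at ts yi)
    where open View v

  ∧-falseˡ : ∀ {x y} → x ≡ false → x ∧ y ≡ false
  ∧-falseˡ refl = refl

  not-true : ∀ {x} → not x ≡ true → x ≡ false
  not-true {false} _ = refl

  not-false : ∀ {x} → not x ≡ false → x ≡ true
  not-false {true} _ = refl

  -- Every hull vertex is removed at most once, so the work of the two inner loops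
  -- is paid from the sizes of the hulls.
  module Amortised (w : ℕ)
    (turn≤w : suc (costᴮ turnTest ℕ.+ cost (rXb ≔ inc (reg rXb))) ℕ.≤ w)
    (pop≤w  : suc (costᴮ popTest ℕ.+ cost (rYt ≔ dec (reg rYt))) ℕ.≤ w)
    where

    tops bottoms : View → ℕ
    tops v = (View.yt v ℕ.+ View.xt v) ℕ.* w
    bottoms v = (View.yb v ℕ.+ View.xb v) ℕ.* w

    -- The amortised inequality `s + Φ v′ ≤ Φ v + d` for the potential `Φ = tops - bottoms`,
    -- rearranged to avoid subtraction.
    record Paid (s : ℕ) (v v′ : View) (d : ℕ) : Set where
      constructor paid
      field
        balance : s ℕ.+ (tops v′ ℕ.+ bottoms v) ℕ.≤ (bottoms v′ ℕ.+ tops v) ℕ.+ d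
    open Paid public

    paid-trans : ∀ {s₁ s₂ v v₁ v₂ d₁ d₂} → Paid s₁ v v₁ d₁ → Paid s₂ v₁ v₂ d₂ → Paid (s₁ ℕ.+ s₂) v v₂ (d₁ ℕ.+ d₂)
    paid-trans {s₁} {s₂} {v} {v₁} {v₂} {d₁} {d₂} p q = paid (ℕ.+-cancelʳ-≤ (tops v₁ ℕ.+ bottoms v₁) _ _ (subst₂ ℕ._≤_
      (solve 6 (λ s₁ s₂ t₁ b t₂ b₁ → (s₁ :+ (t₁ :+ b)) :+ (s₂ :+ (t₂ :+ b₁)) := ((s₁ :+ s₂) :+ (t₂ :+ b)) :+ (t₁ :+ b₁))
        refl s₁ s₂ (tops v₁) (bottoms v) (tops v₂) (bottoms v₁))
      (solve 6 (λ d₁ d₂ t₁ b₁ t b₂ → ((b₁ :+ t) :+ d₁) :+ ((b₂ :+ t₁) :+ d₂) := ((b₂ :+ t) :+ (d₁ :+ d₂)) :+ (t₁ :+ b₁))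
        refl d₁ d₂ (tops v₁) (bottoms v₁) (tops v) (bottoms v₂))
      (ℕ.+-mono-≤ (balance p) (balance q))))

    paid-weaken : ∀ {s v v′ d d′} → d ℕ.≤ d′ → Paid s v v′ d → Paid s v v′ d′
    paid-weaken q p = paid (ℕ.≤-trans (balance p) (ℕ.+-monoʳ-≤ _ q))

    paid-const : ∀ {v v′} s → tops v′ ≡ tops v → bottoms v ℕ.≤ bottoms v′ → Paid s v v′ s
    paid-const {v} {v′} s t b = paid (subst (ℕ._≤ (bottoms v′ ℕ.+ tops v) ℕ.+ s)
      (trans (solve 3 (λ s t b → (b :+ t) :+ s := s :+ (t :+ b)) refl s (tops v) (bottoms v))
             (cong (λ t → s ℕ.+ (t ℕ.+ bottoms v)) (sym t)))
      (ℕ.+-monoˡ-≤ s (ℕ.+-monoˡ-≤ (tops v) b)))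

    paid-resp : ∀ {s v v₁ v₂ d} → v₁ ≡ v₂ → Paid s v v₁ d → Paid s v v₂ d
    paid-resp refl p = p

    paid-extra : ∀ {s v v′ d} e → Paid s v v′ d → Paid (e ℕ.+ s) v v′ (e ℕ.+ d)
    paid-extra e p = paid-trans (paid-const e refl ℕ.≤-refl) p

    paid-turn : ∀ v i {s e} → s ℕ.+ View.xb v ℕ.* w ℕ.≤ i ℕ.* w ℕ.+ e → Paid s v (record v { xb = i }) e
    paid-turn v i {s} {e} p = paid (subst₂ ℕ._≤_
      (solve 5 (λ s xb w yb t → (s :+ xb :* w) :+ (yb :* w :+ t) := s :+ (t :+ (yb :+ xb) :* w)) refl s xb w yb (tops v))
      (solve 5 (λ i e w yb t → (i :* w :+ e) :+ (yb :* w :+ t) := ((yb :+ i) :* w :+ t) :+ e) refl i e w yb (tops v))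
      (ℕ.+-monoˡ-≤ (yb ℕ.* w ℕ.+ tops v) p))
      where open View v

    paid-pop : ∀ v i {s e} → s ℕ.+ i ℕ.* w ℕ.≤ View.yt v ℕ.* w ℕ.+ e → Paid s v (record v { yt = i }) e
    paid-pop v i {s} {e} p = paid (subst₂ ℕ._≤_
      (solve 5 (λ s i w xt b → (s :+ i :* w) :+ (xt :* w :+ b) := s :+ ((i :+ xt) :* w :+ b)) refl s i w xt (bottoms v))
      (solve 5 (λ yt e w xt b → (yt :* w :+ e) :+ (xt :* w :+ b) := (b :+ (yt :+ xt) :* w) :+ e) refl yt e w xt (bottoms v))
      (ℕ.+-monoˡ-≤ (xt ℕ.* w ℕ.+ bottoms v) p))
      where open View v

    -- A new vertex deposits the amount `w` for its later removal.
    paid-append : ∀ v s → Paid s v (appendV v) (s ℕ.+ w)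
    paid-append v s = paid (ℕ.≤-reflexive
      (solve 5 (λ s yt xt w b → s :+ ((con 1 :+ yt :+ xt) :* w :+ b) := (b :+ (yt :+ xt) :* w) :+ (s :+ w))
        refl s yt xt w (bottoms v)))
      where open View v

    paid-swap : ∀ v s → Paid s v (swapV v) s
    paid-swap v s = paid-const s (cong (ℕ._* w) (ℕ.+-comm (View.xt v) (View.yt v)))
      (ℕ.≤-reflexive (cong (ℕ._* w) (ℕ.+-comm (View.yb v) (View.xb v))))

    -- Total correctness: started in σ, which has view v, program p halts in a store
    -- whose view satisfies Q, and its running time is d up to the change of potential.
    record Exec {q} (v : View) (σ : Store) (p : Program) (Q : View → Set q) (d : ℕ) : Set (c ⊔ ℓ ⊔ q) where
      constructor exec
      field
        {steps} : ℕ
        {after} : Store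
        runs    : p , σ ⇓[ steps ] after
        holds   : Q (view after)
        cheap   : Paid steps v (view after) d

    exec-seq : ∀ {q q′ v σ p p′ d d′} {Q : View → Set q} {Q′ : View → Set q′} → Exec v σ p Q d →
      (∀ σ₁ v₁ → view σ₁ ≡ v₁ → Q v₁ → Exec v₁ σ₁ p′ Q′ d′) → Exec v σ (p ⨾ p′) Q′ (d ℕ.+ d′)
    exec-seq (exec {after = σ₁} r h p) f with f σ₁ (view σ₁) refl h
    ... | exec r′ h′ p′ = exec (seq r r′) h′ (paid-trans p p′)

    exec-true : ∀ {q v σ b p p′ d} {Q : View → Set q} → ⟦ b ⟧ᴮ σ ≡ true → Exec v σ p Q d →
      Exec v σ (IF b THEN p ELSE p′) Q (suc (costᴮ b) ℕ.+ d)
    exec-true eq (exec r h p) = exec (if-true eq r) h (paid-extra _ p)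

    exec-false : ∀ {q v σ b p p′ d} {Q : View → Set q} → ⟦ b ⟧ᴮ σ ≡ false → Exec v σ p′ Q d →
      Exec v σ (IF b THEN p ELSE p′) Q (suc (costᴮ b) ℕ.+ d)
    exec-false eq (exec r h p) = exec (if-false eq r) h (paid-extra _ p)

    exec-map : ∀ {q q′ v σ p d d′} {Q : View → Set q} {Q′ : View → Set q′} →
      (∀ {v′} → Q v′ → Q′ v′) → d ℕ.≤ d′ → Exec v σ p Q d → Exec v σ p Q′ d′
    exec-map f le (exec r h p) = exec r (f h) (paid-weaken le p)

    -- The addresses of registers and arrays are literals, so the effect of a block on the view
    -- computes, and the equation for `G` is met by `refl` wherever this is applied.
    exec-straight : ∀ p {sp : Straight p} {G : View → View} {d v} σ → view σ ≡ v →
      (∀ σ → view (run p σ) ≡ G (view σ)) → Paid (cost p) v (G v) d → Exec v σ p (_≡ G v) d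
    exec-straight p {sp} σ refl eq pd = exec (straight p {sp} σ) (eq σ) (paid-resp (sym (eq σ)) pd)

    WhileResult : ∀ {q} → (ℕ → View → Set q) → (View → Bool) → View → Set q
    WhileResult Inv test v = ∃ λ m → Inv m v × test v ≡ false

    -- The account of an iteration includes its test, unlike in `exec-while`. This admits `D = 0`,
    -- which is the case of the two inner loops.
    exec-loop : ∀ {q b body D} (Inv : ℕ → View → Set q) (test : View → Bool) →
      (∀ σ → ⟦ b ⟧ᴮ σ ≡ test (view σ)) →
      (∀ {v} → Inv 0 v → test v ≡ false) →
      (∀ {m v} σ → view σ ≡ v → Inv (suc m) v → test v ≡ true →
        Σ[ k ∈ ℕ ] Σ[ σ′ ∈ Store ] (body , σ ⇓[ k ] σ′) × Inv m (view σ′) × Paid (suc (costᴮ b ℕ.+ k)) v (view σ′) D) →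
      ∀ {m v} σ → view σ ≡ v → Inv m v →
      Exec v σ (WHILE b DO body) (WhileResult Inv test) (m ℕ.* D ℕ.+ suc (costᴮ b))
    exec-loop {b = b} {body} {D} Inv test test≡ stop step {m} σ refl inv =
      wrap (while-loop Inv′ (λ τ i → trans (test≡ τ) (stop (proj₁ (proj₂ i)))) step′ m {0} {σ}
        (0 , inv , paid-const 0 refl ℕ.≤-refl , ℕ.≤-refl))
      where
      v = view σ
      Inv′ : ℕ → ℕ → Store → Set _
      Inv′ m′ s τ = Σ[ d ∈ ℕ ] Inv m′ (view τ) × Paid s v (view τ) d × d ℕ.+ m′ ℕ.* D ℕ.≤ m ℕ.* D
      step′ : ∀ {m′ s} τ → Inv′ (suc m′) s τ → ⟦ b ⟧ᴮ τ ≡ true →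
        Σ[ k ∈ ℕ ] Σ[ τ′ ∈ Store ] (body , τ ⇓[ k ] τ′) × Inv′ m′ (s ℕ.+ suc (costᴮ b ℕ.+ k)) τ′
      step′ {m′} τ (d , i , pd , le) t = advance (step τ refl i (trans (sym (test≡ τ)) t))
        where
        advance : _ → _
        advance (k , τ′ , r , i′ , pd′) = k , τ′ , r , d ℕ.+ D , i′ , paid-trans pd pd′ ,
          ℕ.≤-trans (ℕ.≤-reflexive (ℕ.+-assoc d D (m′ ℕ.* D))) le
      wrap : _ → _
      wrap (k , τ , m′ , s , r , (d , i , pd , le) , t , total) =
        exec r (m′ , i , trans (sym (test≡ τ)) t)
          (paid-weaken (ℕ.+-monoˡ-≤ (suc (costᴮ b)) (ℕ.≤-trans (ℕ.m≤m+n d _) le))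
            (subst (λ k → Paid k v (view τ) (d ℕ.+ suc (costᴮ b))) (sym total)
              (paid-trans pd (paid-const (suc (costᴮ b)) refl ℕ.≤-refl))))

    exec-while : ∀ {q b body D} (Inv : ℕ → View → Set q) (test : View → Bool) →
      (∀ σ → ⟦ b ⟧ᴮ σ ≡ test (view σ)) →
      (∀ {v} → Inv 0 v → test v ≡ false) →
      (∀ {m v} σ → view σ ≡ v → Inv (suc m) v → test v ≡ true → Exec v σ body (Inv m) D) →
      ∀ {m v} σ → view σ ≡ v → Inv m v →
      Exec v σ (WHILE b DO body) (WhileResult Inv test) (m ℕ.* suc (costᴮ b ℕ.+ D) ℕ.+ suc (costᴮ b))
    exec-while {b = b} {D = D} Inv test test≡ stop step = exec-loop Inv test test≡ stop
      λ σ e i t → unwrap (step σ e i t)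
      where
      unwrap : ∀ {m v σ} → Exec v σ _ (Inv m) D → _
      unwrap (exec {k} {σ′} r h p) = k , σ′ , r , h , paid-extra (suc (costᴮ b)) p

    PopResult : ∀ {p} (v : View) → (ℕ → Set p) → View → Set (c ⊔ ℓ ⊔ p)
    PopResult v Q v′ = Σ[ i ∈ ℕ ] v′ ≡ record v { yt = i } × i ℕ.≤ yt × Q i ×
      (¬ (suc guard ℕ.≤ i) ⊎ ¬ (hy i ≤ popLine v (ℕ.pred i) at hx i))
      where open View v

    exec-pop : ∀ {p v} σ → view σ ≡ v → (Q : ℕ → Set p) → let open View v in
      (∀ {i} → suc guard ℕ.≤ i → hy i ≤ popLine v (ℕ.pred i) at hx i → Q i → Q (ℕ.pred i)) → Q yt →
      Exec v σ popᴾ (PopResult v Q) (suc (costᴮ popTest))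
    -- Each iteration is paid for by the vertex it removes, so the bound `yt` on the number of
    -- iterations is multiplied by 0.
    exec-pop {v = v} σ e Q next start = exec-map done (ℕ.+-monoˡ-≤ (suc (costᴮ popTest)) (ℕ.≤-reflexive (ℕ.*-zeroʳ yt)))
      (exec-loop {D = 0} Inv popTestV (λ _ → refl) (λ { (refl , _) → refl }) step σ e (refl , start , ℕ.≤-refl))
      where
      open View v
      Inv : ℕ → View → Set _
      Inv i v′ = v′ ≡ record v { yt = i } × Q i × i ℕ.≤ yt
      step : ∀ {i v′} τ → view τ ≡ v′ → Inv (suc i) v′ → popTestV v′ ≡ true →
        Σ[ k ∈ ℕ ] Σ[ τ′ ∈ Store ] (rYt ≔ dec (reg rYt) , τ ⇓[ k ] τ′) × Inv i (view τ′) × Paid (suc (costᴮ popTest ℕ.+ k)) v′ (view τ′) 0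
      step {i} τ refl (e , q , le) test = _ , _ , assign ,
        (cong (λ v → record v { yt = ℕ.pred (View.yt v) }) e ,
         next (does-true (suc guard ℕ.≤? suc i) (proj₁ tests)) (does-true (hy (suc i) ≤? popLine v i at hx (suc i)) (proj₂ tests)) q ,
         ℕ.<⇒≤ le) ,
        paid-pop (view τ) (ℕ.pred (View.yt (view τ))) (ℕ.≤-trans
          (subst (λ y → suc (costᴮ popTest ℕ.+ cost (rYt ≔ dec (reg rYt))) ℕ.+ ℕ.pred y ℕ.* w ℕ.≤ y ℕ.* w)
            (sym (cong View.yt e)) (ℕ.+-monoˡ-≤ (i ℕ.* w) pop≤w)) (ℕ.m≤m+n _ 0))
        where tests = ∧-true (trans (sym (cong popTestV e)) test)
      done : ∀ {v′} → WhileResult Inv popTestV v′ → PopResult v Q v′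
      done (i , (refl , q , le) , test) = i , refl , le , q , stopped (∧-false test)
        where
        stopped : does (suc guard ℕ.≤? i) ≡ false ⊎ does (hy i ≤? popLine v (ℕ.pred i) at hx i) ≡ false → _
        stopped (inj₁ r) = inj₁ (does-false (suc guard ℕ.≤? i) r)
        stopped (inj₂ r) = inj₂ (does-false (hy i ≤? popLine v (ℕ.pred i) at hx i) r)

    TurnResult : ∀ {p} (v : View) → (ℕ → Set p) → View → Set (c ⊔ ℓ ⊔ p)
    TurnResult v Q v′ = Σ[ i ∈ ℕ ] v′ ≡ record v { xb = i } × Q i ×
      (¬ (suc i ℕ.≤ yT) ⊎ hy (suc i) ≤ turnLine v i at hx (suc i))
      where open View v

    exec-turn : ∀ {p v} σ → view σ ≡ v → (Q : ℕ → Set p) → let open View v in xb ℕ.≤ yT →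
      (∀ {i} → suc i ℕ.≤ yT → ¬ (hy (suc i) ≤ turnLine v i at hx (suc i)) → Q i → Q (suc i)) → Q xb →
      Exec v σ turnᴾ (TurnResult v Q) (suc (costᴮ turnTest))
    exec-turn {v = v} σ e Q xb≤yT next start =
      exec-map done (ℕ.+-monoˡ-≤ (suc (costᴮ turnTest)) (ℕ.≤-reflexive (ℕ.*-zeroʳ (yT ℕ.∸ xb))))
        (exec-loop {D = 0} Inv turnTestV (λ _ → refl) stop step σ e (xb , refl , start , ℕ.m+[n∸m]≡n xb≤yT))
      where
      open View v
      Inv : ℕ → View → Set _
      Inv m v′ = Σ[ i ∈ ℕ ] v′ ≡ record v { xb = i } × Q i × i ℕ.+ m ≡ yT
      stop : ∀ {v′} → Inv 0 v′ → turnTestV v′ ≡ false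
      stop (i , refl , _ , eq) = ∧-falseˡ (false-does (suc i ℕ.≤? yT)
        (ℕ.<⇒≱ (ℕ.s≤s (ℕ.≤-reflexive (trans (sym eq) (ℕ.+-identityʳ i))))))
      step : ∀ {m v′} τ → view τ ≡ v′ → Inv (suc m) v′ → turnTestV v′ ≡ true →
        Σ[ k ∈ ℕ ] Σ[ τ′ ∈ Store ] (rXb ≔ inc (reg rXb) , τ ⇓[ k ] τ′) × Inv m (view τ′) × Paid (suc (costᴮ turnTest ℕ.+ k)) v′ (view τ′) 0
      step {m} τ refl (i , e , q , eq) test = _ , _ , assign ,
        (suc i , cong (λ v → record v { xb = suc (View.xb v) }) e ,
         next (does-true (suc i ℕ.≤? yT) (proj₁ tests)) (does-false (hy (suc i) ≤? turnLine v i at hx (suc i)) (not-true (proj₂ tests))) q ,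
         trans (sym (ℕ.+-suc i m)) eq) ,
        paid-turn (view τ) (suc (View.xb (view τ))) (ℕ.≤-trans (ℕ.+-monoˡ-≤ (View.xb (view τ) ℕ.* w) turn≤w) (ℕ.m≤m+n _ 0))
        where tests = ∧-true (trans (sym (cong turnTestV e)) test)
      done : ∀ {v′} → WhileResult Inv turnTestV v′ → TurnResult v Q v′
      done (_ , (i , refl , q , _) , test) = i , refl , q , stopped (∧-false test)
        where
        stopped : does (suc i ℕ.≤? yT) ≡ false ⊎ not (does (hy (suc i) ≤? turnLine v i at hx (suc i))) ≡ false → _
        stopped (inj₁ r) = inj₁ (does-false (suc i ℕ.≤? yT) r)
        stopped (inj₂ r) = inj₂ (does-true (hy (suc i) ≤? turnLine v i at hx (suc i)) (not-false r))

  module Costs (w : ℕ) where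
    pushCost turnCost keepCost finishCost bodyCost scanCost : ℕ
    pushCost = suc (costᴮ popTest) ℕ.+ (cost appendᴾ ℕ.+ w)
    turnCost = suc (costᴮ touchTest) ℕ.+ (suc (costᴮ turnTest) ℕ.+ (cost lineᴾ ℕ.+ (suc (costᴮ popTest) ℕ.+
      ((cost appendᴾ ℕ.+ w) ℕ.+ cost (rXT ≔ reg rYt)))))
    keepCost = suc (costᴮ touchTest) ℕ.+ (cost (rGuard ≔ reg rXT) ℕ.+ pushCost)
    -- The costs of the two branches are added, which is simpler than their maximum.
    finishCost = (turnCost ℕ.+ keepCost) ℕ.+ cost nextᴾ
    bodyCost = (suc (costᴮ clearTest) ℕ.+ (1 ℕ.+ (cost emitᴾ ℕ.+ cost startStageᴾ))) ℕ.+ finishCost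
    scanCost = cost (rGuard ≔ reg rYb) ℕ.+ (suc (costᴮ popTest) ℕ.+ ((cost appendᴾ ℕ.+ w) ℕ.+ cost scanStepᴾ))

  -- Copying the input

  record Copied (σ : Store) (base : ℕ) (V : ℕ → Carrier) (i : ℕ) (τ : Store) : Set c where
    field
      len≡ : register τ 0 ≡ register σ 0
      yi≡  : register τ rYi ≡ base ℕ.+ i
      xi≡  : register τ rXi ≡ i
      rem≡ : register τ rRem ≡ base ℕ.+ i
      bx≡  : array τ aBx ≡ array σ aBx
      by≡  : array τ aBy ≡ array σ aBy
      ε≡   : array τ aε ≡ array σ aε
      ts-old : ∀ {j} → j ℕ.< base → array τ aTs j ≡ array σ aTs j
      os-old : ∀ {j} → j ℕ.< base → array τ aOs j ≡ array σ aOs j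
      ts-new : ∀ {j} → j ℕ.< i → array τ aTs (base ℕ.+ j) ≡ array σ aBx j
      os-new : ∀ {j} → j ℕ.< i → array τ aOs (base ℕ.+ j) ≡ V j

  copyCost : SExp → ℕ
  copyCost e = suc (costᴮ copyTest ℕ.+ cost (copyBody e))

  copy-step : ∀ {e σ base V i} τ →
    (∀ τ → array τ aBy ≡ array σ aBy → array τ aε ≡ array σ aε → ⟦ e ⟧ˢ τ ≡ V (register τ rXi)) →
    Copied σ base V i τ → Copied σ base V (suc i) (run (copyBody e) τ)
  copy-step {e} {σ} {base} {V} {i} τ eval C = record
    { len≡ = len≡ ; yi≡ = trans (cong suc yi≡) (sym (ℕ.+-suc base i)) ; xi≡ = cong suc xi≡
    ; rem≡ = trans (cong suc rem≡) (sym (ℕ.+-suc base i))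
    ; bx≡ = bx≡ ; by≡ = by≡ ; ε≡ = ε≡
    ; ts-old = λ r → trans (update-other (array τ aTs) y _ (old r)) (ts-old r)
    ; os-old = λ r → trans (update-other (array τ aOs) y _ (old r)) (os-old r)
    ; ts-new = λ r → new (array τ aTs) _ ts-new (trans (cong (array τ aBx) xi≡) (cong (λ f → f i) bx≡)) (ℕ.m≤n⇒m<n∨m≡n (ℕ.s≤s⁻¹ r))
    ; os-new = λ r → new (array τ aOs) _ os-new (trans (eval (setCell τ aTs y (array τ aBx (register τ rXi))) by≡ ε≡) (cong V xi≡)) (ℕ.m≤n⇒m<n∨m≡n (ℕ.s≤s⁻¹ r)) }
    where
    open Copied C
    y = register τ rYi
    old : ∀ {j} → j ℕ.< base → j ≢ y
    old r refl = ℕ.<⇒≱ r (ℕ.≤-trans (ℕ.m≤m+n base i) (ℕ.≤-reflexive (sym yi≡)))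
    new : ∀ (f : ℕ → Carrier) v {g : ℕ → Carrier} → (∀ {j} → j ℕ.< i → f (base ℕ.+ j) ≡ g j) → v ≡ g i →
      ∀ {j} → j ℕ.< i ⊎ j ≡ i → update f y v (base ℕ.+ j) ≡ g j
    new f v p q (inj₁ r) = trans (update-other f y v
      (λ eq → ℕ.<⇒≢ r (ℕ.+-cancelˡ-≡ base _ _ (trans eq yi≡)))) (p r)
    new f v p q (inj₂ refl) = trans (cong (λ k → update f k v (base ℕ.+ i)) yi≡) (trans (update-same f (base ℕ.+ i) v) q)

  copy-run : ∀ e σ base V N →
    (∀ τ → array τ aBy ≡ array σ aBy → array τ aε ≡ array σ aε → ⟦ e ⟧ˢ τ ≡ V (register τ rXi)) →
    register σ 0 ≡ N → Copied σ base V 0 σ →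
    Σ[ s ∈ ℕ ] Σ[ τ ∈ Store ] (copyᴾ e , σ ⇓[ s ] τ) × Copied σ base V N τ × s ℕ.≤ N ℕ.* copyCost e ℕ.+ suc (costᴮ copyTest)
  copy-run e σ base V N eval len C₀ = wrap (while-loop Inv stop step N {0} {σ} (0 , refl , C₀ , ℕ.z≤n))
    where
    K = copyCost e
    Inv : ℕ → ℕ → Store → Set c
    Inv m s τ = Σ[ i ∈ ℕ ] i ℕ.+ m ≡ N × Copied σ base V i τ × s ℕ.≤ i ℕ.* K
    decides : ∀ {i} τ → Copied σ base V i τ → ⟦ copyTest ⟧ᴮ τ ≡ does (suc i ℕ.≤? N)
    decides τ C = cong₂ (λ i N → does (suc i ℕ.≤? N)) (Copied.xi≡ C) (trans (Copied.len≡ C) len)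
    stop : ∀ {s} τ → Inv 0 s τ → ⟦ copyTest ⟧ᴮ τ ≡ false
    stop τ (i , i≡ , C , _) = trans (decides τ C) (false-does (suc i ℕ.≤? N)
      (ℕ.<⇒≱ (ℕ.s≤s (ℕ.≤-reflexive (trans (sym i≡) (ℕ.+-identityʳ i))))))
    step : ∀ {m s} τ → Inv (suc m) s τ → ⟦ copyTest ⟧ᴮ τ ≡ true →
      Σ[ k ∈ ℕ ] Σ[ τ′ ∈ Store ] (copyBody e , τ ⇓[ k ] τ′) × Inv m (s ℕ.+ suc (costᴮ copyTest ℕ.+ k)) τ′
    step {m} {s} τ (i , i≡ , C , le) _ = cost (copyBody e) , run (copyBody e) τ , straight (copyBody e) τ ,
      suc i , trans (sym (ℕ.+-suc i m)) i≡ , copy-step {e} τ eval C ,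
      ℕ.≤-trans (ℕ.+-monoˡ-≤ K le) (ℕ.≤-reflexive (ℕ.+-comm (i ℕ.* K) K))
    wrap : _ → _
    wrap (k , τ , m , s , r , (i , i≡ , C , le) , test , total) = k , τ , r , subst (λ i → Copied σ base V i τ) i≡N C ,
      ℕ.≤-trans (ℕ.≤-reflexive total) (ℕ.+-monoˡ-≤ (suc (costᴮ copyTest))
        (ℕ.≤-trans le (ℕ.*-monoˡ-≤ K (ℕ.≤-reflexive i≡N))))
      where
      i≡N : i ≡ N
      i≡N = ℕ.≤-antisym (ℕ.≤-trans (ℕ.m≤m+n i m) (ℕ.≤-reflexive i≡))
        (ℕ.≮⇒≥ (does-false (suc i ℕ.≤? N) (trans (sym (decides τ C)) test)))

  -- Correctness and running time of the program

  module Simplification (w : ℕ)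
    (turn≤w : suc (costᴮ turnTest ℕ.+ cost (rXb ≔ inc (reg rXb))) ℕ.≤ w)
    (pop≤w  : suc (costᴮ popTest ℕ.+ cost (rYt ≔ dec (reg rYt))) ℕ.≤ w)
    (I : Instance)
    where
    open Amortised w turn≤w pop≤w
    open Costs w
    open Instance I
    open Corridor I

    Finished : Side → ℕ → ℕ → View → View → Set (c ⊔ ℓ)
    Finished y jy jx v v′ = Ready (opp y) jx (suc jy) (nextV v′) × View.rem v′ ≡ View.rem v

    Next : Side → ℕ → ℕ → View → View → Set (c ⊔ ℓ)
    Next y jy jx v v′ = Ready (opp y) jx (suc jy) v′ × View.rem v′ ≡ ℕ.pred (View.rem v)

    turn-exec : ∀ {y jy jx v} σ → view σ ≡ v → Checked y jy jx v → ⟦ touchTest ⟧ᴮ σ ≡ true →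
      Exec v σ (turnᴾ ⨾ lineᴾ ⨾ popᴾ ⨾ appendᴾ ⨾ rXT ≔ reg rYt) (Finished y jy jx v)
        (suc (costᴮ turnTest) ℕ.+ (cost lineᴾ ℕ.+ (suc (costᴮ popTest) ℕ.+ ((cost appendᴾ ℕ.+ w) ℕ.+ cost (rXT ≔ reg rYt)))))
    turn-exec {y} {jy} {jx} {v} σ e C test =
      exec-seq (exec-turn σ e Turn (proj₁ yT≤) turn-step turn-start) λ σ₁ v₁ e₁ → λ { (i , refl , t , stop) →
      exec-seq (exec-straight lineᴾ {G = lineV} σ₁ e₁ (λ _ → refl) (paid-const _ refl ℕ.≤-refl)) λ σ₂ v₂ e₂ → λ { refl →
      rest σ₂ e₂ (turned t stop) } }
      where
      open Checked C
      open View v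
      touches : 0# - os yi ≤ MX at ts yi
      touches = does-true (_ ≤? _) (trans (sym (cong touchTestV e)) test)
      open Turning C touches
      rest : ∀ {v₂} σ₂ → view σ₂ ≡ v₂ →
        Turned y jy jx v₂ × View.MX v₂ at t jy ≡ up (opp y) (t jy) × View.hx v₂ (View.xb v₂) < t jy →
        Exec v₂ σ₂ (popᴾ ⨾ appendᴾ ⨾ rXT ≔ reg rYt)
          (λ v′ → Ready (opp y) jx (suc jy) (nextV v′) × View.rem v′ ≡ View.rem v₂)
          (suc (costᴮ popTest) ℕ.+ ((cost appendᴾ ℕ.+ w) ℕ.+ cost (rXT ≔ reg rYt)))
      rest {v₂} σ₂ e₂ (S , touch , xb<) =
        exec-seq (exec-pop σ₂ e₂ Popped pop-next (popping-start S)) λ σ₃ v₃ e₃ → λ { (i , refl , le , P , stop) →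
        exec-seq (exec-straight appendᴾ {G = appendV} σ₃ e₃ (λ _ → refl) (paid-append _ (cost appendᴾ))) λ σ₄ v₄ e₄ → λ { refl →
        exec-map (λ { refl → pushed S le P stop (inj₁ (refl , touch , xb<)) , refl }) ℕ.≤-refl
          (exec-straight (rXT ≔ reg rYt) {G = λ v → record v { xT = View.yt v }} σ₄ e₄ (λ _ → refl) (paid-const _ refl ℕ.≤-refl)) } }
        where
        module v₂ = View v₂
        open Popping v₂.hx v₂.hy (obs y) v₂.yb v₂.guard (proj₁ (Turned.guard≤ S)) (v₂.ts v₂.yi) (v₂.os v₂.yi)

    keep-exec : ∀ {y jy jx v} σ → view σ ≡ v → Checked y jy jx v → ⟦ touchTest ⟧ᴮ σ ≡ false →
      Exec v σ (rGuard ≔ reg rXT ⨾ popᴾ ⨾ appendᴾ) (Finished y jy jx v) (cost (rGuard ≔ reg rXT) ℕ.+ pushCost)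
    keep-exec {y} {jy} {jx} {v} σ e C test =
      exec-seq (exec-straight (rGuard ≔ reg rXT) {G = λ v → record v { guard = View.xT v }} σ e (λ _ → refl)
        (paid-const _ refl ℕ.≤-refl)) λ σ₁ v₁ e₁ → λ { refl →
      exec-seq (exec-pop σ₁ e₁ Popped pop-next (popping-start S)) λ σ₂ v₂ e₂ → λ { (i , refl , le , P , stop) →
      exec-map (λ { refl → pushed S le P stop (inj₂ (refl , touched C free)) , refl }) ℕ.≤-refl
        (exec-straight appendᴾ {G = appendV} σ₂ e₂ (λ _ → refl) (paid-append _ (cost appendᴾ))) } }
      where
      open Checked C
      open View v
      free : ¬ (0# - os yi ≤ MX at ts yi)
      free = does-false (_ ≤? _) (trans (sym (cong touchTestV e)) test)
      S = kept C free
      open Popping hx hy (obs y) yb xT (proj₁ (Turned.guard≤ S)) (ts yi) (os yi)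

    paid-next : ∀ v s → Paid s v (nextV v) s
    paid-next v s = paid (balance (paid-swap (record v { yi = suc (View.yi v) ; rem = ℕ.pred (View.rem v) }) s))

    finish-exec : ∀ {y jy jx v} σ → view σ ≡ v → Checked y jy jx v → Exec v σ finishᴾ (Next y jy jx v) finishCost
    finish-exec {y} {jy} {jx} {v} σ e C = exec-seq (branch (⟦ touchTest ⟧ᴮ σ) refl) λ σ₁ v₁ e₁ → λ { (R , rem≡) →
      exec-map (λ { refl → R , cong ℕ.pred rem≡ }) ℕ.≤-refl
        (exec-straight nextᴾ {G = nextV} σ₁ e₁ (λ _ → refl) (paid-next v₁ (cost nextᴾ))) }
      where
      branch : ∀ b → ⟦ touchTest ⟧ᴮ σ ≡ b → Exec v σ (IF touchTest THEN turnᴾ ⨾ lineᴾ ⨾ popᴾ ⨾ appendᴾ ⨾ rXT ≔ reg rYt ELSE (rGuard ≔ reg rXT ⨾ popᴾ ⨾ appendᴾ))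
        (Finished y jy jx v) (turnCost ℕ.+ keepCost)
      branch true  eq = exec-map (λ q → q) (ℕ.m≤m+n turnCost keepCost) (exec-true eq (turn-exec σ e C eq))
      branch false eq = exec-map (λ q → q) (ℕ.m≤n+m keepCost turnCost) (exec-false eq (keep-exec σ e C eq))

    -- Cutting the hulls at the window only raises their bottoms, which lowers the potential, so a
    -- new stage takes constant time.
    start-exec : ∀ {v} σ → view σ ≡ v → View.yb v ℕ.≤ View.yt v → View.xb v ℕ.≤ View.yT v →
      Exec v σ startStageᴾ (_≡ startStage v) (cost startStageᴾ)
    start-exec {v} σ e p q = exec-straight startStageᴾ {G = startStage} σ e (λ _ → refl)
      (paid-const (cost startStageᴾ) refl (ℕ.*-monoˡ-≤ w (ℕ.+-mono-≤ p q)))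

    emit-exec : ∀ {v} σ → view σ ≡ v → Exec v σ emitᴾ (_≡ emit v) (cost emitᴾ)
    emit-exec {v} σ e = exec-straight emitᴾ {G = emit} σ e (λ _ → refl) (paid-const (cost emitᴾ) refl ℕ.≤-refl)

    ready-jy≤n : ∀ {y jy jx v} → Layout y jy jx v → 1 ℕ.≤ View.rem v → jy ℕ.≤ n
    ready-jy≤n {y} {jy} {jx} {v} l 1≤rem with jy ℕ.≤? n
    ... | yes p = p
    ... | no p  = ⊥-elim (ℕ.<⇒≢ (ℕ.+-mono-≤ 1≤rem (ℕ.+-mono-≤ n<jy (ℕ.≤-trans n<jy (proj₁ (jx-range l))))) (sym (Layout.rem≡ l)))
      where n<jy = ℕ.≰⇒> p

    body-exec : ∀ {y jy jx v} σ → view σ ≡ v → Ready y jy jx v → 1 ℕ.≤ View.rem v →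
      Exec v σ bodyᴾ (Next y jy jx v) bodyCost
    body-exec {y} {jy} {jx} {v} σ e R 1≤rem = exec-seq (branch (⟦ clearTest ⟧ᴮ σ) refl) λ σ₁ v₁ e₁ → λ { (C , rem≡) →
      exec-map (λ { (R , r) → R , trans r (cong ℕ.pred rem≡) }) ℕ.≤-refl (finish-exec σ₁ e₁ C) }
      where
      open Ready R
      open Layout layout
      open View v
      jy≤n : jy ℕ.≤ n
      jy≤n = ready-jy≤n layout 1≤rem
      tsx : ts yi ≡ t jy
      tsx = trans (cong ts yi≡) (ts≡ y jy≤n)
      osx : os yi ≡ obs y (t jy)
      osx = trans (cong os yi≡) (os≡ y jy≤n)
      Continues : View → Set (c ⊔ ℓ)
      Continues v′ = Checked y jy jx v′ × View.rem v′ ≡ rem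
      branch : ∀ b → ⟦ clearTest ⟧ᴮ σ ≡ b →
        Exec v σ (IF clearTest THEN skip ELSE (emitᴾ ⨾ startStageᴾ)) Continues (suc (costᴮ clearTest) ℕ.+ (1 ℕ.+ (cost emitᴾ ℕ.+ cost startStageᴾ)))
      branch true eq = exec-map (λ { refl → stage-continues R jy≤n (subst₂ _≤_ osx (cong (MY at_) tsx)
          (does-true (_ ≤? _) (trans (sym (cong clearTestV e)) eq))) , refl })
        (ℕ.+-monoʳ-≤ (suc (costᴮ clearTest)) (ℕ.m≤m+n 1 (cost emitᴾ ℕ.+ cost startStageᴾ)))
        (exec-true eq (exec-straight skip {G = λ v → v} σ e (λ _ → refl) (paid-const 1 refl ℕ.≤-refl)))
      branch false eq = exec-map (λ q → q)
        (ℕ.+-monoʳ-≤ (suc (costᴮ clearTest)) (ℕ.m≤n+m (cost emitᴾ ℕ.+ cost startStageᴾ) 1))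
        (exec-false eq (exec-seq (emit-exec σ e) λ σ₁ v₁ e₁ → λ { refl →
          exec-map (λ { refl → stage-finished R jy≤n stuck , refl }) ℕ.≤-refl
            (start-exec σ₁ e₁ (b≤t (Flank.hull flankY)) (proj₁ touchY)) }))
        where
        stuck : MY at t jy < obs y (t jy)
        stuck = subst₂ _<_ (cong (MY at_) tsx) osx (≰⇒< (does-false (_ ≤? _) (trans (sym (cong clearTestV e)) eq)))

    Finishing : View → Set (c ⊔ ℓ)
    Finishing v = Ready lower (suc n) (suc n) v

    -- All `2 (n + 1)` points are processed. If the upper side were next, their number would be
    -- `jy + (jy + 1)`, which is odd.
    all-added : ∀ {y jy jx v} → Ready y jy jx v → View.rem v ≡ 0 → Finishing v
    all-added {y} {jy} {jx} {v} R rem≡0 =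
      go y jy jx R (Layout.jx≡ layout) (trans (cong (ℕ._+ (jy ℕ.+ jx)) (sym rem≡0)) (Layout.rem≡ layout)) (ℕ.<-cmp jy (suc n))
      where
      open Ready R
      go : ∀ y jy jx → Ready y jy jx v → jx ≡ lead y jy → jy ℕ.+ jx ≡ suc n ℕ.+ suc n →
        Tri (jy ℕ.< suc n) (jy ≡ suc n) (suc n ℕ.< jy) → Finishing v
      go lower _ _ R refl eq (tri< p _ _) = ⊥-elim (ℕ.<⇒≢ (ℕ.+-mono-< p p) eq)
      go lower _ _ R refl eq (tri≈ _ refl _) = R
      go lower _ _ R refl eq (tri> _ _ p) = ⊥-elim (ℕ.<⇒≢ (ℕ.+-mono-< p p) (sym eq))
      go upper _ _ R refl eq (tri< p _ _) = ⊥-elim (ℕ.<⇒≢ (ℕ.+-mono-<-≤ p p) eq)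
      go upper _ _ R refl eq (tri≈ _ refl _) = ⊥-elim (ℕ.<⇒≢ (ℕ.+-monoʳ-< (suc n) ℕ.≤-refl) (sym eq))
      go upper _ _ R refl eq (tri> _ _ p) = ⊥-elim (ℕ.<⇒≢ (ℕ.+-mono-< p (ℕ.m<n⇒m<1+n p)) (sym eq))

    mainTestV : View → Bool
    mainTestV v = does (1 ℕ.≤? View.rem v)

    main-exec : ∀ {y jy jx v} D → (∀ {y jy jx v} σ → view σ ≡ v → Ready y jy jx v → 1 ℕ.≤ View.rem v →
        Exec v σ bodyᴾ (Next y jy jx v) D) →
      ∀ σ → view σ ≡ v → Ready y jy jx v →
      Exec v σ mainᴾ Finishing (View.rem v ℕ.* suc (costᴮ mainTest ℕ.+ D) ℕ.+ suc (costᴮ mainTest))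
    main-exec {v = v} D body σ e R = exec-map done ℕ.≤-refl
      (exec-while Inv mainTestV (λ _ → refl) stop step σ e ((_ , _ , _ , R) , refl))
      where
      Inv : ℕ → View → Set (c ⊔ ℓ)
      Inv m v = (Σ[ y ∈ Side ] Σ[ jy ∈ ℕ ] Σ[ jx ∈ ℕ ] Ready y jy jx v) × View.rem v ≡ m
      stop : ∀ {v} → Inv 0 v → mainTestV v ≡ false
      stop {v} (_ , rem≡) = false-does (1 ℕ.≤? View.rem v) (λ p → ℕ.n≮0 (subst (1 ℕ.≤_) rem≡ p))
      step : ∀ {m v} σ → view σ ≡ v → Inv (suc m) v → mainTestV v ≡ true → Exec v σ bodyᴾ (Inv m) D
      step {m} {v} σ e ((y , jy , jx , R) , rem≡) t = exec-map
        (λ { (R′ , rem′) → (_ , _ , _ , R′) , trans rem′ (cong ℕ.pred rem≡) }) ℕ.≤-refl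
        (body σ e R (does-true (1 ℕ.≤? View.rem v) t))
      done : ∀ {v} → WhileResult Inv mainTestV v → Finishing v
      done {v} (_ , ((_ , _ , _ , R) , _) , t) = all-added R (ℕ.n<1⇒n≡0 (ℕ.≰⇒> (does-false (1 ℕ.≤? View.rem v) t)))

    scanBody-exec : ∀ {j v} σ → view σ ≡ v → Scanning j v → j ℕ.≤ n → View.os v (View.xi v) ≤ View.MX v at View.ts v (View.xi v) →
      Exec v σ scanBodyᴾ (Scanning (suc j)) scanCost
    scanBody-exec {j} {v} σ e S j≤n ok =
      exec-seq (exec-straight (rGuard ≔ reg rYb) {G = λ v → record v { guard = View.yb v }} σ e (λ _ → refl) (paid-const _ refl ℕ.≤-refl)) λ σ₁ v₁ e₁ → λ { refl →
      exec-seq (exec-pop σ₁ e₁ Popped pop-next (scan-pop-start S j≤n)) λ σ₂ v₂ e₂ → λ { (i , refl , le , P , stop) →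
      exec-seq (exec-straight appendᴾ {G = appendV} σ₂ e₂ (λ _ → refl) (paid-append _ (cost appendᴾ))) λ σ₃ v₃ e₃ → λ { refl →
      exec-map (λ { refl → scan-step S j≤n le P stop ok }) ℕ.≤-refl
        (exec-straight scanStepᴾ {G = scanStepV} σ₃ e₃ (λ _ → refl) (paid-const _ refl ℕ.≤-refl)) } } }
      where
      open View v
      open Popping hx hy (obs upper) yb yb ℕ.≤-refl (ts yi) (os yi)

    Scanned : View → Set (c ⊔ ℓ)
    Scanned v = Σ[ j ∈ ℕ ] Scanning j v × (¬ (1 ℕ.≤ rem) ⊎ ¬ (os xi ≤ MX at ts xi))
      where open View v

    scan-exec : ∀ {j v} D → (∀ {j v} σ → view σ ≡ v → Scanning j v → j ℕ.≤ n → View.os v (View.xi v) ≤ View.MX v at View.ts v (View.xi v) →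
        Exec v σ scanBodyᴾ (Scanning (suc j)) D) →
      ∀ σ → view σ ≡ v → Scanning j v →
      Exec v σ scanᴾ Scanned (suc n ℕ.* suc (costᴮ scanTest ℕ.+ D) ℕ.+ suc (costᴮ scanTest))
    scan-exec {j} {v} D body σ e S = exec-map done
      (ℕ.+-monoˡ-≤ (suc (costᴮ scanTest)) (ℕ.*-monoˡ-≤ (suc (costᴮ scanTest ℕ.+ D)) (ℕ.m∸n≤m (suc n) j)))
      (exec-while Inv scanTestV (λ _ → refl) stop step σ e (j , S , ℕ.m∸n+n≡m (Scanning.j≤ S)))
      where
      Inv : ℕ → View → Set (c ⊔ ℓ)
      Inv m v = Σ[ j ∈ ℕ ] Scanning j v × m ℕ.+ j ≡ suc n
      stop : ∀ {v} → Inv 0 v → scanTestV v ≡ false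
      stop {v} (j , S , j≡) = ∧-falseˡ (false-does (1 ℕ.≤? View.rem v) (scan-rem-zero S j≡))
      step : ∀ {m v} σ → view σ ≡ v → Inv (suc m) v → scanTestV v ≡ true → Exec v σ scanBodyᴾ (Inv m) D
      step {m} {v} σ e (j , S , j≡) test = exec-map (λ S′ → suc j , S′ , trans (ℕ.+-suc m j) j≡) ℕ.≤-refl
        (body σ e S (scan-rem S (does-true (1 ℕ.≤? rem) (proj₁ tests))) (does-true (os xi ≤? MX at ts xi) (proj₂ tests)))
        where
        open View v
        tests : does (1 ℕ.≤? rem) ≡ true × does (os xi ≤? MX at ts xi) ≡ true
        tests = ∧-true test
      done : ∀ {v} → WhileResult Inv scanTestV v → Scanned v
      done {v} (_ , (j , S , _) , test) = j , S , stopped (∧-false test)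
        where
        open View v
        stopped : does (1 ℕ.≤? rem) ≡ false ⊎ does (os xi ≤? MX at ts xi) ≡ false → ¬ (1 ℕ.≤ rem) ⊎ ¬ (os xi ≤ MX at ts xi)
        stopped (inj₁ r) = inj₁ (does-false (1 ℕ.≤? rem) r)
        stopped (inj₂ r) = inj₂ (does-false (os xi ≤? MX at ts xi) r)

    linkCost stagesCost : ℕ → ℕ → ℕ
    linkCost C D = cost swapᴾ ℕ.+ (cost startStageᴾ ℕ.+ (C ℕ.+
      (((suc n ℕ.+ suc n) ℕ.* suc (costᴮ mainTest ℕ.+ D) ℕ.+ suc (costᴮ mainTest)) ℕ.+ cost finalᴾ)))
    stagesCost C D = suc (costᴮ mainTest) ℕ.+ (linkCost C D ℕ.+ cost constantᴾ)

    stages-exec : ∀ {v} C D →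
      (∀ {y jy jx v} σ → view σ ≡ v → Checked y jy jx v → Exec v σ finishᴾ (Next y jy jx v) C) →
      (∀ {y jy jx v} σ → view σ ≡ v → Ready y jy jx v → 1 ℕ.≤ View.rem v → Exec v σ bodyᴾ (Next y jy jx v) D) →
      ∀ σ → view σ ≡ v → Scanned v → Exec v σ stagesᴾ Answer (stagesCost C D)
    stages-exec {v} C D finish body σ e (j , S , stop) = branch (⟦ mainTest ⟧ᴮ σ) refl
      where
      open View v
      rem≤ : ∀ {v} → Scanning j v → View.rem v ℕ.≤ suc n ℕ.+ suc n
      rem≤ S = ℕ.≤-trans (ℕ.m≤m+n _ _) (ℕ.≤-reflexive (Scanning.rem≡ S))
      links-exec : 1 ℕ.≤ rem → ¬ (os xi ≤ MX at ts xi) →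
        Exec v σ (swapᴾ ⨾ startStageᴾ ⨾ finishᴾ ⨾ mainᴾ ⨾ finalᴾ) Answer (linkCost C D)
      links-exec 1≤rem over =
        exec-seq (exec-straight swapᴾ {G = swapV} σ e (λ _ → refl) (paid-swap v (cost swapᴾ))) λ σ₁ v₁ e₁ → λ { refl →
        exec-seq (start-exec σ₁ e₁ (Blocked.yb≤yt B) (Blocked.xb≤yT B)) λ σ₂ v₂ e₂ → λ { refl →
        exec-seq (finish σ₂ e₂ (first-stage S j≤n exceeds)) λ σ₃ v₃ e₃ → λ { (R , rem≡) →
        exec-seq (exec-map (λ f → f)
          (ℕ.+-monoˡ-≤ _ (ℕ.*-monoˡ-≤ (suc (costᴮ mainTest ℕ.+ D))
            (ℕ.≤-trans (ℕ.≤-reflexive rem≡) (ℕ.≤-trans ℕ.pred[n]≤n (rem≤ S)))))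
          (main-exec D body σ₃ e₃ R)) λ σ₄ v₄ e₄ R′ →
        exec-map (λ { refl → final-answer R′ }) ℕ.≤-refl
          (exec-straight finalᴾ {G = finalV} σ₄ e₄ (λ _ → refl) (paid-const (cost finalᴾ) refl ℕ.≤-refl)) } } }
        where
        j≤n : j ℕ.≤ n
        j≤n = scan-rem S 1≤rem
        exceeds : height₀ < a (t j)
        exceeds = scan-exceeds S j≤n over
        B = first-blocked S j≤n exceeds
      branch : ∀ b → ⟦ mainTest ⟧ᴮ σ ≡ b → Exec v σ stagesᴾ Answer (stagesCost C D)
      branch true eq = exec-map (λ q → q) (ℕ.+-monoʳ-≤ (suc (costᴮ mainTest)) (ℕ.m≤m+n (linkCost C D) (cost constantᴾ)))
        (exec-true eq (links-exec 1≤rem (over stop)))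
        where
        1≤rem : 1 ℕ.≤ rem
        1≤rem = does-true (1 ℕ.≤? rem) (trans (sym (cong mainTestV e)) eq)
        over : _ ⊎ _ → _
        over (inj₁ p) = ⊥-elim (p 1≤rem)
        over (inj₂ p) = p
      branch false eq = exec-map (λ q → q) (ℕ.+-monoʳ-≤ (suc (costᴮ mainTest)) (ℕ.m≤n+m (cost constantᴾ) (linkCost C D)))
        (exec-false eq (exec-map (λ { refl → constant-answer (subst (λ j → Scanning j v) j≡ S) }) ℕ.≤-refl
          (exec-straight constantᴾ {G = constantV} σ e (λ _ → refl) (paid-const (cost constantᴾ) refl ℕ.≤-refl))))
        where
        j≡ : j ≡ suc n
        j≡ = scan-end S (does-false (1 ℕ.≤? rem) (trans (sym (cong mainTestV e)) eq))

    record Input (σ : Store) : Set c where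
      field
        len≡ : register σ 0 ≡ suc n
        bx≡  : ∀ {i} → i ℕ.≤ n → array σ aBx i ≡ t i
        by≡  : ∀ {i} → i ℕ.≤ n → array σ aBy i ≡ a (t i)
        ε≡   : array σ aε 0 ≡ ε

    record Doubled (τ : Store) : Set c where
      field
        len≡ : register τ 0 ≡ suc n
        rem≡ : register τ rRem ≡ suc n ℕ.+ suc n
        ε≡   : array τ aε 0 ≡ ε
        ts≡  : ∀ s {i} → i ℕ.≤ n → array τ aTs (offset s ℕ.+ i) ≡ t i
        os≡  : ∀ s {i} → i ℕ.≤ n → array τ aOs (offset s ℕ.+ i) ≡ obs s (t i)

    init-scanning : ∀ τ → Doubled τ → Scanning 1 (view (run initᴾ τ))
    init-scanning τ D = record
      { 1≤j = ℕ.≤-refl ; j≤ = ℕ.s≤s ℕ.z≤n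
      ; yi≡ = trans (cong suc len≡) (sym (ℕ.+-comm (suc n) 1)) ; xi≡ = refl ; yb≡ = len≡
      ; yt< = ℕ.≤-trans (ℕ.s≤s (ℕ.≤-reflexive len≡)) (ℕ.≤-reflexive (sym (ℕ.+-comm (suc n) 1)))
      ; xb≡ = refl ; xt≡ = refl ; xT≡ = len≡ ; k≡ = refl
      ; rem≡ = trans (cong (λ r → ℕ.pred (ℕ.pred r) ℕ.+ 2) rem≡) (trans (ℕ.+-comm (ℕ.pred (n ℕ.+ suc n)) 2)
          (cong (λ r → suc (suc (ℕ.pred r))) (ℕ.+-suc n n) ⟨≡⟩ cong suc (sym (ℕ.+-suc n n))))
      ; sg≡ = refl ; ε≡ = ε≡ ; ts≡ = ts≡ ; os≡ = os≡
      ; hull = hull-singleton (trans hyN (trans os-N (cong (obs upper) (sym (trans hxN ts-N)))))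
      ; left = trans hxN ts-N ; topY = trans hxN ts-N
      ; topX = ts≡ lower ℕ.z≤n
      ; valX = os≡ lower ℕ.z≤n
      ; MX≡ = cong₂ (λ x y → line 0# (x + y)) (os≡ lower ℕ.z≤n) ε≡
      ; lm≡ = cong₂ (λ x y → line 0# (x + y)) (os≡ lower ℕ.z≤n) ε≡
      ; low = <⇒≤ (x<x+pos 0<ε) }
      where
      open Doubled D
      _⟨≡⟩_ : ∀ {A : Set} {x y z : A} → x ≡ y → y ≡ z → x ≡ z
      p ⟨≡⟩ q = trans p q
      N = register τ 0
      N≢0 : N ≢ 0
      N≢0 eq = ℕ.1+n≢0 (trans (sym len≡) eq)
      hxN : View.hx (view (run initᴾ τ)) N ≡ array τ aTs N
      hxN = trans (update-other (update (array τ aHx) N (array τ aTs N)) 0 _ N≢0) (update-same (array τ aHx) N _)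
      hyN : View.hy (view (run initᴾ τ)) N ≡ array τ aOs N
      hyN = trans (update-other (update (array τ aHy) N (array τ aOs N)) 0 _ N≢0) (update-same (array τ aHy) N _)
      ts-N : array τ aTs N ≡ t 0
      ts-N = trans (cong (array τ aTs) (trans len≡ (sym (ℕ.+-identityʳ (suc n))))) (ts≡ upper ℕ.z≤n)
      os-N : array τ aOs N ≡ obs upper (t 0)
      os-N = trans (cong (array τ aOs) (trans len≡ (sym (ℕ.+-identityʳ (suc n))))) (os≡ upper ℕ.z≤n)

    Halts : ∀ {q} → Program → Store → (Store → Set q) → ℕ → Set (c ⊔ q)
    Halts p σ Q d = Σ[ s ∈ ℕ ] Σ[ σ′ ∈ Store ] (p , σ ⇓[ s ] σ′) × Q σ′ × s ℕ.≤ d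

    halts-straight : ∀ {a} p {sp : Straight p} σ {q e} {Q : Store → Set a} → Halts q (run p σ) Q e → Halts (p ⨾ q) σ Q (cost p ℕ.+ e)
    halts-straight p {sp} σ (s , τ , r , h , le) = _ , τ , seq (straight p {sp} _) r , h , ℕ.+-monoʳ-≤ (cost p) le

    halts-seq : ∀ {a b p q σ d e} {Q : Store → Set a} {Q′ : Store → Set b} → Halts p σ Q d →
      (∀ τ → Q τ → Halts q τ Q′ e) → Halts (p ⨾ q) σ Q′ (d ℕ.+ e)
    halts-seq (s , τ , r , h , le) f = wrap (f τ h)
      where
      wrap : _ → _
      wrap (s′ , τ′ , r′ , h′ , le′) = _ , τ′ , seq r r′ , h′ , ℕ.+-mono-≤ le le′

    -- The potential is 0 at the beginning and nonnegative at the end, so the amortised cost bounds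
    -- the actual one.
    settled-cheap : ∀ {s v v′ d} → Paid s v v′ d → tops v ≡ bottoms v →
      View.yb v′ ℕ.≤ View.yt v′ × View.xb v′ ℕ.≤ View.xt v′ → s ℕ.≤ d
    settled-cheap {s} {v} {v′} {d} pd eq (p , q) = ℕ.+-cancelʳ-≤ (tops v′ ℕ.+ bottoms v) s d
      (ℕ.≤-trans (balance pd) (ℕ.≤-trans (ℕ.≤-reflexive (ℕ.+-comm (bottoms v′ ℕ.+ tops v) d))
        (ℕ.+-monoʳ-≤ d (ℕ.+-mono-≤ (ℕ.*-monoˡ-≤ w (ℕ.+-mono-≤ p q)) (ℕ.≤-reflexive eq)))))

    doubled : ∀ {σ τ τ′} → Input σ → Copied (run clearᴾ σ) 0 (array σ aBy) (suc n) τ →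
      Copied (run (rXi ≔ lit 0) τ) (suc n) (λ j → 0# - (array τ aBy j + array τ aε 0)) (suc n) τ′ → Doubled τ′
    doubled {σ} {τ} {τ′} In C C′ = record
      { len≡ = trans C′.len≡ (trans C.len≡ In.len≡)
      ; rem≡ = C′.rem≡
      ; ε≡ = trans (cong (λ f → f 0) (trans C′.ε≡ C.ε≡)) In.ε≡
      ; ts≡ = λ { lower r → trans (C′.ts-old (ℕ.s≤s r)) (trans (C.ts-new (ℕ.s≤s r)) (In.bx≡ r))
                ; upper {i} r → trans (C′.ts-new (ℕ.s≤s r)) (trans (cong (λ f → f i) C.bx≡) (In.bx≡ r)) }
      ; os≡ = λ { lower r → trans (C′.os-old (ℕ.s≤s r)) (trans (C.os-new (ℕ.s≤s r)) (In.by≡ r))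
                ; upper {i} r → trans (C′.os-new (ℕ.s≤s r)) (trans (CR.+-identityˡ _)
                    (cong -_ (cong₂ _+_ (trans (cong (λ f → f i) C.by≡) (In.by≡ r)) (trans (cong (λ f → f 0) C.ε≡) In.ε≡)))) } }
      where
      module In = Input In
      module C = Copied C
      module C′ = Copied C′

    copyTotal : SExp → ℕ
    copyTotal e = suc n ℕ.* copyCost e ℕ.+ suc (costᴮ copyTest)

    scanTotal : ℕ
    scanTotal = suc n ℕ.* suc (costᴮ scanTest ℕ.+ scanCost) ℕ.+ suc (costᴮ scanTest)

    scanned-halts : ∀ τ → Doubled τ →
      Halts (scanᴾ ⨾ stagesᴾ) (run initᴾ τ) (λ σ′ → Answer (view σ′)) (scanTotal ℕ.+ stagesCost finishCost bodyCost)
    scanned-halts τ D = conclude (exec-seq (scan-exec scanCost scanBody-exec (run initᴾ τ) refl (init-scanning τ D)) λ σ₁ v₁ e₁ S →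
        stages-exec finishCost bodyCost finish-exec body-exec σ₁ e₁ S)
      where
      conclude : Exec (view (run initᴾ τ)) (run initᴾ τ) (scanᴾ ⨾ stagesᴾ) Answer (scanTotal ℕ.+ stagesCost finishCost bodyCost) → _
      -- Both hulls start as single vertices, so the initial potential vanishes by computation.
      conclude (exec {s} {σ′} r A pd) = s , σ′ , r , A , settled-cheap pd refl (Answer.settled A)

    module _ (σ : Store) (In : Input σ) where
      private
        module In = Input In
        σ₀ = run clearᴾ σ
        Done : Store → Set (c ⊔ ℓ)
        Done σ′ = Answer (view σ′)
        upperV : Store → ℕ → Carrier
        upperV τ j = 0# - (array τ aBy j + array τ aε 0)

        copied₀ : Copied σ₀ 0 (array σ aBy) 0 σ₀
        copied₀ = record { len≡ = refl ; yi≡ = refl ; xi≡ = refl ; rem≡ = refl ; bx≡ = refl ; by≡ = refl ; ε≡ = refl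
          ; ts-old = λ () ; os-old = λ () ; ts-new = λ () ; os-new = λ () }
        copied₁ : ∀ τ → Copied σ₀ 0 (array σ aBy) (suc n) τ →
          Copied (run (rXi ≔ lit 0) τ) (suc n) (upperV τ) 0 (run (rXi ≔ lit 0) τ)
        copied₁ τ C = record { len≡ = refl ; yi≡ = trans (Copied.yi≡ C) (sym (ℕ.+-identityʳ (suc n))) ; xi≡ = refl
          ; rem≡ = trans (Copied.rem≡ C) (sym (ℕ.+-identityʳ (suc n))) ; bx≡ = refl ; by≡ = refl ; ε≡ = refl
          ; ts-old = λ _ → refl ; os-old = λ _ → refl ; ts-new = λ () ; os-new = λ () }

        copy-lower : Halts (copyᴾ lowerᴱ) σ₀ (Copied σ₀ 0 (array σ aBy) (suc n)) (copyTotal lowerᴱ)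
        copy-lower = copy-run lowerᴱ σ₀ 0 (array σ aBy) (suc n) (λ τ e _ → cong (λ f → f (register τ rXi)) e) In.len≡ copied₀

        copy-upper : ∀ τ → Copied σ₀ 0 (array σ aBy) (suc n) τ →
          Halts (copyᴾ upperᴱ) (run (rXi ≔ lit 0) τ) (Copied (run (rXi ≔ lit 0) τ) (suc n) (upperV τ) (suc n)) (copyTotal upperᴱ)
        copy-upper τ C = copy-run upperᴱ (run (rXi ≔ lit 0) τ) (suc n) (upperV τ) (suc n)
          (λ τ′ e e′ → cong₂ (λ f g → 0# - (f (register τ′ rXi) + g 0)) e e′) (trans (Copied.len≡ C) In.len≡) (copied₁ τ C)

        bound₁ bound₂ bound₃ bound₄ : ℕ
        bound₁ = cost initᴾ ℕ.+ (scanTotal ℕ.+ stagesCost finishCost bodyCost)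
        bound₂ = copyTotal upperᴱ ℕ.+ bound₁
        bound₃ = cost (rXi ≔ lit 0) ℕ.+ bound₂
        bound₄ = copyTotal lowerᴱ ℕ.+ bound₃

        halts₁ : ∀ τ → Doubled τ → Halts (initᴾ ⨾ scanᴾ ⨾ stagesᴾ) τ Done bound₁
        halts₁ τ D = halts-straight initᴾ τ {e = scanTotal ℕ.+ stagesCost finishCost bodyCost} (scanned-halts τ D)

        halts₂ : ∀ τ → Copied σ₀ 0 (array σ aBy) (suc n) τ →
          Halts (copyᴾ upperᴱ ⨾ initᴾ ⨾ scanᴾ ⨾ stagesᴾ) (run (rXi ≔ lit 0) τ) Done bound₂
        halts₂ τ C = halts-seq {d = copyTotal upperᴱ} {e = bound₁} (copy-upper τ C) λ τ′ C′ → halts₁ τ′ (doubled In C C′)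

        halts₃ : ∀ τ → Copied σ₀ 0 (array σ aBy) (suc n) τ →
          Halts (rXi ≔ lit 0 ⨾ copyᴾ upperᴱ ⨾ initᴾ ⨾ scanᴾ ⨾ stagesᴾ) τ Done bound₃
        halts₃ τ C = halts-straight (rXi ≔ lit 0) τ {e = bound₂} (halts₂ τ C)

        halts₄ : Halts (copyᴾ lowerᴱ ⨾ rXi ≔ lit 0 ⨾ copyᴾ upperᴱ ⨾ initᴾ ⨾ scanᴾ ⨾ stagesᴾ) σ₀ Done bound₄
        halts₄ = halts-seq {d = copyTotal lowerᴱ} {e = bound₃} copy-lower halts₃

      simplify-halts : Halts simplifyᴾ σ Done (cost clearᴾ ℕ.+ bound₄)
      simplify-halts = halts-straight clearᴾ σ {e = bound₄} halts₄

-- From the machine to the statement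

module Conclusion {c ℓ} (F : OrderedField c ℓ) where
  open OrderedField F
  open PiecewiseLinear F
  open RealRAM F
  open Geometry F
  open Machine F

  -- Sequences indexed by numbers spare the geometry the coercions between finite types; beyond the
  -- end the last value is repeated.
  extend : ∀ {a} {A : Set a} {n} → (Fin (suc n) → A) → ℕ → A
  extend         f zero    = f fzero
  extend {n = zero}  f (suc i) = f fzero
  extend {n = suc n} f (suc i) = extend (λ j → f (fsuc j)) i

  extend-toℕ : ∀ {a} {A : Set a} {n} (f : Fin (suc n) → A) i → extend f (toℕ i) ≡ f i
  extend-toℕ f fzero = refl
  extend-toℕ {n = suc n} f (fsuc i) = extend-toℕ (λ j → f (fsuc j)) i

  extend-inject₁ : ∀ {a} {A : Set a} {n i} (f : Fin (suc n) → A) (p : i ℕ.< n) → extend f i ≡ f (inject₁ (fromℕ< p))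
  extend-inject₁ f p = trans (cong (extend f) (sym (trans (Finₚ.toℕ-inject₁ (fromℕ< p)) (Finₚ.toℕ-fromℕ< p))))
    (extend-toℕ f (inject₁ (fromℕ< p)))

  extend-suc : ∀ {a} {A : Set a} {n i} (f : Fin (suc n) → A) (p : i ℕ.< n) → extend f (suc i) ≡ f (fsuc (fromℕ< p))
  extend-suc f p = trans (cong (λ i → extend f (suc i)) (sym (Finₚ.toℕ-fromℕ< p))) (extend-toℕ f (fsuc (fromℕ< p)))

  module Sequence {f : Carrier → Carrier} {tmax : Carrier} {n} {t : Fin (suc n) → Carrier} (B : HasBreakpoints f tmax t) where
    open HasBreakpoints B renaming (slope to slopes)

    τ : ℕ → Carrier
    τ = extend t

    μ : ℕ → Line
    μ i = line (extend slopes i) (extend (λ i → proj₁ (affine i)) i)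

    τ-rising : ∀ {i} → i ℕ.< n → τ i < τ (suc i)
    τ-rising p = subst₂ _<_ (sym (extend-inject₁ t p)) (sym (extend-suc t p)) (sorted (fromℕ< p))

    τ-last : τ n ≡ tmax
    τ-last = trans (cong τ (sym (Finₚ.toℕ-fromℕ n))) (trans (extend-toℕ t (fromℕ n)) last)

    first : ∀ {z} → z ≤ τ 0 → f z ≡ μ 0 at z
    first {z} p = proj₂ (affine fzero) z p

    private
      -- At a successor `Piece` reduces only when `n` is itself a successor, so `n` has to be
      -- matched on.
      piece : ∀ {n} (t : Fin (suc n) → Carrier) (i : Fin n) {z} → t (inject₁ i) ≤ z → z ≤ t (fsuc i) → Piece t (fsuc i) z
      piece {suc n} t i p q = p , q

    next : ∀ {i} → i ℕ.< n → ∀ {z} → τ i ≤ z → z ≤ τ (suc i) → f z ≡ μ (suc i) at z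
    next p {z} q r = trans
      (proj₂ (affine (fsuc (fromℕ< p))) z (piece t (fromℕ< p) (≤-respˡ (extend-inject₁ t p) q) (≤-respʳ (extend-suc t p) r)))
      (cong (_at z) (cong₂ line (sym (extend-suc slopes p)) (sym (extend-suc (λ i → proj₁ (affine i)) p))))

  module _ {tmax ε : Carrier} {a : Carrier → Carrier} {n} {t : Fin (suc n) → Carrier}
    (A : IsATF tmax a) (B : HasBreakpoints a tmax t) (0<ε : 0# < ε) where
    private
      module S = Sequence B
      open IsATF A

      flat : slope (S.μ 0) ≡ 0#
      flat = from-constant initiallyConstant
        where
        m = slope (S.μ 0)
        k = intercept (S.μ 0)
        from-constant : (∃ λ tmin → tmin ≤ tmax × (∀ t → t ≤ tmin → a t ≡ a tmin)) → m ≡ 0#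
        from-constant (tmin , _ , const) = begin
          m                                ≡⟨ sym (CR.*-identityʳ m) ⟩
          m * 1#                           ≡⟨ solve 4 (λ m k z i → m :* i := (m :* z :+ k) :- (m :* (z :- i) :+ k)) refl m k z 1# ⟩
          S.μ 0 at z - S.μ 0 at (z - 1#)   ≡⟨ cong₂ _-_ (sym (S.first z≤₀)) (sym (S.first (≤-trans z-1≤z z≤₀))) ⟩
          a z - a (z - 1#)                 ≡⟨ cong₂ _-_ (const z z≤tmin) (const (z - 1#) (≤-trans z-1≤z z≤tmin)) ⟩
          a tmin - a tmin                  ≡⟨ CR.-‿inverseʳ _ ⟩
          0#                               ∎
          where
          open ≡-Reasoning
          -- At `z` and `z - 1#` both the first line and the constancy of `a` apply, and the slope
          -- is the difference of the two values.
          z = min (S.τ 0) tmin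
          z≤₀ = min-≤ˡ (S.τ 0) tmin
          z≤tmin = min-≤ʳ (S.τ 0) tmin
          z-1≤z : z - 1# ≤ z
          z-1≤z = 0≤⇒≤ (≤-respʳ (solve 2 (λ z i → i := z :- (z :- i)) refl z 1#) (<⇒≤ 0<1))

    arrival : Instance
    arrival = record
      { n = n ; t = S.τ ; a = a ; ε = ε ; 0<ε = 0<ε ; t-rising = S.τ-rising
      ; a-affine = λ {i} p → S.μ (suc i) , S.next p
      ; a-const = λ {z} p → trans (S.first p) (trans (flat-line z) (sym (S.first ≤-refl)))
      ; a-mono = λ {x} {y} p q → nonDecreasing x y p (≤-respʳ S.τ-last q) }
      where
      flat-line : ∀ z → S.μ 0 at z ≡ S.μ 0 at S.τ 0
      flat-line z = cong (_+ intercept (S.μ 0))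
        (trans (cong (_* z) flat) (trans (CR.zeroˡ z) (sym (trans (cong (_* S.τ 0) flat) (CR.zeroˡ _)))))

  module Reading (I : Instance) where
    open Instance I
    open Corridor I

    competitor : ∀ {g n′} {t′ : Fin (suc n′) → Carrier} → HasBreakpoints g (t n) t′ → Within (t n) ε a g → Competitor
    competitor {g} {n′} B W = record
      { n′ = n′ ; τ = τ ; μ = μ ; g = g ; τ-rising = τ-rising ; τ-last = τ-last ; first = first ; next = next
      ; within = λ {z} p → inside (proj₁ (W z p)) (proj₂ (W z p)) }
      where open Sequence B

    module _ {v : View} (A : Answer v) where
      open Answer A
      open View v
      open Path path
      open Joined joined

      a′ : Carrier → Carrier
      a′ = pieces bx ln κ

      t′ : Fin (suc κ) → Carrier
      t′ i = bx (toℕ i)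

      private
        bx-sorted : ∀ {i} → i ℕ.< κ → bx i < bx (suc i)
        bx-sorted p = go (ℕ.m≤n⇒m<n∨m≡n p)
          where
          go : ∀ {i} → suc i ℕ.< κ ⊎ suc i ≡ κ → bx i < bx (suc i)
          go (inj₁ q)    = sorted q
          go (inj₂ refl) = <-respʳ (sym last-x) (before ℕ.≤-refl)

        on-first : ∀ {z} → z ≤ bx 0 → a′ z ≡ ln 0 at z
        on-first p = pieces-before κ ℕ.z≤n ℕ.≤-refl (λ _ → p)

        on-next : ∀ {i z} → i ℕ.< κ → bx i ≤ z → z ≤ bx (suc i) → a′ z ≡ ln (suc i) at z
        on-next {i} i<κ p q = trans (pieces-before κ i<κ ℕ.≤-refl (λ _ → q)) (pieces-from i i<κ p)

        ordinate : ∀ {i} → i ℕ.< κ ⊎ i ≡ κ → by i ≡ a′ (bx i)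
        ordinate (inj₁ p) = trans (height p) (sym (trans (pieces-before κ (ℕ.<⇒≤ p) ℕ.≤-refl (λ _ → ≤-refl)) (pieces-at _ p)))
        ordinate (inj₂ refl) = trans last-y (trans (cong (ln κ at_) (sym last-x))
          (sym (pieces-final κ (λ p → <-respʳ (sym last-x) (before p)))))

        -- `κ` is a projection and cannot be matched on; a copy of it can, and then `Piece` reduces.
        affine-piece : ∀ κ₀ → κ₀ ≡ κ → (i : Fin (suc κ₀)) → ∀ x → Piece {n = κ₀} (λ i → bx (toℕ i)) i x → a′ x ≡ ln (toℕ i) at x
        affine-piece _       _    fzero    x p       = on-first p
        affine-piece (suc _) refl (fsuc i) x (p , q) = on-next (Finₚ.toℕ<n i) (≤-respˡ (cong bx (Finₚ.toℕ-inject₁ i)) p) q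

      answer-stored : ∀ {σ} → view σ ≡ v → StoresBreakpoints σ a′ t′
      answer-stored refl = record
        { length = len≡ ; abscissae = λ _ → refl
        ; ordinates = λ i → ordinate (ℕ.m≤n⇒m<n∨m≡n (ℕ.s≤s⁻¹ (Finₚ.toℕ<n i))) }

      answer-breakpoints : HasBreakpoints a′ (t n) t′
      answer-breakpoints = record
        { sorted = λ i → <-respˡ (cong bx (sym (Finₚ.toℕ-inject₁ i))) (bx-sorted (Finₚ.toℕ<n i))
        ; last = trans (cong bx (Finₚ.toℕ-fromℕ κ)) last-x
        ; slope = λ i → slope (ln (toℕ i))
        ; affine = λ i → intercept (ln (toℕ i)) , affine-piece κ refl i
        ; bends = λ i eq → bend (Finₚ.toℕ<n i) (trans (cong (λ j → slope (ln j)) (sym (Finₚ.toℕ-inject₁ i))) eq) }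

      answer-within : Within (t n) ε a a′
      answer-within z p = valid p lower , inside-≤ (valid p)

      answer-fewest : FewestBreakpoints (t n) ε a (suc κ)
      answer-fewest g t″ B _ W = ℕ.s≤s (fewest (competitor B W))

      answer-atf : (∀ z → z ≤ t n → z ≤ a z) → IsATF (t n) a′
      answer-atf departs = record
        { piecewiseLinear = κ , t′ , answer-breakpoints
        ; continuous = lipschitz⇒continuous (proj₂ lipschitz) (t n)
        ; nonDecreasing = λ _ _ p _ → Lipschitz.mono (proj₂ lipschitz) p
        ; notBeforeDeparture = λ z p → ≤-trans (departs z p) (proj₁ (answer-within z p))
        ; initiallyConstant = bx 0 , ≤-respʳ last-x (rising⇒mono bx-sorted ℕ.z≤n ℕ.≤-refl) ,
            λ z p → trans (on-first p) (trans (flat-at (ln 0) flat z (bx 0)) (sym (on-first ≤-refl))) }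
        where lipschitz = pieces-lipschitz κ ℕ.≤-refl

  record _≤[_]·_ (x N A : ℕ) : Set where
    constructor by
    field bound : x ℕ.≤ A ℕ.* N
  open _≤[_]·_

  -- The left side has the shape of the time bound of `simplifyᴾ`. As `1 ≤ N`, a constant `k` is at
  -- most `k * N`, so every summand passes its coefficient on to the right side.
  linear : ∀ N → 1 ℕ.≤ N → ∀ k₀ K₁ k₁ k₂ K₂ k₃ k₄ K₃ k₅ k₆ k₇ k₈ k₉ K₄ l₀ l₁ l₂ →
    k₀ ℕ.+ ((N ℕ.* K₁ ℕ.+ k₁) ℕ.+ (k₂ ℕ.+ ((N ℕ.* K₂ ℕ.+ k₃) ℕ.+ (k₄ ℕ.+ ((N ℕ.* K₃ ℕ.+ k₅) ℕ.+
      (k₆ ℕ.+ ((k₇ ℕ.+ (k₈ ℕ.+ (k₉ ℕ.+ (((N ℕ.+ N) ℕ.* K₄ ℕ.+ l₀) ℕ.+ l₁)))) ℕ.+ l₂)))))))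
    ℕ.≤ (k₀ ℕ.+ ((K₁ ℕ.+ k₁) ℕ.+ (k₂ ℕ.+ ((K₂ ℕ.+ k₃) ℕ.+ (k₄ ℕ.+ ((K₃ ℕ.+ k₅) ℕ.+
      (k₆ ℕ.+ ((k₇ ℕ.+ (k₈ ℕ.+ (k₉ ℕ.+ (((K₄ ℕ.+ K₄) ℕ.+ l₀) ℕ.+ l₁)))) ℕ.+ l₂)))))))) ℕ.* N
  linear N 1≤N k₀ K₁ k₁ k₂ K₂ k₃ k₄ K₃ k₅ k₆ k₇ k₈ k₉ K₄ l₀ l₁ l₂ =
    bound (plus (const k₀) (plus (plus (times K₁) (const k₁)) (plus (const k₂) (plus (plus (times K₂) (const k₃)) (plus (const k₄)
      (plus (plus (times K₃) (const k₅)) (plus (const k₆) (plus (plus (const k₇) (plus (const k₈) (plus (const k₉)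
        (plus (plus twice (const l₀)) (const l₁))))) (const l₂)))))))))
    where
    plus : ∀ {x y A B} → x ≤[ N ]· A → y ≤[ N ]· B → (x ℕ.+ y) ≤[ N ]· (A ℕ.+ B)
    plus {A = A} {B} p q = by (ℕ.≤-trans (ℕ.+-mono-≤ (bound p) (bound q)) (ℕ.≤-reflexive (sym (ℕ.*-distribʳ-+ N A B))))
    const : ∀ k → k ≤[ N ]· k
    const k = by (ℕ.≤-trans (ℕ.≤-reflexive (sym (ℕ.*-identityʳ k))) (ℕ.*-monoʳ-≤ k 1≤N))
    times : ∀ K → (N ℕ.* K) ≤[ N ]· K
    times K = by (ℕ.≤-reflexive (ℕ.*-comm N K))
    twice : ((N ℕ.+ N) ℕ.* K₄) ≤[ N ]· (K₄ ℕ.+ K₄)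
    twice = by (ℕ.≤-trans (ℕ.≤-reflexive (ℕ.*-distribʳ-+ K₄ N N)) (bound (plus (times K₄) (times K₄))))

  -- A hull vertex has to pay for one iteration of either inner loop, and the sum of the two costs
  -- is at least each of them.
  turnStepCost popStepCost hullCost : ℕ
  turnStepCost = suc (costᴮ turnTest ℕ.+ cost (rXb ≔ inc (reg rXb)))
  popStepCost = suc (costᴮ popTest ℕ.+ cost (rYt ≔ dec (reg rYt)))
  hullCost = turnStepCost ℕ.+ popStepCost

  open Costs hullCost

  rate : ℕ
  rate = cost clearᴾ ℕ.+ ((copyCost lowerᴱ ℕ.+ suc (costᴮ copyTest)) ℕ.+ (cost (rXi ≔ lit 0) ℕ.+ ((copyCost upperᴱ ℕ.+ suc (costᴮ copyTest)) ℕ.+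
    (cost initᴾ ℕ.+ ((suc (costᴮ scanTest ℕ.+ scanCost) ℕ.+ suc (costᴮ scanTest)) ℕ.+
      (suc (costᴮ mainTest) ℕ.+ ((cost swapᴾ ℕ.+ (cost startStageᴾ ℕ.+ (finishCost ℕ.+
        (((suc (costᴮ mainTest ℕ.+ bodyCost) ℕ.+ suc (costᴮ mainTest ℕ.+ bodyCost)) ℕ.+ suc (costᴮ mainTest)) ℕ.+ cost finalᴾ)))) ℕ.+ cost constantᴾ)))))))

  module _ (I : Instance) where
    open Instance I
    open Simplification hullCost (ℕ.m≤m+n turnStepCost popStepCost) (ℕ.m≤n+m popStepCost turnStepCost) I
    open Corridor I

    simplify-linear : ∀ σ → Input σ → Halts simplifyᴾ σ (λ σ′ → Answer (view σ′)) (rate ℕ.* suc n)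
    simplify-linear σ In = slower (simplify-halts σ In)
      where
      slower : _ → _
      slower (s , σ′ , r , A , le) = s , σ′ , r , A , ℕ.≤-trans le
        (linear (suc n) (ℕ.s≤s ℕ.z≤n) (cost clearᴾ) (copyCost lowerᴱ) (suc (costᴮ copyTest)) (cost (rXi ≔ lit 0)) (copyCost upperᴱ)
          (suc (costᴮ copyTest)) (cost initᴾ) (suc (costᴮ scanTest ℕ.+ scanCost)) (suc (costᴮ scanTest)) (suc (costᴮ mainTest))
          (cost swapᴾ) (cost startStageᴾ) finishCost (suc (costᴮ mainTest ℕ.+ bodyCost)) (suc (costᴮ mainTest)) (cost finalᴾ) (cost constantᴾ))

  module _ {tmax ε : Carrier} {a : Carrier → Carrier} {n} {t : Fin (suc n) → Carrier} {σ : Store}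
    (A : IsATF tmax a) (B : HasBreakpoints a tmax t) (0<ε : 0# < ε) (stored : StoresBreakpoints σ a t) (ε≡ : StoresScalar σ ε) where
    private
      I = arrival A B 0<ε
      open Corridor I
      open Reading I
      module In = StoresBreakpoints stored
      module S = Sequence B

      at-index : ∀ {p} {P : ℕ → Set p} → (∀ (i : Fin (suc n)) → P (toℕ i)) → ∀ {i} → i ℕ.≤ n → P i
      at-index {P = P} f i≤n = subst P (Finₚ.toℕ-fromℕ< (ℕ.s≤s i≤n)) (f (fromℕ< (ℕ.s≤s i≤n)))

      input : Simplification.Input hullCost (ℕ.m≤m+n turnStepCost popStepCost) (ℕ.m≤n+m popStepCost turnStepCost) I σ
      input = record
        { len≡ = In.length
        ; bx≡ = at-index {P = λ i → array σ aBx i ≡ S.τ i} (λ i → trans (In.abscissae i) (sym (extend-toℕ t i)))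
        ; by≡ = at-index {P = λ i → array σ aBy i ≡ a (S.τ i)} (λ i → trans (In.ordinates i) (cong a (sym (extend-toℕ t i))))
        ; ε≡ = ε≡ }

      Solved : Carrier → Store → Set (c ⊔ ℓ)
      Solved T σ′ = Σ[ a′ ∈ (Carrier → Carrier) ] Σ[ n′ ∈ ℕ ] Σ[ t′ ∈ (Fin (suc n′) → Carrier) ]
        StoresBreakpoints σ′ a′ t′ × IsATF T a′ × HasBreakpoints a′ T t′ × Within T ε a a′ × FewestBreakpoints T ε a (suc n′)

    solved : Σ[ s ∈ ℕ ] Σ[ σ′ ∈ Store ] (simplifyᴾ , σ ⇓[ s ] σ′) × s ℕ.≤ rate ℕ.* suc n × Solved tmax σ′
    solved = read (simplify-linear I σ input)
      where
      read : Σ[ s ∈ ℕ ] Σ[ σ′ ∈ Store ] (simplifyᴾ , σ ⇓[ s ] σ′) × Answer (view σ′) × s ℕ.≤ rate ℕ.* suc n → _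
      read (s , σ′ , r , ans , le) = s , σ′ , r , le , subst (λ T → Solved T σ′) S.τ-last
        (a′ ans , Answer.κ ans , t′ ans , answer-stored ans refl ,
         answer-atf ans (λ z p → IsATF.notBeforeDeparture A z (≤-respʳ S.τ-last p)) ,
         answer-breakpoints ans , answer-within ans , answer-fewest ans)

mainTheorem7 : ∀ {c ℓ} (F : OrderedField c ℓ) →
  let open OrderedField F
      open PiecewiseLinear F
      open RealRAM F
  in
  ∃[ p ] Σ[ C ∈ ℕ ]
  ∀ (tmax ε : Carrier) (a : Carrier → Carrier) {n} (t : Fin (suc n) → Carrier) (σ : Store) →
  IsATF tmax a → HasBreakpoints a tmax t → 0# < ε →
  StoresBreakpoints σ a t → StoresScalar σ ε →
  Σ[ steps ∈ ℕ ] Σ[ σ′ ∈ Store ]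
    (p , σ ⇓[ steps ] σ′) ×
    steps ℕ.≤ C ℕ.* suc n ×
    Σ[ a′ ∈ (Carrier → Carrier) ] Σ[ n′ ∈ ℕ ] Σ[ t′ ∈ (Fin (suc n′) → Carrier) ]
      StoresBreakpoints σ′ a′ t′ ×
      IsATF tmax a′ ×
      HasBreakpoints a′ tmax t′ ×
      Within tmax ε a a′ ×
      FewestBreakpoints tmax ε a (suc n′)
mainTheorem7 F = simplifyᴾ , Conclusion.rate F ,
  λ tmax ε a t σ A B 0<ε stored ε≡ → Conclusion.solved F A B 0<ε stored ε≡
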